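{- Let $(\nu_n)_{n=1}^\infty$ be an increasing sequence of positive integers, and let $\alpha=\liminf_{n\to\infty}\frac{\nu_n}{n}\in[0,\infty]$. Define \[F((\nu_n)_{n=1}^\infty)=\{x\in J\colon a_{n}(x),\ldots,a_{n+\nu_n-1}(x)\ \text{is an arithmetic progression for infinitely many}\ n\geq1\}.\] Then \[\dim_{\rm H} F((\nu_n)_{n=1}^\infty)=\begin{cases}\dfrac{1}{2(1+\alpha)}&\text{if }\alpha<\infty,\\ 0&\text{otherwise.}\end{cases}\]
   Context: Every irrational $x\in(0,1)$ has a regular continued fraction expansion $x=\cfrac{1}{a_1(x)+\cfrac{1}{a_2(x)+\cdots}}$ with partial quotients $a_n(x)\in\mathbb N$. $J=\{x\in(0,1)\setminus\mathbb Q\colon a_n(x)<a_{n+1}(x)\text{ for every }n\ge1\}$. $\dim_{\rm H}$ denotes Hausdorff dimension in $[0,1]$ with the Euclidean metric. -}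

module Defs where

open import Data.Empty using (⊥)
open import Data.Integer.Base as ℤ using (ℤ; +_)
open import Data.Nat.Base as ℕ using (ℕ; zero; suc)
import Data.Nat.Properties as ℕₚ
open import Data.Nat.InfinitelyOften using () renaming (Inf to InfinitelyOften)
open import Data.Product.Base using (Σ; ∃; _×_; _,_)
open import Data.Rational.Base as ℚ using (ℚ; 0ℚ; 1ℚ; ½)
import Data.Rational.Properties as ℚₚ
open import Data.Rational.Solver using (module +-*-Solver)
open import Data.Sum.Base using (inj₁; inj₂)
open import Data.Unit.Base using (⊤)
open import Function.Base using (_∘_; flip)
open import Level using (Level; 0ℓ; _⊔_) renaming (suc to lsuc)
open import Relation.Binary.Core using (Rel)
open import Relation.Binary.Definitions using (_Respects_)
open import Relation.Binary.PropositionalEquality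
  using (_≡_; refl; sym; trans; cong; cong₂; subst)
open import Relation.Nullary using (¬_; yes; no)
open import Relation.Unary using (Pred; Empty; Satisfiable; _⊆_)

private
  variable
    a p r : Level

-- The sequences (ν_n) and (a_n), n ≥ 1, are indexed from 0: ν k stands for
-- ν_{k+1} and a k for a_{k+1}.

-- Reals are Cauchy sequences of rationals, taken up to _≈_.

IsCauchy : (ℕ → ℚ) → Set
IsCauchy f = ∀ ε → 0ℚ ℚ.< ε →
  ∃ λ N → ∀ m n → N ℕ.≤ m → N ℕ.≤ n → ℚ.∣ f m ℚ.- f n ∣ ℚ.≤ ε

record ℝ : Set where
  constructor mkℝ
  field
    seq    : ℕ → ℚ
    cauchy : IsCauchy seq

open ℝ public

infix 4 _≤_ _<_ _≈_

_≤_ : Rel ℝ 0ℓ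
x ≤ y = ∀ ε → 0ℚ ℚ.< ε → ∃ λ N → ∀ n → N ℕ.≤ n → seq x n ℚ.≤ seq y n ℚ.+ ε

_<_ : Rel ℝ 0ℓ
x < y = ∃ λ ε → 0ℚ ℚ.< ε ×
  (∃ λ N → ∀ n → N ℕ.≤ n → seq x n ℚ.+ ε ℚ.≤ seq y n)

_≈_ : Rel ℝ 0ℓ
x ≈ y = x ≤ y × y ≤ x

-- abstract: otherwise the checker unfolds these proofs inside every real
-- expression below.
private
  abstract
    half+half : ∀ ε → ½ ℚ.* ε ℚ.+ ½ ℚ.* ε ≡ ε
    half+half ε = trans (sym (ℚₚ.*-distribʳ-+ ε ½ ½)) (ℚₚ.*-identityˡ ε)

    half-pos : ∀ {ε} → 0ℚ ℚ.< ε → 0ℚ ℚ.< ½ ℚ.* ε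
    half-pos {ε} ε>0 =
      subst (ℚ._< ½ ℚ.* ε) (ℚₚ.*-zeroʳ ½) (ℚₚ.*-monoʳ-<-pos ½ ε>0)

    +-cauchy : ∀ {f g} → IsCauchy f → IsCauchy g → IsCauchy (λ n → f n ℚ.+ g n)
    +-cauchy {f} {g} cf cg ε ε>0 with cf (½ ℚ.* ε) (half-pos ε>0) | cg (½ ℚ.* ε) (half-pos ε>0)
    ... | M , hf | N , hg = M ℕ.⊔ N , λ m n m≥ n≥ → begin
      ℚ.∣ (f m ℚ.+ g m) ℚ.- (f n ℚ.+ g n) ∣
        ≡⟨ cong ℚ.∣_∣ (regroup (f m) (g m) (f n) (g n)) ⟩
      ℚ.∣ (f m ℚ.- f n) ℚ.+ (g m ℚ.- g n) ∣
        ≤⟨ ℚₚ.∣p+q∣≤∣p∣+∣q∣ (f m ℚ.- f n) (g m ℚ.- g n) ⟩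
      ℚ.∣ f m ℚ.- f n ∣ ℚ.+ ℚ.∣ g m ℚ.- g n ∣
        ≤⟨ ℚₚ.+-mono-≤
             (hf m n (ℕₚ.m⊔n≤o⇒m≤o M N m≥) (ℕₚ.m⊔n≤o⇒m≤o M N n≥))
             (hg m n (ℕₚ.m⊔n≤o⇒n≤o M N m≥) (ℕₚ.m⊔n≤o⇒n≤o M N n≥)) ⟩
      ½ ℚ.* ε ℚ.+ ½ ℚ.* ε
        ≡⟨ half+half ε ⟩
      ε ∎
      where
      open ℚₚ.≤-Reasoning
      open +-*-Solver
      regroup : ∀ a b c d → (a ℚ.+ b) ℚ.- (c ℚ.+ d) ≡ (a ℚ.- c) ℚ.+ (b ℚ.- d)
      regroup = solve 4 (λ a b c d → (a :+ b) :- (c :+ d) := (a :- c) :+ (b :- d)) refl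

    neg-cauchy : ∀ {f} → IsCauchy f → IsCauchy (λ n → ℚ.- f n)
    neg-cauchy {f} cf ε ε>0 with cf ε ε>0
    ... | N , h = N , λ m n m≥ n≥ → subst (ℚ._≤ ε)
      (trans (sym (ℚₚ.∣-p∣≡∣p∣ (f m ℚ.- f n)))
             (cong ℚ.∣_∣ (ℚₚ.neg-distrib-+ (f m) (ℚ.- f n))))
      (h m n m≥ n≥)

    ∣p∣≤∣p-q∣+∣q∣ : ∀ p q → ℚ.∣ p ∣ ℚ.≤ ℚ.∣ p ℚ.- q ∣ ℚ.+ ℚ.∣ q ∣
    ∣p∣≤∣p-q∣+∣q∣ p q = begin
      ℚ.∣ p ∣                       ≡⟨ cong ℚ.∣_∣ (split p q) ⟩
      ℚ.∣ (p ℚ.- q) ℚ.+ q ∣         ≤⟨ ℚₚ.∣p+q∣≤∣p∣+∣q∣ (p ℚ.- q) q ⟩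
      ℚ.∣ p ℚ.- q ∣ ℚ.+ ℚ.∣ q ∣     ∎
      where
      open ℚₚ.≤-Reasoning
      open +-*-Solver
      split : ∀ p q → p ≡ (p ℚ.- q) ℚ.+ q
      split = solve 2 (λ p q → p := (p :- q) :+ q) refl

    ∣p∣-∣q∣≤∣p-q∣ : ∀ p q → ℚ.∣ p ∣ ℚ.- ℚ.∣ q ∣ ℚ.≤ ℚ.∣ p ℚ.- q ∣
    ∣p∣-∣q∣≤∣p-q∣ p q = begin
      ℚ.∣ p ∣ ℚ.- ℚ.∣ q ∣                          ≤⟨ ℚₚ.+-monoˡ-≤ (ℚ.- ℚ.∣ q ∣) (∣p∣≤∣p-q∣+∣q∣ p q) ⟩
      (ℚ.∣ p ℚ.- q ∣ ℚ.+ ℚ.∣ q ∣) ℚ.- ℚ.∣ q ∣      ≡⟨ cancel ℚ.∣ p ℚ.- q ∣ ℚ.∣ q ∣ ⟩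
      ℚ.∣ p ℚ.- q ∣                                ∎
      where
      open ℚₚ.≤-Reasoning
      open +-*-Solver
      cancel : ∀ a b → (a ℚ.+ b) ℚ.- b ≡ a
      cancel = solve 2 (λ a b → (a :+ b) :- b := a) refl

    neg-sub : ∀ p q → ℚ.- (p ℚ.- q) ≡ q ℚ.- p
    neg-sub = solve 2 (λ p q → :- (p :- q) := q :- p) refl
      where open +-*-Solver

    ∣∣p∣-∣q∣∣≤∣p-q∣ : ∀ p q → ℚ.∣ ℚ.∣ p ∣ ℚ.- ℚ.∣ q ∣ ∣ ℚ.≤ ℚ.∣ p ℚ.- q ∣
    ∣∣p∣-∣q∣∣≤∣p-q∣ p q with ℚₚ.∣p∣≡p∨∣p∣≡-p (ℚ.∣ p ∣ ℚ.- ℚ.∣ q ∣)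
    ... | inj₁ eq = subst (ℚ._≤ ℚ.∣ p ℚ.- q ∣) (sym eq) (∣p∣-∣q∣≤∣p-q∣ p q)
    ... | inj₂ eq = begin
      ℚ.∣ ℚ.∣ p ∣ ℚ.- ℚ.∣ q ∣ ∣      ≡⟨ eq ⟩
      ℚ.- (ℚ.∣ p ∣ ℚ.- ℚ.∣ q ∣)      ≡⟨ neg-sub ℚ.∣ p ∣ ℚ.∣ q ∣ ⟩
      ℚ.∣ q ∣ ℚ.- ℚ.∣ p ∣            ≤⟨ ∣p∣-∣q∣≤∣p-q∣ q p ⟩
      ℚ.∣ q ℚ.- p ∣                  ≡⟨ cong ℚ.∣_∣ (neg-sub p q) ⟨
      ℚ.∣ ℚ.- (p ℚ.- q) ∣            ≡⟨ ℚₚ.∣-p∣≡∣p∣ (p ℚ.- q) ⟩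
      ℚ.∣ p ℚ.- q ∣                  ∎
      where open ℚₚ.≤-Reasoning

    abs-cauchy : ∀ {f} → IsCauchy f → IsCauchy (λ n → ℚ.∣ f n ∣)
    abs-cauchy {f} cf ε ε>0 with cf ε ε>0
    ... | N , h = N , λ m n m≥ n≥ → ℚₚ.≤-trans (∣∣p∣-∣q∣∣≤∣p-q∣ (f m) (f n)) (h m n m≥ n≥)

    bounded : ∀ {f} → IsCauchy f →
              ∃ λ B → ℚ.Positive B × (∃ λ N → ∀ n → N ℕ.≤ n → ℚ.∣ f n ∣ ℚ.≤ B)
    bounded {f} cf with cf 1ℚ (ℚₚ.positive⁻¹ 1ℚ)
    ... | N , h =
      ℚ.∣ f N ∣ ℚ.+ 1ℚ ,
      ℚₚ.nonNeg+pos⇒pos ℚ.∣ f N ∣ {{ℚₚ.∣-∣-nonNeg (f N)}} 1ℚ ,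
      N ,
      λ n n≥ → begin
        ℚ.∣ f n ∣                            ≤⟨ ∣p∣≤∣p-q∣+∣q∣ (f n) (f N) ⟩
        ℚ.∣ f n ℚ.- f N ∣ ℚ.+ ℚ.∣ f N ∣      ≤⟨ ℚₚ.+-monoˡ-≤ ℚ.∣ f N ∣ (h n N n≥ ℕₚ.≤-refl) ⟩
        1ℚ ℚ.+ ℚ.∣ f N ∣                     ≡⟨ ℚₚ.+-comm 1ℚ ℚ.∣ f N ∣ ⟩
        ℚ.∣ f N ∣ ℚ.+ 1ℚ                     ∎
      where open ℚₚ.≤-Reasoning

    scale : ∀ ε B → 0ℚ ℚ.< ε → ℚ.Positive B → ∃ λ δ → 0ℚ ℚ.< δ × B ℚ.* δ ≡ ε
    scale ε B ε>0 B>0 = B⁻¹ ℚ.* ε , δ>0 , B*δ≡ε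
      where
      B⁻¹ : ℚ
      B⁻¹ = ℚ.1/_ B {{ℚₚ.pos⇒nonZero B {{B>0}}}}
      δ>0 : 0ℚ ℚ.< B⁻¹ ℚ.* ε
      δ>0 = ℚₚ.positive⁻¹ (B⁻¹ ℚ.* ε)
              {{ℚₚ.pos*pos⇒pos B⁻¹ {{ℚₚ.1/pos⇒pos B {{B>0}}}} ε {{ℚ.positive ε>0}}}}
      B*δ≡ε : B ℚ.* (B⁻¹ ℚ.* ε) ≡ ε
      B*δ≡ε = trans (sym (ℚₚ.*-assoc B B⁻¹ ε))
                (trans (cong (ℚ._* ε) (ℚₚ.*-inverseʳ B {{ℚₚ.pos⇒nonZero B {{B>0}}}}))
                       (ℚₚ.*-identityˡ ε))

    ∣p*q∣≤r*s : ∀ {p q} r s → ℚ.∣ p ∣ ℚ.≤ r → ℚ.∣ q ∣ ℚ.≤ s → ℚ.∣ p ℚ.* q ∣ ℚ.≤ r ℚ.* s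
    ∣p*q∣≤r*s {p} {q} r s p≤r q≤s = begin
      ℚ.∣ p ℚ.* q ∣            ≡⟨ ℚₚ.∣p*q∣≡∣p∣*∣q∣ p q ⟩
      ℚ.∣ p ∣ ℚ.* ℚ.∣ q ∣      ≤⟨ ℚₚ.*-monoʳ-≤-nonNeg ℚ.∣ q ∣ {{ℚₚ.∣-∣-nonNeg q}} p≤r ⟩
      r ℚ.* ℚ.∣ q ∣            ≤⟨ ℚₚ.*-monoˡ-≤-nonNeg r {{ℚ.nonNegative (ℚₚ.≤-trans (ℚₚ.0≤∣p∣ p) p≤r)}} q≤s ⟩
      r ℚ.* s                  ∎
      where open ℚₚ.≤-Reasoning

    product-gap : ∀ a b c d {B C δ δ′} →
                  ℚ.∣ a ∣ ℚ.≤ B → ℚ.∣ b ℚ.- d ∣ ℚ.≤ δ →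
                  ℚ.∣ d ∣ ℚ.≤ C → ℚ.∣ a ℚ.- c ∣ ℚ.≤ δ′ →
                  ℚ.∣ a ℚ.* b ℚ.- c ℚ.* d ∣ ℚ.≤ B ℚ.* δ ℚ.+ C ℚ.* δ′
    product-gap a b c d {B} {C} {δ} {δ′} a≤B bd≤δ d≤C ac≤δ′ = begin
      ℚ.∣ a ℚ.* b ℚ.- c ℚ.* d ∣
        ≡⟨ cong ℚ.∣_∣ (regroup a b c d) ⟩
      ℚ.∣ a ℚ.* (b ℚ.- d) ℚ.+ d ℚ.* (a ℚ.- c) ∣
        ≤⟨ ℚₚ.∣p+q∣≤∣p∣+∣q∣ (a ℚ.* (b ℚ.- d)) (d ℚ.* (a ℚ.- c)) ⟩
      ℚ.∣ a ℚ.* (b ℚ.- d) ∣ ℚ.+ ℚ.∣ d ℚ.* (a ℚ.- c) ∣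
        ≤⟨ ℚₚ.+-mono-≤ (∣p*q∣≤r*s {a} {b ℚ.- d} B δ a≤B bd≤δ)
                       (∣p*q∣≤r*s {d} {a ℚ.- c} C δ′ d≤C ac≤δ′) ⟩
      B ℚ.* δ ℚ.+ C ℚ.* δ′ ∎
      where
      open ℚₚ.≤-Reasoning
      open +-*-Solver
      regroup : ∀ a b c d → a ℚ.* b ℚ.- c ℚ.* d ≡ a ℚ.* (b ℚ.- d) ℚ.+ d ℚ.* (a ℚ.- c)
      regroup = solve 4 (λ a b c d → a :* b :- c :* d := a :* (b :- d) :+ d :* (a :- c)) refl

    *-cauchy : ∀ {f g} → IsCauchy f → IsCauchy g → IsCauchy (λ n → f n ℚ.* g n)
    *-cauchy {f} {g} cf cg ε ε>0 =
      let B , B>0 , N₁ , f≤B = bounded cf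
          C , C>0 , N₂ , g≤C = bounded cg
          δ  , δ>0  , Bδ  = scale (½ ℚ.* ε) B (half-pos ε>0) B>0
          δ′ , δ′>0 , Cδ′ = scale (½ ℚ.* ε) C (half-pos ε>0) C>0
          N₃ , hf = cf δ′ δ′>0
          N₄ , hg = cg δ δ>0
          M₁ = N₁ ℕ.⊔ N₂
          M₂ = N₃ ℕ.⊔ N₄
      in M₁ ℕ.⊔ M₂ , λ m n m≥ n≥ →
        let m≥M₁ = ℕₚ.m⊔n≤o⇒m≤o M₁ M₂ m≥
            m≥M₂ = ℕₚ.m⊔n≤o⇒n≤o M₁ M₂ m≥
            n≥M₁ = ℕₚ.m⊔n≤o⇒m≤o M₁ M₂ n≥
            n≥M₂ = ℕₚ.m⊔n≤o⇒n≤o M₁ M₂ n≥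
        in subst (ℚ.∣ f m ℚ.* g m ℚ.- f n ℚ.* g n ∣ ℚ.≤_)
             (trans (cong₂ ℚ._+_ Bδ Cδ′) (half+half ε))
             (product-gap (f m) (g m) (f n) (g n)
               (f≤B m (ℕₚ.m⊔n≤o⇒m≤o N₁ N₂ m≥M₁))
               (hg m n (ℕₚ.m⊔n≤o⇒n≤o N₃ N₄ m≥M₂) (ℕₚ.m⊔n≤o⇒n≤o N₃ N₄ n≥M₂))
               (g≤C n (ℕₚ.m⊔n≤o⇒n≤o N₁ N₂ n≥M₁))
               (hf m n (ℕₚ.m⊔n≤o⇒m≤o N₃ N₄ m≥M₂) (ℕₚ.m⊔n≤o⇒m≤o N₃ N₄ n≥M₂)))

    const-cauchy : ∀ q → IsCauchy (λ _ → q)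
    const-cauchy q ε ε>0 = 0 , λ _ _ _ _ →
      subst (ℚ._≤ ε) (sym (cong ℚ.∣_∣ (ℚₚ.+-inverseʳ q))) (ℚₚ.<⇒≤ ε>0)

fromℚ : ℚ → ℝ
fromℚ q = mkℝ (λ _ → q) (const-cauchy q)

0ℝ 1ℝ 2ℝ : ℝ
0ℝ = fromℚ 0ℚ
1ℝ = fromℚ 1ℚ
2ℝ = fromℚ (+ 2 ℚ./ 1)

infixr 8 _^_
infix  8 -_
infixl 7 _*_
infixl 6 _+_ _-_

_+_ : ℝ → ℝ → ℝ
x + y = mkℝ (λ n → seq x n ℚ.+ seq y n) (+-cauchy {seq x} {seq y} (cauchy x) (cauchy y))

-_ : ℝ → ℝ
- x = mkℝ (λ n → ℚ.- seq x n) (neg-cauchy {seq x} (cauchy x))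

_-_ : ℝ → ℝ → ℝ
x - y = x + (- y)

_*_ : ℝ → ℝ → ℝ
x * y = mkℝ (λ n → seq x n ℚ.* seq y n) (*-cauchy {seq x} {seq y} (cauchy x) (cauchy y))

∣_∣ : ℝ → ℝ
∣ x ∣ = mkℝ (λ n → ℚ.∣ seq x n ∣) (abs-cauchy {seq x} (cauchy x))

_^_ : ℝ → ℕ → ℝ
x ^ zero  = 1ℝ
x ^ suc n = x * x ^ n

-- ∑ t n = t 0 + … + t (n - 1)
∑ : (ℕ → ℝ) → ℕ → ℝ
∑ t zero    = 0ℝ
∑ t (suc n) = ∑ t n + t n

_⟶_ : (ℕ → ℝ) → ℝ → Set
u ⟶ x = ∀ ε → 0ℝ < ε → ∃ λ N → ∀ n → N ℕ.≤ n → ∣ u n - x ∣ ≤ ε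

Irrational : Pred ℝ 0ℓ
Irrational x = ∀ q → ¬ (x ≈ fromℚ q)

UnitInterval : Pred ℝ 0ℓ
UnitInterval x = 0ℝ ≤ x × x ≤ 1ℝ

IsSup : {A : Set a} → Rel A r → Pred A p → A → Set (a ⊔ r ⊔ p)
IsSup _≲_ P s = (∀ y → P y → y ≲ s) × (∀ b → (∀ y → P y → y ≲ b) → s ≲ b)

IsInf : {A : Set a} → Rel A r → Pred A p → A → Set (a ⊔ r ⊔ p)
IsInf _≲_ = IsSup (flip _≲_)

-- (-∞, ∞]
data ℝ∞ : Set where
  fin : ℝ → ℝ∞
  ∞   : ℝ∞

infix 4 _≤∞_

_≤∞_ : Rel ℝ∞ 0ℓ
fin x ≤∞ fin y = x ≤ y
∞     ≤∞ fin y = ⊥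
_     ≤∞ ∞     = ⊤

-- lim inf u = sup over n of inf {u m | m ≥ n}
IsLiminf : (ℕ → ℝ∞) → ℝ∞ → Set
IsLiminf u α = ∃ λ (i : ℕ → ℝ∞) →
  (∀ n → IsInf _≤∞_ (λ y → ∃ λ m → n ℕ.≤ m × y ≡ u m) (i n)) ×
  IsSup _≤∞_ (λ y → ∃ λ n → y ≡ i n) α

-- y = x ^ s for real x ∈ [0,1] and s ≥ 0, as the supremum of the rational
-- powers x ^ (m / (k + 1)) with m / (k + 1) ≥ s.  For x ∈ [0,1] the powers
-- decrease in the exponent.  The convention is 0 ^ 0 = 1.
IsPower : ℝ → ℝ → ℝ → Set
IsPower x s y = IsSup _≤_
  (λ z → ∃ λ m → ∃ λ k →
     s ≤ fromℚ (+ m ℚ./ suc k) × 0ℝ ≤ z × z ^ suc k ≈ x ^ m)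
  y

IsDiam : Pred ℝ 0ℓ → ℝ → Set
IsDiam U = IsSup _≤_ (λ r → ∃ λ x → ∃ λ y → U x × U y × r ≡ ∣ x - y ∣)

-- IsWeight s U w : w = (diam U) ^ s, where the empty set has weight 0 for
-- every s, including s = 0.
data IsWeight (s : ℝ) (U : Pred ℝ 0ℓ) : ℝ → Set where
  empty    : Empty U → IsWeight s U 0ℝ
  nonempty : ∀ {d w} → Satisfiable U → IsDiam U d → IsPower d s w → IsWeight s U w

-- The ambient space is [0,1] with the distance ∣ x - y ∣.
record Cover (δ : ℝ) (F : Pred ℝ 0ℓ) : Set (lsuc 0ℓ) where
  field
    piece      : ℕ → Pred ℝ 0ℓ
    respects-≈ : ∀ i → piece i Respects _≈_
    ⊆-unit     : ∀ i → piece i ⊆ UnitInterval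
    diam≤δ     : ∀ i {x y} → piece i x → piece i y → ∣ x - y ∣ ≤ δ
    covers     : ∀ {x} → F x → ∃ λ i → piece i x

open Cover public

-- h = inf over δ-covers of ∑ᵢ (diam Uᵢ) ^ s, each sum taken in [0,∞].
IsHausdorffContent : ℝ → ℝ → Pred ℝ 0ℓ → ℝ∞ → Set (lsuc 0ℓ)
IsHausdorffContent s δ F = IsInf _≤∞_ λ total →
  Σ (Cover δ F) λ C → ∃ λ (w : ℕ → ℝ) →
    (∀ i → IsWeight s (piece C i) (w i)) ×
    IsSup _≤∞_ (λ y → ∃ λ n → y ≡ fin (∑ w n)) total

IsHausdorffMeasure : ℝ → Pred ℝ 0ℓ → ℝ∞ → Set (lsuc 0ℓ)
IsHausdorffMeasure s F μ = ∃ λ (h : ℝ → ℝ∞) →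
  (∀ δ → 0ℝ < δ → IsHausdorffContent s δ F (h δ)) ×
  IsSup _≤∞_ (λ y → ∃ λ δ → 0ℝ < δ × y ≡ h δ) μ

IsHausdorffDim : Pred ℝ 0ℓ → ℝ → Set (lsuc 0ℓ)
IsHausdorffDim F = IsInf _≤_ (λ s → 0ℝ ≤ s × IsHausdorffMeasure s F (fin 0ℝ))

-- 1 / q, with the junk value 0 at q = 0.
recip : ℚ → ℚ
recip q with q ℚₚ.≟ 0ℚ
... | yes _   = 0ℚ
... | no  q≢0 = ℚ.1/_ q {{ℚ.≢-nonZero q≢0}}

-- The finite continued fraction with partial quotients a 0, …, a (n - 1).
convergent : (ℕ → ℕ) → ℕ → ℚ
convergent a zero    = 0ℚ
convergent a (suc n) = recip (+ a 0 ℚ./ 1 ℚ.+ convergent (a ∘ suc) n)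

ArePartialQuotients : ℝ → (ℕ → ℕ) → Set
ArePartialQuotients x a = (∀ k → 1 ℕ.≤ a k) × (fromℚ ∘ convergent a) ⟶ x

-- Partial quotients of an irrational are unique, so "∃ a" here and in F
-- speaks about the expansion of x.
J : Pred ℝ 0ℓ
J x = 0ℝ < x × x < 1ℝ × Irrational x ×
      (∃ λ a → ArePartialQuotients x a × (∀ k → a k ℕ.< a (suc k)))

-- Every block of length at most 2 counts as an arithmetic progression.
IsArithProg : (ℕ → ℕ) → ℕ → ℕ → Set
IsArithProg a k len = ∃ λ (d : ℤ) →
  ∀ i → i ℕ.< len → + a (k ℕ.+ i) ≡ + a k ℤ.+ + i ℤ.* d

F : (ℕ → ℕ) → Pred ℝ 0ℓ
F ν x = J x ×
  (∃ λ a → ArePartialQuotients x a × InfinitelyOften (λ k → IsArithProg a k (ν k)))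

{-# OPTIONS --safe #-}

-- Upper bound.  Let the block at k be an arithmetic progression with ν k ≥ β k.  From its second digit on, the
-- block is at least a (k + 1), so the cylinder fixed by the first k + 2 digits and the block has diameter at
-- most P^{-2(1+β)}, where P is the product of these k + 2 digits.  The digits increase, so cylinders correspond
-- to finite subsets S of {1, 2, …}, and ∑_S ∏_{d ∈ S} d^{-t} = ∏_d (1 + d^{-t}) converges for t = 2(1+β)s > 1.
-- The subsets with at least N elements therefore give covers of arbitrarily small total s-weight.
--
-- Lower bound.  Let γ > α and 2(1+γ)s < 1.  Choose digits a_n freely in [n m, (n+1) m) with m ≈ n^K, and at
-- very sparse places N with ν N ≤ γ N insert progressions of difference 1, which are forced.  Give all choices
-- equal mass.  Points that first differ at digit n + 1 are, up to constants, at least ∏_{i ≤ n+1} a_i^{-2}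
-- apart, and the s-th power of this distance dominates the mass of a cylinder of order n when K is large.  So
-- each set of a cover kills at most one cylinder, whose mass its s-weight bounds, and a cover of small total
-- weight misses a point.

module Submission where

open import Defs
open import Axiom.ExcludedMiddle using (ExcludedMiddle)
open import Algebra.Bundles using (AbelianGroup; CommutativeRing)
import Algebra.Properties.Group as GroupProperties
open import Data.Empty using (⊥; ⊥-elim)
open import Data.Integer.Base as ℤ using (+_)
import Data.Integer.Properties as ℤₚ
open import Data.List.Base as List using (List; []; _∷_)
open import Data.List.Properties using (∷-injectiveˡ; ∷-injectiveʳ)
open import Data.Nat.Base as ℕ using (ℕ; zero; suc)
open import Data.Nat.InfinitelyOften using () renaming (Inf to InfinitelyOften)
import Data.Nat.Properties as ℕₚ
open import Data.Nat.Tactic.RingSolver using (solve-∀)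
open import Data.Product.Base using (Σ; ∃; _×_; _,_; proj₁; proj₂)
open import Data.Rational.Base as ℚ using (ℚ; 0ℚ; 1ℚ; ½)
import Data.Rational.Properties as ℚₚ
import Data.Rational.Unnormalised.Base as ℚᵘ
import Data.Rational.Unnormalised.Properties as ℚᵘₚ
open import Data.Rational.Solver using (module +-*-Solver)
open import Data.Sum.Base using (_⊎_; inj₁; inj₂)
open import Data.Unit.Base using (tt)
open import Function.Base using (_∘_)
open import Level using (0ℓ; Lift; lift) renaming (suc to lsuc)
import Relation.Binary.Definitions as Rel
open import Relation.Binary.PropositionalEquality
  using (_≡_; _≢_; refl; sym; trans; cong; cong₂; subst; subst₂; module ≡-Reasoning)
open import Relation.Nullary using (¬_; Dec; yes; no)
open import Relation.Nullary.Decidable using (decidable-stable)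
open import Relation.Unary using (Pred; Satisfiable)
import Algebra.Properties.CommutativeSemiring.Exp as Exp
open Exp (CommutativeRing.commutativeSemiring ℚₚ.+-*-commutativeRing)
  using (^-homo-*; ^-assocʳ; ^-distrib-*) renaming (_^_ to _^ℚ_)

-- Rational arithmetic

-- All estimates are between rationals with integer exponents. A weight d^(-t) would be irrational,
-- so `wt` raises a rational base to the integer part of log₂ d, and fractional exponents vanish by
-- raising both sides to a common power. These losses are affordable because the exponents s and the
-- slopes β, γ obey strict inequalities; rationals that do so are found near α only at the end.
-- Excluded middle supplies the suprema behind `IsDiam` and `IsPower`, the roots, and the choice of
-- digits. Restricting to sets with at least N elements needs no tail estimate: doubling every digit
-- weight keeps the total finite and yields a factor of at least 2^N for each such set. In the lower
-- bound there is neither a measure nor compactness, and a cover is an arbitrary sequence of sets. A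
-- set whose points split is charged to their longest common prefix, and a path avoiding all charged
-- prefixes is built digit by digit by averaging. The delicate quantity is the share of forced
-- digits: it must not rise much above γ / (1 + γ) at any position, since a set of a cover may split
-- at any level.

0≤-+ : ∀ {p q} → 0ℚ ℚ.≤ p → 0ℚ ℚ.≤ q → 0ℚ ℚ.≤ p ℚ.+ q
0≤-+ = ℚₚ.+-mono-≤

0<-+ : ∀ {p q} → 0ℚ ℚ.< p → 0ℚ ℚ.≤ q → 0ℚ ℚ.< p ℚ.+ q
0<-+ = ℚₚ.+-mono-<-≤

0≤-* : ∀ {p q} → 0ℚ ℚ.≤ p → 0ℚ ℚ.≤ q → 0ℚ ℚ.≤ p ℚ.* q
0≤-* {p} {q} p≥0 q≥0 = ℚₚ.nonNegative⁻¹ (p ℚ.* q)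
  {{ℚₚ.nonNeg*nonNeg⇒nonNeg p {{ℚ.nonNegative p≥0}} q {{ℚ.nonNegative q≥0}}}}

0<-* : ∀ {p q} → 0ℚ ℚ.< p → 0ℚ ℚ.< q → 0ℚ ℚ.< p ℚ.* q
0<-* {p} {q} p>0 q>0 = ℚₚ.positive⁻¹ (p ℚ.* q)
  {{ℚₚ.pos*pos⇒pos p {{ℚ.positive p>0}} q {{ℚ.positive q>0}}}}

p≤q⇒0≤q-p : ∀ {p q} → p ℚ.≤ q → 0ℚ ℚ.≤ q ℚ.- p
p≤q⇒0≤q-p {p} {q} p≤q =
  subst (ℚ._≤ q ℚ.- p) (ℚₚ.+-inverseʳ p) (ℚₚ.+-monoˡ-≤ (ℚ.- p) p≤q)

p<q⇒0<q-p : ∀ {p q} → p ℚ.< q → 0ℚ ℚ.< q ℚ.- p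
p<q⇒0<q-p {p} {q} p<q =
  subst (ℚ._< q ℚ.- p) (ℚₚ.+-inverseʳ p) (ℚₚ.+-monoˡ-< (ℚ.- p) p<q)

p+[q-p]≡q : ∀ p q → p ℚ.+ (q ℚ.- p) ≡ q
p+[q-p]≡q = solve 2 (λ p q → p :+ (q :- p) := q) refl where open +-*-Solver

≤-from-gap : ∀ {p q r} → 0ℚ ℚ.≤ r → q ℚ.- p ≡ r → p ℚ.≤ q
≤-from-gap {p} {q} r≥0 refl = subst₂ ℚ._≤_ (ℚₚ.+-identityʳ p) (p+[q-p]≡q p q) (ℚₚ.+-monoʳ-≤ p r≥0)

<-from-gap : ∀ {p q r} → 0ℚ ℚ.< r → q ℚ.- p ≡ r → p ℚ.< q
<-from-gap {p} {q} r>0 refl = subst₂ ℚ._<_ (ℚₚ.+-identityʳ p) (p+[q-p]≡q p q) (ℚₚ.+-monoʳ-< p r>0)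

p≤p+q : ∀ p {q} → 0ℚ ℚ.≤ q → p ℚ.≤ p ℚ.+ q
p≤p+q p {q} q≥0 = subst (ℚ._≤ p ℚ.+ q) (ℚₚ.+-identityʳ p) (ℚₚ.+-monoʳ-≤ p q≥0)

0<1 : 0ℚ ℚ.< 1ℚ
0<1 = ℚₚ.positive⁻¹ 1ℚ

0≤1 : 0ℚ ℚ.≤ 1ℚ
0≤1 = ℚₚ.<⇒≤ 0<1

0<½ : 0ℚ ℚ.< ½
0<½ = ℚₚ.positive⁻¹ ½

0≤½ : 0ℚ ℚ.≤ ½
0≤½ = ℚₚ.<⇒≤ 0<½

½+½ : ∀ ε → ½ ℚ.* ε ℚ.+ ½ ℚ.* ε ≡ ε
½+½ ε = trans (sym (ℚₚ.*-distribʳ-+ ε ½ ½)) (ℚₚ.*-identityˡ ε)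

0<½* : ∀ {ε} → 0ℚ ℚ.< ε → 0ℚ ℚ.< ½ ℚ.* ε
0<½* = 0<-* 0<½

*-mono-≤ : ∀ {p q r s} → 0ℚ ℚ.≤ p → 0ℚ ℚ.≤ r → p ℚ.≤ q → r ℚ.≤ s → p ℚ.* r ℚ.≤ q ℚ.* s
*-mono-≤ {p} {q} {r} {s} p≥0 r≥0 p≤q r≤s = ℚₚ.≤-trans
  (ℚₚ.*-monoʳ-≤-nonNeg r {{ℚ.nonNegative r≥0}} p≤q)
  (ℚₚ.*-monoˡ-≤-nonNeg q {{ℚ.nonNegative (ℚₚ.≤-trans p≥0 p≤q)}} r≤s)

*-monoˡ-≤ : ∀ {p q} r → 0ℚ ℚ.≤ r → p ℚ.≤ q → r ℚ.* p ℚ.≤ r ℚ.* q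
*-monoˡ-≤ r r≥0 = ℚₚ.*-monoˡ-≤-nonNeg r {{ℚ.nonNegative r≥0}}

*-monoʳ-≤ : ∀ {p q} r → 0ℚ ℚ.≤ r → p ℚ.≤ q → p ℚ.* r ℚ.≤ q ℚ.* r
*-monoʳ-≤ r r≥0 = ℚₚ.*-monoʳ-≤-nonNeg r {{ℚ.nonNegative r≥0}}

*-cancelʳ-≤ : ∀ {p q} r → 0ℚ ℚ.< r → p ℚ.* r ℚ.≤ q ℚ.* r → p ℚ.≤ q
*-cancelʳ-≤ r r>0 = ℚₚ.*-cancelʳ-≤-pos r {{ℚ.positive r>0}}

∣p∣≤q : ∀ {p q} → p ℚ.≤ q → ℚ.- p ℚ.≤ q → ℚ.∣ p ∣ ℚ.≤ q
∣p∣≤q {p} p≤q -p≤q with ℚₚ.∣p∣≡p∨∣p∣≡-p p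
... | inj₁ eq = subst (ℚ._≤ _) (sym eq) p≤q
... | inj₂ eq = subst (ℚ._≤ _) (sym eq) -p≤q

p≤∣p∣ : ∀ p → p ℚ.≤ ℚ.∣ p ∣
p≤∣p∣ p with ℚₚ.≤-total 0ℚ p
... | inj₁ p≥0 = ℚₚ.≤-reflexive (sym (ℚₚ.0≤p⇒∣p∣≡p p≥0))
... | inj₂ p≤0 = ℚₚ.≤-trans p≤0 (ℚₚ.0≤∣p∣ p)

-p≤∣p∣ : ∀ p → ℚ.- p ℚ.≤ ℚ.∣ p ∣
-p≤∣p∣ p = subst (ℚ.- p ℚ.≤_) (ℚₚ.∣-p∣≡∣p∣ p) (p≤∣p∣ (ℚ.- p))

neg-sub : ∀ p q → ℚ.- (p ℚ.- q) ≡ q ℚ.- p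
neg-sub = solve 2 (λ p q → :- (p :- q) := q :- p) refl where open +-*-Solver

∣p-q∣-comm : ∀ p q → ℚ.∣ p ℚ.- q ∣ ≡ ℚ.∣ q ℚ.- p ∣
∣p-q∣-comm p q = trans (sym (ℚₚ.∣-p∣≡∣p∣ (p ℚ.- q))) (cong ℚ.∣_∣ (neg-sub p q))

p-q≤r⇒p≤q+r : ∀ p q {r} → p ℚ.- q ℚ.≤ r → p ℚ.≤ q ℚ.+ r
p-q≤r⇒p≤q+r p q h = subst (ℚ._≤ _) (p+[q-p]≡q q p) (ℚₚ.+-monoʳ-≤ q h)

∣p-q∣≤r⇒p≤q+r : ∀ p q {r} → ℚ.∣ p ℚ.- q ∣ ℚ.≤ r → p ℚ.≤ q ℚ.+ r
∣p-q∣≤r⇒p≤q+r p q h = p-q≤r⇒p≤q+r p q (ℚₚ.≤-trans (p≤∣p∣ (p ℚ.- q)) h)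

∣p-q∣≤r⇒q≤p+r : ∀ p q {r} → ℚ.∣ p ℚ.- q ∣ ℚ.≤ r → q ℚ.≤ p ℚ.+ r
∣p-q∣≤r⇒q≤p+r p q {r} h = ∣p-q∣≤r⇒p≤q+r q p (subst (ℚ._≤ r) (∣p-q∣-comm p q) h)

p≤q+r⇒p-q≤r : ∀ p q {r} → p ℚ.≤ q ℚ.+ r → p ℚ.- q ℚ.≤ r
p≤q+r⇒p-q≤r p q {r} h = subst (p ℚ.- q ℚ.≤_) (cancel q r) (ℚₚ.+-monoˡ-≤ (ℚ.- q) h)
  where
  open +-*-Solver
  cancel : ∀ q r → (q ℚ.+ r) ℚ.- q ≡ r
  cancel = solve 2 (λ q r → (q :+ r) :- q := r) refl

∣p-q∣≤r : ∀ p q {r} → p ℚ.≤ q ℚ.+ r → q ℚ.≤ p ℚ.+ r → ℚ.∣ p ℚ.- q ∣ ℚ.≤ r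
∣p-q∣≤r p q {r} h h′ = ∣p∣≤q (p≤q+r⇒p-q≤r p q h) (subst (ℚ._≤ r) (sym (neg-sub p q)) (p≤q+r⇒p-q≤r q p h′))

∣p-r∣≤∣p-q∣+∣q-r∣ : ∀ p q r → ℚ.∣ p ℚ.- r ∣ ℚ.≤ ℚ.∣ p ℚ.- q ∣ ℚ.+ ℚ.∣ q ℚ.- r ∣
∣p-r∣≤∣p-q∣+∣q-r∣ p q r = subst (ℚ._≤ ℚ.∣ p ℚ.- q ∣ ℚ.+ ℚ.∣ q ℚ.- r ∣) (cong ℚ.∣_∣ (telescope p q r))
  (ℚₚ.∣p+q∣≤∣p∣+∣q∣ (p ℚ.- q) (q ℚ.- r))
  where
  open +-*-Solver
  telescope : ∀ p q r → (p ℚ.- q) ℚ.+ (q ℚ.- r) ≡ p ℚ.- r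
  telescope = solve 3 (λ p q r → (p :- q) :+ (q :- r) := p :- r) refl

≤-from-ε : ∀ {p q} → (∀ ε → 0ℚ ℚ.< ε → p ℚ.≤ q ℚ.+ ε) → p ℚ.≤ q
≤-from-ε {p} {q} h with ℚₚ._≤?_ p q
... | yes p≤q = p≤q
... | no p≰q = ⊥-elim (ℚₚ.<-irrefl refl (ℚₚ.<-≤-trans gap (h ε (0<½* (p<q⇒0<q-p q<p)))))
  where
  q<p = ℚₚ.≰⇒> p≰q
  ε = ½ ℚ.* (p ℚ.- q)
  gap : q ℚ.+ ε ℚ.< p
  gap = <-from-gap (0<½* (p<q⇒0<q-p q<p))
    (trans (regroup p q ε) (trans (cong (ℚ._- ε) (sym (½+½ (p ℚ.- q)))) (cancel ε)))
    where
    open +-*-Solver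
    regroup : ∀ p q ε → p ℚ.- (q ℚ.+ ε) ≡ (p ℚ.- q) ℚ.- ε
    regroup = solve 3 (λ p q ε → p :- (q :+ ε) := (p :- q) :- ε) refl
    cancel : ∀ ε → (ε ℚ.+ ε) ℚ.- ε ≡ ε
    cancel = solve 1 (λ ε → (ε :+ ε) :- ε := ε) refl

-- ι and frac are abstract so that the checker never evaluates a gcd.
abstract
  ι : ℕ → ℚ
  ι n = + n ℚ./ 1

  frac : ℕ → ℕ → ℚ
  frac m k = + m ℚ./ suc k

  ι-def : ∀ n → + n ℚ./ 1 ≡ ι n
  ι-def n = refl

  frac-def : ∀ m k → + m ℚ./ suc k ≡ frac m k
  frac-def m k = refl

  ι-0 : ι 0 ≡ 0ℚ
  ι-0 = refl

  ι-1 : ι 1 ≡ 1ℚ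
  ι-1 = refl

  ι-≃ : ∀ n → ℚ.toℚᵘ (ι n) ℚᵘ.≃ ℚᵘ.mkℚᵘ (+ n) 0
  ι-≃ n = ℚₚ.toℚᵘ-fromℚᵘ (ℚᵘ.mkℚᵘ (+ n) 0)

  /-≃ : ∀ m k → ℚ.toℚᵘ (+ m ℚ./ suc k) ℚᵘ.≃ ℚᵘ.mkℚᵘ (+ m) k
  /-≃ m k = ℚₚ.toℚᵘ-fromℚᵘ (ℚᵘ.mkℚᵘ (+ m) k)

  ι-+ : ∀ m n → ι (m ℕ.+ n) ≡ ι m ℚ.+ ι n
  ι-+ m n = ℚₚ.toℚᵘ-injective (begin
    ℚ.toℚᵘ (ι (m ℕ.+ n))                          ≈⟨ ι-≃ (m ℕ.+ n) ⟩
    ℚᵘ.mkℚᵘ (+ (m ℕ.+ n)) 0                       ≈⟨ ℚᵘ.*≡* (cong (ℤ._* + 1) (sym (cong₂ ℤ._+_ (ℤₚ.*-identityʳ (+ m)) (ℤₚ.*-identityʳ (+ n))))) ⟩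
    ℚᵘ.mkℚᵘ (+ m) 0 ℚᵘ.+ ℚᵘ.mkℚᵘ (+ n) 0          ≈⟨ ℚᵘₚ.+-cong (ι-≃ m) (ι-≃ n) ⟨
    ℚ.toℚᵘ (ι m) ℚᵘ.+ ℚ.toℚᵘ (ι n)                ≈⟨ ℚₚ.toℚᵘ-homo-+ (ι m) (ι n) ⟨
    ℚ.toℚᵘ (ι m ℚ.+ ι n)                          ∎)
    where open ℚᵘₚ.≃-Reasoning

  ι-* : ∀ m n → ι (m ℕ.* n) ≡ ι m ℚ.* ι n
  ι-* m n = ℚₚ.toℚᵘ-injective (begin
    ℚ.toℚᵘ (ι (m ℕ.* n))                          ≈⟨ ι-≃ (m ℕ.* n) ⟩
    ℚᵘ.mkℚᵘ (+ (m ℕ.* n)) 0                       ≈⟨ ℚᵘ.*≡* (cong (ℤ._* + 1) (ℤₚ.pos-* m n)) ⟩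
    ℚᵘ.mkℚᵘ (+ m) 0 ℚᵘ.* ℚᵘ.mkℚᵘ (+ n) 0          ≈⟨ ℚᵘₚ.*-cong (ι-≃ m) (ι-≃ n) ⟨
    ℚ.toℚᵘ (ι m) ℚᵘ.* ℚ.toℚᵘ (ι n)                ≈⟨ ℚₚ.toℚᵘ-homo-* (ι m) (ι n) ⟨
    ℚ.toℚᵘ (ι m ℚ.* ι n)                          ∎)
    where open ℚᵘₚ.≃-Reasoning

  frac-*-ι : ∀ m k → frac m k ℚ.* ι (suc k) ≡ ι m
  frac-*-ι m k = ℚₚ.toℚᵘ-injective (begin
    ℚ.toℚᵘ ((+ m ℚ./ suc k) ℚ.* ι (suc k))            ≈⟨ ℚₚ.toℚᵘ-homo-* (+ m ℚ./ suc k) (ι (suc k)) ⟩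
    ℚ.toℚᵘ (+ m ℚ./ suc k) ℚᵘ.* ℚ.toℚᵘ (ι (suc k))    ≈⟨ ℚᵘₚ.*-cong (/-≃ m k) (ι-≃ (suc k)) ⟩
    ℚᵘ.mkℚᵘ (+ m) k ℚᵘ.* ℚᵘ.mkℚᵘ (+ suc k) 0          ≈⟨ ℚᵘ.*≡* (trans (ℤₚ.*-identityʳ (+ m ℤ.* + suc k)) (cong (+ m ℤ.*_) (cong (+_ ∘ suc) (sym (ℕₚ.*-identityʳ k))))) ⟩
    ℚᵘ.mkℚᵘ (+ m) 0                                   ≈⟨ ι-≃ m ⟨
    ℚ.toℚᵘ (ι m)                                      ∎)
    where open ℚᵘₚ.≃-Reasoning

  0≤frac : ∀ m k → 0ℚ ℚ.≤ frac m k
  0≤frac m k = ℚₚ.nonNegative⁻¹ (+ m ℚ./ suc k) {{ℚₚ.normalize-nonNeg m (suc k)}}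

  0≤ι : ∀ n → 0ℚ ℚ.≤ ι n
  0≤ι n = 0≤frac n 0

  0<ι : ∀ n → 0ℚ ℚ.< ι (suc n)
  0<ι n = ℚₚ.positive⁻¹ (ι (suc n)) {{ℚₚ.normalize-pos (suc n) 1}}

ι-mono-≤ : ∀ {m n} → m ℕ.≤ n → ι m ℚ.≤ ι n
ι-mono-≤ {m} {n} m≤n with ℕₚ.m≤n⇒∃[o]m+o≡n m≤n
... | o , refl = subst (ι m ℚ.≤_) (sym (ι-+ m o)) (p≤p+q (ι m) (0≤ι o))

ι-mono-< : ∀ {m n} → m ℕ.< n → ι m ℚ.< ι n
ι-mono-< {m} {n} m<n with ℕₚ.m≤n⇒∃[o]m+o≡n m<n
... | o , refl = subst₂ ℚ._<_ (ℚₚ.+-identityʳ (ι m))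
  (trans (sym (ι-+ m (suc o))) (cong ι (ℕₚ.+-suc m o))) (ℚₚ.+-monoʳ-< (ι m) (0<ι o))

ι-cancel-≤ : ∀ {m n} → ι m ℚ.≤ ι n → m ℕ.≤ n
ι-cancel-≤ {m} {n} h with ℕₚ._≤?_ m n
... | yes m≤n = m≤n
... | no m≰n = ⊥-elim (ℚₚ.<-irrefl refl (ℚₚ.<-≤-trans (ι-mono-< (ℕₚ.≰⇒> m≰n)) h))

ι-cancel-< : ∀ {m n} → ι m ℚ.< ι n → m ℕ.< n
ι-cancel-< {m} {n} h with ℕₚ._<?_ m n
... | yes m<n = m<n
... | no m≮n = ⊥-elim (ℚₚ.<-irrefl refl (ℚₚ.<-≤-trans h (ι-mono-≤ (ℕₚ.≮⇒≥ m≮n))))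

1≤ι : ∀ {n} → 1 ℕ.≤ n → 1ℚ ℚ.≤ ι n
1≤ι {n} h = subst (ℚ._≤ ι n) ι-1 (ι-mono-≤ h)

ι-suc : ∀ n → ι (suc n) ≡ 1ℚ ℚ.+ ι n
ι-suc n = trans (ι-+ 1 n) (cong (ℚ._+ ι n) ι-1)

ι-^ : ∀ m n → ι (m ℕ.^ n) ≡ ι m ^ℚ n
ι-^ m zero = ι-1
ι-^ m (suc n) = trans (ι-* m (m ℕ.^ n)) (cong (ι m ℚ.*_) (ι-^ m n))

nonNeg-fraction : ∀ q → 0ℚ ℚ.≤ q → ∃ λ m → ∃ λ k → q ≡ frac m k
nonNeg-fraction q@(ℚ.mkℚ (+ m) k _) _ = m , k , trans (sym (ℚₚ.↥p/↧p≡p q)) (frac-def m k)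
nonNeg-fraction q@(ℚ.mkℚ ℤ.-[1+ m ] k _) (ℚ.*≤* ())

abstract
  -- Kept opaque so that the case split of `recip` never surfaces; only `recip-def`, `*inv` and
  -- `0<inv` look inside.
  inv : ℚ → ℚ
  inv = recip

  recip-def : ∀ q → recip q ≡ inv q
  recip-def q = refl

  *inv : ∀ {q} → 0ℚ ℚ.< q → q ℚ.* inv q ≡ 1ℚ
  *inv {q} q>0 with ℚₚ._≟_ q 0ℚ
  ... | yes refl = ⊥-elim (ℚₚ.<-irrefl refl q>0)
  ... | no q≢0 = ℚₚ.*-inverseʳ q {{ℚ.≢-nonZero q≢0}}

  0<inv : ∀ {q} → 0ℚ ℚ.< q → 0ℚ ℚ.< inv q
  0<inv {q} q>0 with ℚₚ._≟_ q 0ℚ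
  ... | yes refl = ⊥-elim (ℚₚ.<-irrefl refl q>0)
  ... | no q≢0 = ℚₚ.positive⁻¹ _ {{ℚₚ.1/pos⇒pos q {{ℚ.positive q>0}}}}

inv-unique : ∀ {p q} → 0ℚ ℚ.< p → p ℚ.* q ≡ 1ℚ → q ≡ inv p
inv-unique {p} {q} p>0 pq = begin
  q                              ≡⟨ ℚₚ.*-identityˡ q ⟨
  1ℚ ℚ.* q                       ≡⟨ cong (ℚ._* q) (trans (ℚₚ.*-comm (inv p) p) (*inv p>0)) ⟨
  (inv p ℚ.* p) ℚ.* q          ≡⟨ ℚₚ.*-assoc (inv p) p q ⟩
  inv p ℚ.* (p ℚ.* q)          ≡⟨ cong (inv p ℚ.*_) pq ⟩
  inv p ℚ.* 1ℚ                 ≡⟨ ℚₚ.*-identityʳ (inv p) ⟩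
  inv p                        ∎
  where open ≡-Reasoning

inv-* : ∀ {p q} → 0ℚ ℚ.< p → 0ℚ ℚ.< q → inv (p ℚ.* q) ≡ inv p ℚ.* inv q
inv-* {p} {q} p>0 q>0 = sym (inv-unique (0<-* p>0 q>0)
  (trans (swap p q (inv p) (inv q)) (cong₂ ℚ._*_ (*inv p>0) (*inv q>0))))
  where
  open +-*-Solver
  swap : ∀ a b c d → (a ℚ.* b) ℚ.* (c ℚ.* d) ≡ (a ℚ.* c) ℚ.* (b ℚ.* d)
  swap = solve 4 (λ a b c d → (a :* b) :* (c :* d) := (a :* c) :* (b :* d)) refl

inv-anti-≤ : ∀ {p q} → 0ℚ ℚ.< p → p ℚ.≤ q → inv q ℚ.≤ inv p
inv-anti-≤ {p} {q} p>0 p≤q = *-cancelʳ-≤ (p ℚ.* q) (0<-* p>0 q>0)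
  (subst₂ ℚ._≤_ (sym (lhs p q (inv q) (*inv q>0))) (sym (rhs p q (inv p) (*inv p>0))) p≤q)
  where
  q>0 = ℚₚ.<-≤-trans p>0 p≤q
  open +-*-Solver
  lhs : ∀ p q r → q ℚ.* r ≡ 1ℚ → r ℚ.* (p ℚ.* q) ≡ p
  lhs p q r h = trans (solve 3 (λ p q r → r :* (p :* q) := p :* (q :* r)) refl p q r)
    (trans (cong (p ℚ.*_) h) (ℚₚ.*-identityʳ p))
  rhs : ∀ p q r → p ℚ.* r ≡ 1ℚ → r ℚ.* (p ℚ.* q) ≡ q
  rhs p q r h = trans (solve 3 (λ p q r → r :* (p :* q) := (p :* r) :* q) refl p q r)
    (trans (cong (ℚ._* q) h) (ℚₚ.*-identityˡ q))

1≤^ : ∀ {x} → 1ℚ ℚ.≤ x → ∀ n → 1ℚ ℚ.≤ x ^ℚ n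
0≤^ : ∀ {x} → 0ℚ ℚ.≤ x → ∀ n → 0ℚ ℚ.≤ x ^ℚ n
0≤^ x≥0 zero = 0≤1
0≤^ x≥0 (suc n) = 0≤-* x≥0 (0≤^ x≥0 n)

1≤^ h zero = ℚₚ.≤-refl
1≤^ {x} h (suc n) = *-mono-≤ 0≤1 0≤1 h (1≤^ h n)

0<^ : ∀ {x} → 0ℚ ℚ.< x → ∀ n → 0ℚ ℚ.< x ^ℚ n
0<^ x>0 zero = 0<1
0<^ x>0 (suc n) = 0<-* x>0 (0<^ x>0 n)

^-mono-≤ : ∀ {x y} → 0ℚ ℚ.≤ x → x ℚ.≤ y → ∀ n → x ^ℚ n ℚ.≤ y ^ℚ n
^-mono-≤ x≥0 x≤y zero = ℚₚ.≤-refl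
^-mono-≤ x≥0 x≤y (suc n) = *-mono-≤ x≥0 (0≤^ x≥0 n) x≤y (^-mono-≤ x≥0 x≤y n)

^-mono-< : ∀ {x y} → 0ℚ ℚ.≤ x → x ℚ.< y → ∀ n → x ^ℚ suc n ℚ.< y ^ℚ suc n
^-mono-< {x} {y} x≥0 x<y n = ℚₚ.≤-<-trans
  (*-monoˡ-≤ x x≥0 (^-mono-≤ x≥0 (ℚₚ.<⇒≤ x<y) n))
  (ℚₚ.*-monoˡ-<-pos (y ^ℚ n) {{ℚ.positive (0<^ (ℚₚ.≤-<-trans x≥0 x<y) n)}} x<y)

^-cancel-≤ : ∀ {x y} → 0ℚ ℚ.≤ y → ∀ n → x ^ℚ suc n ℚ.≤ y ^ℚ suc n → x ℚ.≤ y
^-cancel-≤ {x} {y} y≥0 n h with ℚₚ._≤?_ x y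
... | yes x≤y = x≤y
... | no x≰y = ⊥-elim (ℚₚ.<-irrefl refl (ℚₚ.<-≤-trans (^-mono-< y≥0 (ℚₚ.≰⇒> x≰y) n) h))

1^ : ∀ n → 1ℚ ^ℚ n ≡ 1ℚ
1^ zero = refl
1^ (suc n) = trans (ℚₚ.*-identityˡ _) (1^ n)

^≤1 : ∀ {x} → 0ℚ ℚ.≤ x → x ℚ.≤ 1ℚ → ∀ n → x ^ℚ n ℚ.≤ 1ℚ
^≤1 {x} x≥0 x≤1 n = subst (x ^ℚ n ℚ.≤_) (1^ n) (^-mono-≤ x≥0 x≤1 n)

^-anti-≤ : ∀ {x} → 0ℚ ℚ.≤ x → x ℚ.≤ 1ℚ → ∀ {m n} → m ℕ.≤ n → x ^ℚ n ℚ.≤ x ^ℚ m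
^-anti-≤ {x} x≥0 x≤1 {m} m≤n with ℕₚ.m≤n⇒∃[o]m+o≡n m≤n
... | o , refl = subst₂ ℚ._≤_ (sym (^-homo-* x m o)) (ℚₚ.*-identityʳ _)
  (*-monoˡ-≤ (x ^ℚ m) (0≤^ x≥0 m) (^≤1 x≥0 x≤1 o))

inv-^ : ∀ {x} → 0ℚ ℚ.< x → ∀ n → inv (x ^ℚ n) ≡ inv x ^ℚ n
inv-^ x>0 zero = sym (inv-unique 0<1 refl)
inv-^ {x} x>0 (suc n) = trans (inv-* x>0 (0<^ x>0 n)) (cong (inv x ℚ.*_) (inv-^ x>0 n))

-- The induction step has slack n x², a square times n, so x may be negative as long as 1 + x is
-- not. The base of the digit weights needs x = -η.
bernoulli : ∀ {x} → 0ℚ ℚ.≤ 1ℚ ℚ.+ x → ∀ n → 1ℚ ℚ.+ ι n ℚ.* x ℚ.≤ (1ℚ ℚ.+ x) ^ℚ n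
bernoulli {x} h zero = ℚₚ.≤-reflexive (trans (cong (λ t → 1ℚ ℚ.+ t ℚ.* x) ι-0) (trans (cong (1ℚ ℚ.+_) (ℚₚ.*-zeroˡ x)) (ℚₚ.+-identityʳ 1ℚ)))
bernoulli {x} h (suc n) = ℚₚ.≤-trans
  (≤-from-gap (0≤-* (0≤ι n) 0≤x²)
    (trans (cong (λ t → (1ℚ ℚ.+ x) ℚ.* (1ℚ ℚ.+ ι n ℚ.* x) ℚ.- (1ℚ ℚ.+ t ℚ.* x)) (ι-suc n)) (expand x (ι n))))
  (*-monoˡ-≤ (1ℚ ℚ.+ x) h (bernoulli h n))
  where
  open +-*-Solver
  expand : ∀ x k → (1ℚ ℚ.+ x) ℚ.* (1ℚ ℚ.+ k ℚ.* x) ℚ.- (1ℚ ℚ.+ (1ℚ ℚ.+ k) ℚ.* x) ≡ k ℚ.* (x ℚ.* x)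
  expand = solve 2 (λ x k → (con 1ℚ :+ x) :* (con 1ℚ :+ k :* x) :- (con 1ℚ :+ (con 1ℚ :+ k) :* x) := k :* (x :* x)) refl
  0≤x² : 0ℚ ℚ.≤ x ℚ.* x
  0≤x² with ℚₚ.≤-total 0ℚ x
  ... | inj₁ x≥0 = 0≤-* x≥0 x≥0
  ... | inj₂ x≤0 = subst (0ℚ ℚ.≤_) (solve 1 (λ x → (:- x) :* (:- x) := x :* x) refl x)
                     (0≤-* (ℚₚ.neg-antimono-≤ x≤0) (ℚₚ.neg-antimono-≤ x≤0))

archimedean : ∀ q → ∃ λ n → q ℚ.≤ ι n
archimedean q with ℚₚ.≤-total 0ℚ q
... | inj₂ q≤0 = 0 , ℚₚ.≤-trans q≤0 (0≤ι 0)
... | inj₁ q≥0 with nonNeg-fraction q q≥0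
...   | m , k , refl = m , subst₂ ℚ._≤_ (ℚₚ.*-identityʳ (frac m k)) (frac-*-ι m k)
        (*-monoˡ-≤ (frac m k) (0≤frac m k) (1≤ι (ℕ.s≤s ℕ.z≤n)))

archimedean-* : ∀ q {ε} → 0ℚ ℚ.< ε → ∃ λ n → q ℚ.≤ ι n ℚ.* ε
archimedean-* q {ε} ε>0 with archimedean (q ℚ.* inv ε)
... | n , h = n , subst (ℚ._≤ ι n ℚ.* ε)
  (trans (ℚₚ.*-assoc q (inv ε) ε) (trans (cong (q ℚ.*_) (trans (ℚₚ.*-comm (inv ε) ε) (*inv ε>0))) (ℚₚ.*-identityʳ q)))
  (*-monoʳ-≤ ε (ℚₚ.<⇒≤ ε>0) h)

-- With 1 / x = 1 + η, Bernoulli gives (1 / x)^n ≥ n η, which outgrows 1 / ε.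
^-small : ∀ {x} → 0ℚ ℚ.< x → x ℚ.< 1ℚ → ∀ {ε} → 0ℚ ℚ.< ε → ∃ λ n → x ^ℚ n ℚ.≤ ε
^-small {x} x>0 x<1 {ε} ε>0 with archimedean-* (inv ε) η>0
  where
  η = inv x ℚ.- 1ℚ
  η>0 : 0ℚ ℚ.< η
  η>0 = p<q⇒0<q-p (ℚₚ.≰⇒> λ h → ℚₚ.<-irrefl (*inv x>0) (ℚₚ.≤-<-trans
    (ℚₚ.≤-trans (*-monoˡ-≤ x (ℚₚ.<⇒≤ x>0) h) (ℚₚ.≤-reflexive (ℚₚ.*-identityʳ x))) x<1))
... | n , h = n , *-cancelʳ-≤ (inv ε ℚ.* r ^ℚ n) (0<-* (0<inv ε>0) (0<^ (0<inv x>0) n))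
    (subst₂ ℚ._≤_ (sym (lhs (x ^ℚ n) (inv ε) (r ^ℚ n) x^n*r^n)) (sym (rhs ε (inv ε) (r ^ℚ n) (*inv ε>0))) inv≤)
  where
  r = inv x
  η = r ℚ.- 1ℚ
  inv≤ : inv ε ℚ.≤ r ^ℚ n
  inv≤ = ℚₚ.≤-trans h (ℚₚ.≤-trans (≤-from-gap 0≤1 (cancel (ι n ℚ.* η)))
    (subst (λ t → 1ℚ ℚ.+ ι n ℚ.* η ℚ.≤ t ^ℚ n) (p+[q-p]≡q 1ℚ r) (bernoulli (subst (0ℚ ℚ.≤_) (sym (p+[q-p]≡q 1ℚ r)) (ℚₚ.<⇒≤ (0<inv x>0))) n)))
    where
    open +-*-Solver
    cancel : ∀ y → (1ℚ ℚ.+ y) ℚ.- y ≡ 1ℚ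
    cancel = solve 1 (λ y → (con 1ℚ :+ y) :- y := con 1ℚ) refl
  x^n*r^n : x ^ℚ n ℚ.* r ^ℚ n ≡ 1ℚ
  x^n*r^n = trans (sym (^-distrib-* x r n)) (trans (cong (_^ℚ n) (*inv x>0)) (1^ n))
  open +-*-Solver
  lhs : ∀ a b c → a ℚ.* c ≡ 1ℚ → a ℚ.* (b ℚ.* c) ≡ b
  lhs a b c eq = trans (solve 3 (λ a b c → a :* (b :* c) := b :* (a :* c)) refl a b c) (trans (cong (b ℚ.*_) eq) (ℚₚ.*-identityʳ b))
  rhs : ∀ a b c → a ℚ.* b ≡ 1ℚ → a ℚ.* (b ℚ.* c) ≡ c
  rhs a b c eq = trans (sym (ℚₚ.*-assoc a b c)) (trans (cong (ℚ._* c) eq) (ℚₚ.*-identityˡ c))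

½<1 : ½ ℚ.< 1ℚ
½<1 = <-from-gap 0<½ refl

½^-small : ∀ {ε} → 0ℚ ℚ.< ε → ∃ λ n → ½ ^ℚ n ℚ.≤ ε
½^-small = ^-small 0<½ ½<1

-- Real numbers

≤-pointwise : ∀ {x y} → ∀ N → (∀ n → N ℕ.≤ n → seq x n ℚ.≤ seq y n) → x ≤ y
≤-pointwise {x} {y} N h ε ε>0 = N , λ n N≤n → ℚₚ.≤-trans (h n N≤n) (p≤p+q (seq y n) (ℚₚ.<⇒≤ ε>0))

≤ℝ-refl : ∀ {x} → x ≤ x
≤ℝ-refl {x} = ≤-pointwise {x} {x} 0 λ _ _ → ℚₚ.≤-refl

≤ℝ-trans : ∀ {x y z} → x ≤ y → y ≤ z → x ≤ z
≤ℝ-trans {x} {y} {z} x≤y y≤z ε ε>0 with x≤y (½ ℚ.* ε) (0<½* ε>0) | y≤z (½ ℚ.* ε) (0<½* ε>0)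
... | M , hx | N , hy = M ℕ.⊔ N , λ n n≥ → ℚₚ.≤-trans
  (hx n (ℕₚ.m⊔n≤o⇒m≤o M N n≥))
  (ℚₚ.≤-trans (ℚₚ.+-monoˡ-≤ (½ ℚ.* ε) (hy n (ℕₚ.m⊔n≤o⇒n≤o M N n≥)))
    (ℚₚ.≤-reflexive (trans (ℚₚ.+-assoc (seq z n) _ _) (cong (seq z n ℚ.+_) (½+½ ε)))))

fromℚ-mono : ∀ {p q} → p ℚ.≤ q → fromℚ p ≤ fromℚ q
fromℚ-mono {p} {q} p≤q = ≤-pointwise {fromℚ p} {fromℚ q} 0 λ _ _ → p≤q

fromℚ-cancel : ∀ {p q} → fromℚ p ≤ fromℚ q → p ℚ.≤ q
fromℚ-cancel h = ≤-from-ε λ ε ε>0 → proj₂ (h ε ε>0) (proj₁ (h ε ε>0)) ℕₚ.≤-refl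

+ℝ-mono-≤ : ∀ {w x y z} → w ≤ x → y ≤ z → w + y ≤ x + z
+ℝ-mono-≤ {w} {x} {y} {z} w≤x y≤z ε ε>0 with w≤x (½ ℚ.* ε) (0<½* ε>0) | y≤z (½ ℚ.* ε) (0<½* ε>0)
... | M , hw | N , hy = M ℕ.⊔ N , λ n n≥ → ℚₚ.≤-trans
  (ℚₚ.+-mono-≤ (hw n (ℕₚ.m⊔n≤o⇒m≤o M N n≥)) (hy n (ℕₚ.m⊔n≤o⇒n≤o M N n≥)))
  (ℚₚ.≤-reflexive (trans (regroup (seq x n) (seq z n) (½ ℚ.* ε)) (cong (seq x n ℚ.+ seq z n ℚ.+_) (½+½ ε))))
  where
  open +-*-Solver
  regroup : ∀ a b e → (a ℚ.+ e) ℚ.+ (b ℚ.+ e) ≡ (a ℚ.+ b) ℚ.+ (e ℚ.+ e)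
  regroup = solve 3 (λ a b e → (a :+ e) :+ (b :+ e) := (a :+ b) :+ (e :+ e)) refl

∑-mono-≤ : ∀ {s t} → (∀ i → s i ≤ t i) → ∀ n → ∑ s n ≤ ∑ t n
∑-mono-≤ h zero = ≤ℝ-refl {0ℝ}
∑-mono-≤ {s} {t} h (suc n) = +ℝ-mono-≤ {∑ s n} {∑ t n} {s n} {t n} (∑-mono-≤ h n) (h n)

∑ℚ : (ℕ → ℚ) → ℕ → ℚ
∑ℚ t zero    = 0ℚ
∑ℚ t (suc n) = ∑ℚ t n ℚ.+ t n

seq-∑-fromℚ : ∀ t n k → seq (∑ (fromℚ ∘ t) n) k ≡ ∑ℚ t n
seq-∑-fromℚ t zero k = refl
seq-∑-fromℚ t (suc n) k = cong (ℚ._+ t n) (seq-∑-fromℚ t n k)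

abstract
  bounded : ∀ x → ∃ λ B → 0ℚ ℚ.< B × ∃ λ N → ∀ n → N ℕ.≤ n → ℚ.∣ seq x n ∣ ℚ.≤ B
  bounded x = let N , h = cauchy x 1ℚ 0<1 in
    1ℚ ℚ.+ ℚ.∣ seq x N ∣ , 0<-+ 0<1 (ℚₚ.0≤∣p∣ (seq x N)) , N ,
    λ n n≥ → near (seq x n) (seq x N) (h n N n≥ ℕₚ.≤-refl)
    where
    open +-*-Solver
    near : ∀ p q → ℚ.∣ p ℚ.- q ∣ ℚ.≤ 1ℚ → ℚ.∣ p ∣ ℚ.≤ 1ℚ ℚ.+ ℚ.∣ q ∣
    near p q h = ℚₚ.≤-trans
      (subst (λ t → ℚ.∣ t ∣ ℚ.≤ ℚ.∣ p ℚ.- q ∣ ℚ.+ ℚ.∣ q ∣) (solve 2 (λ p q → (p :- q) :+ q := p) refl p q) (ℚₚ.∣p+q∣≤∣p∣+∣q∣ (p ℚ.- q) q))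
      (ℚₚ.+-monoˡ-≤ ℚ.∣ q ∣ h)

-- Expand (c + δ)((b - a) + δ) ≥ 0.
product-error : ∀ {δ D ε} a b c → 0ℚ ℚ.≤ δ → δ ℚ.* D ≡ ε → a ℚ.≤ b ℚ.+ δ → 0ℚ ℚ.≤ c ℚ.+ δ →
  (c ℚ.+ (b ℚ.- a)) ℚ.+ δ ℚ.≤ D → c ℚ.* a ℚ.≤ c ℚ.* b ℚ.+ ε
product-error {δ} {D} {ε} a b c δ≥0 δ*D≡ε hab hc hD = ≤-from-gap nonNeg identity
  where
  open +-*-Solver
  expand : ∀ c d δ D → c ℚ.* d ℚ.+ δ ℚ.* D ≡ (c ℚ.+ δ) ℚ.* (d ℚ.+ δ) ℚ.+ δ ℚ.* (D ℚ.- ((c ℚ.+ d) ℚ.+ δ))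
  expand = solve 4 (λ c d δ D → c :* d :+ δ :* D := (c :+ δ) :* (d :+ δ) :+ δ :* (D :- ((c :+ d) :+ δ))) refl
  factor : ∀ a b c e → (c ℚ.* b ℚ.+ e) ℚ.- c ℚ.* a ≡ c ℚ.* (b ℚ.- a) ℚ.+ e
  factor = solve 4 (λ a b c e → (c :* b :+ e) :- c :* a := c :* (b :- a) :+ e) refl
  shift : ∀ a b d → (b ℚ.+ d) ℚ.- a ≡ (b ℚ.- a) ℚ.+ d
  shift = solve 3 (λ a b d → (b :+ d) :- a := (b :- a) :+ d) refl
  nonNeg : 0ℚ ℚ.≤ (c ℚ.+ δ) ℚ.* ((b ℚ.- a) ℚ.+ δ) ℚ.+ δ ℚ.* (D ℚ.- ((c ℚ.+ (b ℚ.- a)) ℚ.+ δ))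
  nonNeg = 0≤-+ (0≤-* hc (subst (0ℚ ℚ.≤_) (shift a b δ) (p≤q⇒0≤q-p hab))) (0≤-* δ≥0 (p≤q⇒0≤q-p hD))
  identity : (c ℚ.* b ℚ.+ ε) ℚ.- c ℚ.* a ≡ (c ℚ.+ δ) ℚ.* ((b ℚ.- a) ℚ.+ δ) ℚ.+ δ ℚ.* (D ℚ.- ((c ℚ.+ (b ℚ.- a)) ℚ.+ δ))
  identity = trans (factor a b c ε) (trans (cong (c ℚ.* (b ℚ.- a) ℚ.+_) (sym δ*D≡ε)) (expand c (b ℚ.- a) δ D))

-- Including ε in the divisor gives δ ≤ 1 with no minimum to take, and this bounds the δ that occurs
-- inside D in `product-error`.
divide-≤1 : ∀ {D₀ ε} → 0ℚ ℚ.< D₀ → 0ℚ ℚ.< ε → ∃ λ δ → 0ℚ ℚ.< δ × δ ℚ.≤ 1ℚ × δ ℚ.* (D₀ ℚ.+ ε) ≡ ε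
divide-≤1 {D₀} {ε} D₀>0 ε>0 = δ , 0<-* ε>0 (0<inv D>0) ,
  *-cancelʳ-≤ D D>0 (subst₂ ℚ._≤_ (sym δ*D≡ε) (sym (ℚₚ.*-identityˡ D)) ε≤D) , δ*D≡ε
  where
  D = D₀ ℚ.+ ε
  δ = ε ℚ.* inv D
  D>0 : 0ℚ ℚ.< D
  D>0 = 0<-+ D₀>0 (ℚₚ.<⇒≤ ε>0)
  δ*D≡ε : δ ℚ.* D ≡ ε
  δ*D≡ε = trans (ℚₚ.*-assoc ε (inv D) D) (trans (cong (ε ℚ.*_) (trans (ℚₚ.*-comm (inv D) D) (*inv D>0))) (ℚₚ.*-identityʳ ε))
  ε≤D : ε ℚ.≤ D
  ε≤D = subst (ε ℚ.≤_) (ℚₚ.+-comm ε D₀) (p≤p+q ε (ℚₚ.<⇒≤ D₀>0))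

abstract
  product-estimate : ∀ {B C ε} → 0ℚ ℚ.< B → 0ℚ ℚ.< C → 0ℚ ℚ.< ε → ∃ λ δ → 0ℚ ℚ.< δ ×
    (∀ a b c → a ℚ.≤ b ℚ.+ δ → 0ℚ ℚ.≤ c ℚ.+ δ → c ℚ.≤ B → b ℚ.- a ℚ.≤ C → c ℚ.* a ℚ.≤ c ℚ.* b ℚ.+ ε)
  product-estimate {B} {C} {ε} B>0 C>0 ε>0 =
    let D₀ = (B ℚ.+ C) ℚ.+ 1ℚ
        δ , δ>0 , δ≤1 , δ*D≡ε = divide-≤1 {D₀} {ε} (0<-+ {B ℚ.+ C} {1ℚ} (0<-+ {B} {C} B>0 (ℚₚ.<⇒≤ C>0)) 0≤1) ε>0
    in δ , δ>0 , λ a b c hab hc c≤B d≤C → product-error a b c (ℚₚ.<⇒≤ δ>0) δ*D≡ε hab hc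
      (ℚₚ.≤-trans (ℚₚ.+-mono-≤ (ℚₚ.+-mono-≤ c≤B d≤C) δ≤1) (p≤p+q D₀ (ℚₚ.<⇒≤ ε>0)))

*ℝ-monoˡ-≤ : ∀ {z x y} → 0ℝ ≤ z → x ≤ y → z * x ≤ z * y
*ℝ-monoˡ-≤ {z} {x} {y} z≥0 x≤y ε ε>0 =
  let B , B>0 , N₁ , z≤B = bounded z
      C , C>0 , N₂ , d≤C = bounded (y - x)
      δ , δ>0 , estimate = product-estimate B>0 C>0 ε>0
      N₃ , hxy = x≤y δ δ>0
      N₄ , hz = z≥0 δ δ>0
  in (N₁ ℕ.⊔ N₂) ℕ.⊔ (N₃ ℕ.⊔ N₄) , λ n n≥ →
    let n≥₁₂ = ℕₚ.m⊔n≤o⇒m≤o (N₁ ℕ.⊔ N₂) (N₃ ℕ.⊔ N₄) n≥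
        n≥₃₄ = ℕₚ.m⊔n≤o⇒n≤o (N₁ ℕ.⊔ N₂) (N₃ ℕ.⊔ N₄) n≥
    in estimate (seq x n) (seq y n) (seq z n) (hxy n (ℕₚ.m⊔n≤o⇒m≤o N₃ N₄ n≥₃₄)) (hz n (ℕₚ.m⊔n≤o⇒n≤o N₃ N₄ n≥₃₄))
         (ℚₚ.≤-trans (p≤∣p∣ (seq z n)) (z≤B n (ℕₚ.m⊔n≤o⇒m≤o N₁ N₂ n≥₁₂)))
         (ℚₚ.≤-trans (p≤∣p∣ (seq y n ℚ.- seq x n)) (d≤C n (ℕₚ.m⊔n≤o⇒n≤o N₁ N₂ n≥₁₂)))

*ℝ-comm-≤ : ∀ x y → x * y ≤ y * x
*ℝ-comm-≤ x y = ≤-pointwise {x * y} {y * x} 0 λ n _ → ℚₚ.≤-reflexive (ℚₚ.*-comm (seq x n) (seq y n))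

*ℝ-mono-≤ : ∀ {w z x y} → 0ℝ ≤ w → 0ℝ ≤ z → w ≤ x → y ≤ z → w * y ≤ x * z
*ℝ-mono-≤ {w} {z} {x} {y} w≥0 z≥0 w≤x y≤z =
  ≤ℝ-trans {w * y} {w * z} {x * z} (*ℝ-monoˡ-≤ {w} {y} {z} w≥0 y≤z)
    (≤ℝ-trans {w * z} {z * w} {x * z} (*ℝ-comm-≤ w z)
      (≤ℝ-trans {z * w} {z * x} {x * z} (*ℝ-monoˡ-≤ {z} {w} {x} z≥0 w≤x) (*ℝ-comm-≤ z x)))

0≤^ℝ : ∀ {x} → 0ℝ ≤ x → ∀ n → 0ℝ ≤ x ^ n
0≤^ℝ x≥0 zero = fromℚ-mono 0≤1
0≤^ℝ {x} x≥0 (suc n) = ≤ℝ-trans {0ℝ} {x * 0ℝ} {x * x ^ n}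
  (≤-pointwise {0ℝ} {x * 0ℝ} 0 λ k _ → ℚₚ.≤-reflexive (sym (ℚₚ.*-zeroʳ (seq x k))))
  (*ℝ-monoˡ-≤ {x} {0ℝ} {x ^ n} x≥0 (0≤^ℝ {x} x≥0 n))

^ℝ-mono-≤ : ∀ {x y} → 0ℝ ≤ x → x ≤ y → ∀ n → x ^ n ≤ y ^ n
^ℝ-mono-≤ x≥0 x≤y zero = ≤ℝ-refl {1ℝ}
^ℝ-mono-≤ {x} {y} x≥0 x≤y (suc n) = *ℝ-mono-≤ {x} {y ^ n} {y} {x ^ n}
  x≥0 (0≤^ℝ {y} (≤ℝ-trans {0ℝ} {x} {y} x≥0 x≤y) n) x≤y (^ℝ-mono-≤ {x} {y} x≥0 x≤y n)

seq-^ : ∀ x k n → seq (x ^ k) n ≡ seq x n ^ℚ k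
seq-^ x zero n = refl
seq-^ x (suc k) n = cong (seq x n ℚ.*_) (seq-^ x k n)

fromℚ-^-≤ : ∀ q k → fromℚ q ^ k ≤ fromℚ (q ^ℚ k)
fromℚ-^-≤ q k = ≤-pointwise {fromℚ q ^ k} {fromℚ (q ^ℚ k)} 0 λ n _ → ℚₚ.≤-reflexive (seq-^ (fromℚ q) k n)

fromℚ-^-≥ : ∀ q k → fromℚ (q ^ℚ k) ≤ fromℚ q ^ k
fromℚ-^-≥ q k = ≤-pointwise {fromℚ (q ^ℚ k)} {fromℚ q ^ k} 0 λ n _ → ℚₚ.≤-reflexive (sym (seq-^ (fromℚ q) k n))

-- Bisection controls the terms of a sequence one by one; this lemma and `≥-closed` carry such
-- control over to the real number.
≤-closed : ∀ {y x} → (∀ n → y ≤ fromℚ (seq x n)) → y ≤ x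
≤-closed {y} {x} h ε ε>0 with cauchy x (½ ℚ.* ε) (0<½* ε>0)
... | M , hx with h M (½ ℚ.* ε) (0<½* ε>0)
...   | N , hy = M ℕ.⊔ N , λ n n≥ → ℚₚ.≤-trans (hy n (ℕₚ.m⊔n≤o⇒n≤o M N n≥))
  (ℚₚ.≤-trans (ℚₚ.+-monoˡ-≤ (½ ℚ.* ε) (∣p-q∣≤r⇒p≤q+r (seq x M) (seq x n) (hx M n ℕₚ.≤-refl (ℕₚ.m⊔n≤o⇒m≤o M N n≥))))
    (ℚₚ.≤-reflexive (trans (ℚₚ.+-assoc (seq x n) _ _) (cong (seq x n ℚ.+_) (½+½ ε)))))

≥-closed : ∀ {x y} → (∀ n → fromℚ (seq x n) ≤ y) → x ≤ y
≥-closed {x} {y} h ε ε>0 with cauchy x (½ ℚ.* ε) (0<½* ε>0)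
... | M , hx with h M (½ ℚ.* ε) (0<½* ε>0)
...   | N , hy = M ℕ.⊔ N , λ n n≥ → ℚₚ.≤-trans
  (∣p-q∣≤r⇒p≤q+r (seq x n) (seq x M) (hx n M (ℕₚ.m⊔n≤o⇒m≤o M N n≥) ℕₚ.≤-refl))
  (ℚₚ.≤-trans (ℚₚ.+-monoˡ-≤ (½ ℚ.* ε) (hy n (ℕₚ.m⊔n≤o⇒n≤o M N n≥)))
    (ℚₚ.≤-reflexive (trans (ℚₚ.+-assoc (seq y n) _ _) (cong (seq y n ℚ.+_) (½+½ ε)))))

-- Classical logic and the strict order of the reals

LEM : Set₁
LEM = ∀ (P : Set) → Dec P

¬¬-elim : LEM → ∀ {P : Set} → ¬ ¬ P → P
¬¬-elim lem {P} ¬¬p with lem P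
... | yes p = p
... | no ¬p = ⊥-elim (¬¬p ¬p)

¬∀⇒∃¬ : LEM → ∀ {A : Set} {P : A → Set} → ¬ (∀ a → P a) → ∃ λ a → ¬ P a
¬∀⇒∃¬ lem {A} {P} ¬h = ¬¬-elim lem λ ¬∃ → ¬h λ a → ¬¬-elim lem λ ¬pa → ¬∃ (a , ¬pa)

-- The failure shows a gap ε at some index beyond the Cauchy moduli of both sequences for ε/4. From
-- there on each sequence moves by at most ε/4, so ε/2 of the gap survives.
≰⇒> : ∀ {x y} → LEM → ¬ (x ≤ y) → y < x
≰⇒> {x} {y} lem x≰y with ¬∀⇒∃¬ lem x≰y
... | ε , h with ¬¬-elim lem (λ ε≯0 → h λ ε>0 → ⊥-elim (ε≯0 ε>0))
...   | ε>0 = ½ ℚ.* ε , 0<½* ε>0 , M ℕ.⊔ N , gap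
  where
  δ = ½ ℚ.* (½ ℚ.* ε)
  M = proj₁ (cauchy x δ (0<½* (0<½* ε>0)))
  N = proj₁ (cauchy y δ (0<½* (0<½* ε>0)))
  witness : ∃ λ m → ¬ (M ℕ.⊔ N ℕ.≤ m → seq x m ℚ.≤ seq y m ℚ.+ ε)
  witness = ¬∀⇒∃¬ lem λ h′ → h λ _ → M ℕ.⊔ N , h′
  m = proj₁ witness
  m≥ : M ℕ.⊔ N ℕ.≤ m
  m≥ = ¬¬-elim lem λ m≱ → proj₂ witness λ m≥ → ⊥-elim (m≱ m≥)
  y+ε≤x : seq y m ℚ.+ ε ℚ.≤ seq x m
  y+ε≤x = ℚₚ.<⇒≤ (ℚₚ.≰⇒> λ h′ → proj₂ witness λ _ → h′)
  open +-*-Solver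
  combine : ∀ a b c d ε → a ℚ.+ ε ℚ.≤ b → c ℚ.≤ a ℚ.+ ½ ℚ.* (½ ℚ.* ε) → b ℚ.≤ d ℚ.+ ½ ℚ.* (½ ℚ.* ε) → c ℚ.+ ½ ℚ.* ε ℚ.≤ d
  combine a b c d ε h₁ h₂ h₃ = ≤-from-gap
    (0≤-+ (p≤q⇒0≤q-p h₁) (0≤-+ (p≤q⇒0≤q-p h₂) (p≤q⇒0≤q-p h₃)))
    (solve 5 (λ a b c d ε → d :- (c :+ con ½ :* ε) :=
      (b :- (a :+ ε)) :+ (((a :+ con ½ :* (con ½ :* ε)) :- c) :+ ((d :+ con ½ :* (con ½ :* ε)) :- b))) refl a b c d ε)
  gap : ∀ n → M ℕ.⊔ N ℕ.≤ n → seq y n ℚ.+ ½ ℚ.* ε ℚ.≤ seq x n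
  gap n n≥ = combine (seq y m) (seq x m) (seq y n) (seq x n) ε y+ε≤x
    (∣p-q∣≤r⇒p≤q+r (seq y n) (seq y m) (proj₂ (cauchy y δ _) n m (ℕₚ.m⊔n≤o⇒n≤o M N n≥) (ℕₚ.m⊔n≤o⇒n≤o M N m≥)))
    (∣p-q∣≤r⇒p≤q+r (seq x m) (seq x n) (proj₂ (cauchy x δ _) m n (ℕₚ.m⊔n≤o⇒m≤o M N m≥) (ℕₚ.m⊔n≤o⇒m≤o M N n≥)))

<ℝ⇒≤ : ∀ {x y} → x < y → x ≤ y
<ℝ⇒≤ {x} {y} (ε , ε>0 , N , h) = ≤-pointwise {x} {y} N λ n n≥ → ℚₚ.≤-trans (p≤p+q (seq x n) (ℚₚ.<⇒≤ ε>0)) (h n n≥)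

<ℝ⇒≱ : ∀ {x y} → x < y → ¬ (y ≤ x)
<ℝ⇒≱ {x} {y} (ε , ε>0 , M , h) y≤x with y≤x (½ ℚ.* ε) (0<½* ε>0)
... | N , h′ = ℚₚ.<-irrefl refl (ℚₚ.<-≤-trans (<-from-gap (0<½* ε>0) (trans (cong (ℚ._- ½ ℚ.* ε) (sym (½+½ ε))) (cancel (½ ℚ.* ε))))
      (cancel-+ (seq x n) (ℚₚ.≤-trans (h n (ℕₚ.m≤m⊔n M N)) (h′ n (ℕₚ.m≤n⊔m M N)))))
  where
  n = M ℕ.⊔ N
  open +-*-Solver
  cancel : ∀ e → (e ℚ.+ e) ℚ.- e ≡ e
  cancel = solve 1 (λ e → (e :+ e) :- e := e) refl
  cancel-+ : ∀ a {p q} → a ℚ.+ p ℚ.≤ a ℚ.+ q → p ℚ.≤ q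
  cancel-+ a {p} {q} h = ≤-from-gap (p≤q⇒0≤q-p h) (solve 3 (λ a p q → q :- p := (a :+ q) :- (a :+ p)) refl a p q)

≤ℝ-total : LEM → ∀ x y → x ≤ y ⊎ y ≤ x
≤ℝ-total lem x y with lem (x ≤ y)
... | yes x≤y = inj₁ x≤y
... | no x≰y = inj₂ (<ℝ⇒≤ {y} {x} (≰⇒> {x} {y} lem x≰y))

-- Yields two rationals, so that a strict inequality of reals descends to a strict one in ℚ. The
-- first lies ε/4 above an approximant from which x strays at most ε/4; of the gap ε this leaves ε/2
-- below y.
<ℝ-dense : ∀ {x y} → x < y → ∃ λ q → ∃ λ ε → 0ℚ ℚ.< ε × x ≤ fromℚ q × fromℚ (q ℚ.+ ε) ≤ y
<ℝ-dense {x} {y} (ε , ε>0 , M , h) with cauchy x δ (0<½* (0<½* ε>0))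
  where δ = ½ ℚ.* (½ ℚ.* ε)
... | N , hx = seq x k ℚ.+ δ , ½ ℚ.* ε , 0<½* ε>0 ,
  ≤-pointwise {x} {fromℚ (seq x k ℚ.+ δ)} k (λ n n≥ → ∣p-q∣≤r⇒p≤q+r (seq x n) (seq x k) (hx n k (ℕₚ.≤-trans (ℕₚ.m≤n⊔m M N) n≥) (ℕₚ.m≤n⊔m M N))) ,
  ≤-pointwise {fromℚ (seq x k ℚ.+ δ ℚ.+ ½ ℚ.* ε)} {y} k (λ n n≥ → combine (seq x k) (seq x n) (seq y n) ε
    (∣p-q∣≤r⇒p≤q+r (seq x k) (seq x n) (hx k n (ℕₚ.m≤n⊔m M N) (ℕₚ.≤-trans (ℕₚ.m≤n⊔m M N) n≥)))
    (h n (ℕₚ.≤-trans (ℕₚ.m≤m⊔n M N) n≥)))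
  where
  δ = ½ ℚ.* (½ ℚ.* ε)
  k = M ℕ.⊔ N
  open +-*-Solver
  combine : ∀ a b c ε → a ℚ.≤ b ℚ.+ ½ ℚ.* (½ ℚ.* ε) → b ℚ.+ ε ℚ.≤ c → (a ℚ.+ ½ ℚ.* (½ ℚ.* ε)) ℚ.+ ½ ℚ.* ε ℚ.≤ c
  combine a b c ε h₁ h₂ = ≤-from-gap (0≤-+ (p≤q⇒0≤q-p h₁) (p≤q⇒0≤q-p h₂))
    (solve 4 (λ a b c ε → c :- ((a :+ con ½ :* (con ½ :* ε)) :+ con ½ :* ε) :=
      ((b :+ con ½ :* (con ½ :* ε)) :- a) :+ (c :- (b :+ ε))) refl a b c ε)

≤0-from-ε : ∀ {x} → (∀ ε → 0ℚ ℚ.< ε → x ≤ fromℚ ε) → x ≤ 0ℝ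
≤0-from-ε {x} h ε ε>0 with h (½ ℚ.* ε) (0<½* ε>0) (½ ℚ.* ε) (0<½* ε>0)
... | N , h′ = N , λ n n≥ → ℚₚ.≤-trans (h′ n n≥)
  (ℚₚ.≤-reflexive (trans (½+½ ε) (sym (ℚₚ.+-identityˡ ε))))

positive-rational : ∀ {x} → 0ℝ < x → ∃ λ ε → 0ℚ ℚ.< ε × fromℚ ε ≤ x
positive-rational {x} (ε , ε>0 , N , h) = ε , ε>0 ,
  ≤-pointwise {fromℚ ε} {x} N λ n n≥ → subst (ℚ._≤ seq x n) (ℚₚ.+-identityˡ ε) (h n n≥)

-- `_⟶_` compares c n with the real x; passing through one late approximant of x reduces this to the
-- diagonal terms, where rational arithmetic applies.
⟶⇒close : ∀ {x} {c} → (fromℚ ∘ c) ⟶ x → ∀ ε → 0ℚ ℚ.< ε → ∃ λ N → ∀ n → N ℕ.≤ n → ℚ.∣ c n ℚ.- seq x n ∣ ℚ.≤ ε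
⟶⇒close {x} {c} c⟶x ε ε>0 with c⟶x (fromℚ δ) (δ , δ>0 , 0 , λ _ _ → ℚₚ.≤-reflexive (ℚₚ.+-identityˡ δ)) | cauchy x (½ ℚ.* ε) (0<½* ε>0)
  where
  δ = ½ ℚ.* (½ ℚ.* ε)
  δ>0 = 0<½* (0<½* ε>0)
... | M , hM | N , hN = M ℕ.⊔ N , close
  where
  δ = ½ ℚ.* (½ ℚ.* ε)
  close : ∀ n → M ℕ.⊔ N ℕ.≤ n → ℚ.∣ c n ℚ.- seq x n ∣ ℚ.≤ ε
  close n n≥ with hM n (ℕₚ.m⊔n≤o⇒m≤o M N n≥) δ (0<½* (0<½* ε>0))
  ... | K , hK = ℚₚ.≤-trans (∣p-r∣≤∣p-q∣+∣q-r∣ (c n) (seq x (K ℕ.⊔ N)) (seq x n))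
    (ℚₚ.≤-trans (ℚₚ.+-mono-≤ (hK (K ℕ.⊔ N) (ℕₚ.m≤m⊔n K N)) (hN (K ℕ.⊔ N) n (ℕₚ.m≤n⊔m K N) (ℕₚ.m⊔n≤o⇒n≤o M N n≥)))
      (ℚₚ.≤-reflexive (trans (cong (ℚ._+ ½ ℚ.* ε) (½+½ (½ ℚ.* ε))) (½+½ ε))))

close⇒⟶ : ∀ {x} {c} → (∀ ε → 0ℚ ℚ.< ε → ∃ λ N → ∀ n → N ℕ.≤ n → ℚ.∣ c n ℚ.- seq x n ∣ ℚ.≤ ε) → (fromℚ ∘ c) ⟶ x
close⇒⟶ {x} {c} h ε (η , η>0 , N , hε) with h (½ ℚ.* η) (0<½* η>0) | cauchy x (½ ℚ.* η) (0<½* η>0)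
... | K , hK | M , hM = K ℕ.⊔ M , λ n n≥ → ≤-pointwise {∣ fromℚ (c n) - x ∣} {ε} (N ℕ.⊔ M) λ m m≥ →
  ℚₚ.≤-trans (∣p-r∣≤∣p-q∣+∣q-r∣ (c n) (seq x n) (seq x m))
    (ℚₚ.≤-trans (ℚₚ.+-mono-≤ (hK n (ℕₚ.m⊔n≤o⇒m≤o K M n≥)) (hM n m (ℕₚ.m⊔n≤o⇒n≤o K M n≥) (ℕₚ.m⊔n≤o⇒n≤o N M m≥)))
      (ℚₚ.≤-trans (ℚₚ.≤-reflexive (trans (½+½ η) (sym (ℚₚ.+-identityˡ η)))) (hε m (ℕₚ.m⊔n≤o⇒m≤o N M m≥))))

-- Bisection, suprema and roots

nested-cauchy : ∀ {l u f : ℕ → ℚ} → (∀ N n → N ℕ.≤ n → l N ℚ.≤ f n × f n ℚ.≤ u N) →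
  (∀ ε → 0ℚ ℚ.< ε → ∃ λ N → u N ℚ.≤ l N ℚ.+ ε) → IsCauchy f
nested-cauchy {l} {u} {f} bounds shrink ε ε>0 =
  let N , u≤l+ε = shrink ε ε>0 in N , λ m n m≥ n≥ →
    ∣p-q∣≤r (f m) (f n) (near N m n u≤l+ε m≥ n≥) (near N n m u≤l+ε n≥ m≥)
  where
  near : ∀ N m n → u N ℚ.≤ l N ℚ.+ ε → N ℕ.≤ m → N ℕ.≤ n → f m ℚ.≤ f n ℚ.+ ε
  near N m n h m≥ n≥ = ℚₚ.≤-trans (proj₂ (bounds N m m≥)) (ℚₚ.≤-trans h (ℚₚ.+-monoˡ-≤ ε (proj₁ (bounds N n n≥))))

-- Q fails at every term of `lower` and holds at every term of `upper`, while the two are equal as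
-- reals. Being an upper bound is read off `upper`, being the least one off `lower`; roots use the
-- two sides likewise.
record Bisection (Q : ℚ → Set) (a b : ℚ) : Set where
  field
    lower upper   : ℝ
    below         : ∀ n → ¬ Q (seq lower n)
    above         : ∀ n → Q (seq upper n)
    a≤lower       : ∀ n → a ℚ.≤ seq lower n
    upper≤lower   : upper ≤ lower
    lower≤upper   : lower ≤ upper

module _ (lem : LEM) {Q : ℚ → Set} {a b : ℚ} (a≤b : a ℚ.≤ b) (¬Qa : ¬ Q a) (Qb : Q b) where
  private
    record State : Set where
      constructor ⟨_,_,_,_,_⟩
      field
        l u : ℚ
        l≤u : l ℚ.≤ u
        ¬Ql : ¬ Q l
        Qu  : Q u
    open State

    mid : ℚ → ℚ → ℚ
    mid l u = ½ ℚ.* (l ℚ.+ u)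

    mid-width₁ : ∀ l u → u ℚ.- mid l u ≡ ½ ℚ.* (u ℚ.- l)
    mid-width₁ = solve 2 (λ l u → u :- con ½ :* (l :+ u) := con ½ :* (u :- l)) refl where open +-*-Solver

    mid-width₂ : ∀ l u → mid l u ℚ.- l ≡ ½ ℚ.* (u ℚ.- l)
    mid-width₂ = solve 2 (λ l u → con ½ :* (l :+ u) :- l := con ½ :* (u :- l)) refl where open +-*-Solver

    l≤mid : ∀ {l u} → l ℚ.≤ u → l ℚ.≤ mid l u
    l≤mid {l} {u} h = ≤-from-gap (0≤-* 0≤½ (p≤q⇒0≤q-p h)) (mid-width₂ l u)

    mid≤u : ∀ {l u} → l ℚ.≤ u → mid l u ℚ.≤ u
    mid≤u {l} {u} h = ≤-from-gap (0≤-* 0≤½ (p≤q⇒0≤q-p h)) (mid-width₁ l u)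

    halve : (s : State) → Dec (Q (mid (l s) (u s))) → State
    halve s (yes q) = ⟨ l s , mid (l s) (u s) , l≤mid (l≤u s) , ¬Ql s , q ⟩
    halve s (no ¬q) = ⟨ mid (l s) (u s) , u s , mid≤u (l≤u s) , ¬q , Qu s ⟩

    l≤halve : ∀ s d → l s ℚ.≤ l (halve s d)
    l≤halve s (yes q) = ℚₚ.≤-refl
    l≤halve s (no ¬q) = l≤mid (l≤u s)

    halve≤u : ∀ s d → u (halve s d) ℚ.≤ u s
    halve≤u s (yes q) = mid≤u (l≤u s)
    halve≤u s (no ¬q) = ℚₚ.≤-refl

    width-halve : ∀ s d → u (halve s d) ℚ.- l (halve s d) ≡ ½ ℚ.* (u s ℚ.- l s)
    width-halve s (yes q) = mid-width₂ (l s) (u s)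
    width-halve s (no ¬q) = mid-width₁ (l s) (u s)

    state : ℕ → State
    state zero = ⟨ a , b , a≤b , ¬Qa , Qb ⟩
    state (suc n) = halve (state n) (lem _)

    l-mono : ∀ n k → l (state n) ℚ.≤ l (state (k ℕ.+ n))
    l-mono n zero = ℚₚ.≤-refl
    l-mono n (suc k) = ℚₚ.≤-trans (l-mono n k) (l≤halve (state (k ℕ.+ n)) (lem _))

    u-mono : ∀ n k → u (state (k ℕ.+ n)) ℚ.≤ u (state n)
    u-mono n zero = ℚₚ.≤-refl
    u-mono n (suc k) = ℚₚ.≤-trans (halve≤u (state (k ℕ.+ n)) (lem _)) (u-mono n k)

    width : ∀ n → u (state n) ℚ.- l (state n) ≡ ½ ^ℚ n ℚ.* (b ℚ.- a)
    width zero = sym (ℚₚ.*-identityˡ (b ℚ.- a))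
    width (suc n) = trans (width-halve (state n) (lem _))
      (trans (cong (½ ℚ.*_) (width n)) (sym (ℚₚ.*-assoc ½ (½ ^ℚ n) (b ℚ.- a))))

    shrink : ∀ ε → 0ℚ ℚ.< ε → ∃ λ N → u (state N) ℚ.≤ l (state N) ℚ.+ ε
    shrink ε ε>0 =
      let D = 1ℚ ℚ.+ (b ℚ.- a)
          D>0 = 0<-+ {1ℚ} {b ℚ.- a} 0<1 (p≤q⇒0≤q-p a≤b)
          N , h = ½^-small {ε ℚ.* inv D} (0<-* ε>0 (0<inv D>0))
      in N , p-q≤r⇒p≤q+r (u (state N)) (l (state N)) (subst (ℚ._≤ ε) (sym (width N))
        (ℚₚ.≤-trans (*-mono-≤ (0≤^ 0≤½ N) (p≤q⇒0≤q-p a≤b) h (b-a≤D D refl))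
          (ℚₚ.≤-reflexive (trans (ℚₚ.*-assoc ε (inv D) D) (trans (cong (ε ℚ.*_) (trans (ℚₚ.*-comm (inv D) D) (*inv D>0))) (ℚₚ.*-identityʳ ε))))))
      where
      b-a≤D : ∀ D → D ≡ 1ℚ ℚ.+ (b ℚ.- a) → b ℚ.- a ℚ.≤ D
      b-a≤D D refl = subst (b ℚ.- a ℚ.≤_) (ℚₚ.+-comm (b ℚ.- a) 1ℚ) (p≤p+q (b ℚ.- a) 0≤1)

    ordered : ∀ {N n} → N ℕ.≤ n → ∃ λ k → n ≡ k ℕ.+ N
    ordered {N} N≤n with ℕₚ.m≤n⇒∃[o]m+o≡n N≤n
    ... | k , refl = k , ℕₚ.+-comm N k

    l-bounds : ∀ N n → N ℕ.≤ n → l (state N) ℚ.≤ l (state n) × l (state n) ℚ.≤ u (state N)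
    l-bounds N n N≤n with ordered N≤n
    ... | k , refl = l-mono N k , ℚₚ.≤-trans (l≤u (state (k ℕ.+ N))) (u-mono N k)

    u-bounds : ∀ N n → N ℕ.≤ n → l (state N) ℚ.≤ u (state n) × u (state n) ℚ.≤ u (state N)
    u-bounds N n N≤n with ordered N≤n
    ... | k , refl = ℚₚ.≤-trans (l-mono N k) (l≤u (state (k ℕ.+ N))) , u-mono N k

    L U : ℝ
    L = mkℝ (l ∘ state) (nested-cauchy {l ∘ state} {u ∘ state} l-bounds shrink)
    U = mkℝ (u ∘ state) (nested-cauchy {l ∘ state} {u ∘ state} u-bounds shrink)

    a≤l : ∀ n → a ℚ.≤ l (state n)
    a≤l n = subst (λ m → a ℚ.≤ l (state m)) (ℕₚ.+-identityʳ n) (l-mono 0 n)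

    U≤L : U ≤ L
    U≤L ε ε>0 = let N , h = shrink ε ε>0 in N , λ n N≤n →
      ℚₚ.≤-trans (proj₂ (u-bounds N n N≤n)) (ℚₚ.≤-trans h (ℚₚ.+-monoˡ-≤ ε (proj₁ (l-bounds N n N≤n))))

  abstract
    bisection : Bisection Q a b
    bisection = record
      { lower = L ; upper = U ; below = ¬Ql ∘ state ; above = Qu ∘ state ; a≤lower = a≤l
      ; upper≤lower = U≤L ; lower≤upper = ≤-pointwise {L} {U} 0 λ n _ → l≤u (state n) }

module _ (lem : LEM) {P : Pred ℝ 0ℓ} {b : ℚ} (bound : ∀ y → P y → y ≤ fromℚ b) (y₀ : ℝ) (Py₀ : P y₀) where
  open Bisection

  private
    Q : ℚ → Set
    Q t = ∀ y → P y → y ≤ fromℚ t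

    a : ℚ
    a = ℚ.- proj₁ (bounded y₀) ℚ.- 1ℚ

    a<y₀ : fromℚ a < y₀
    a<y₀ = let B , _ , N , h = bounded y₀ in 1ℚ , 0<1 , N , λ n N≤n →
      below-neg B (seq y₀ n) (ℚₚ.≤-trans (-p≤∣p∣ (seq y₀ n)) (h n N≤n))
      where
      open +-*-Solver
      below-neg : ∀ B y → ℚ.- y ℚ.≤ B → (ℚ.- B ℚ.- 1ℚ) ℚ.+ 1ℚ ℚ.≤ y
      below-neg B y h = ≤-from-gap (p≤q⇒0≤q-p h)
        (solve 2 (λ B y → y :- ((:- B :- con 1ℚ) :+ con 1ℚ) := B :- (:- y)) refl B y)

    ¬Qa : ¬ Q a
    ¬Qa h = <ℝ⇒≱ {fromℚ a} {y₀} a<y₀ (h y₀ Py₀)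

    a≤b : a ℚ.≤ b
    a≤b = fromℚ-cancel (≤ℝ-trans {fromℚ a} {y₀} {fromℚ b} (<ℝ⇒≤ {fromℚ a} {y₀} a<y₀) (bound y₀ Py₀))

    B : Bisection Q a b
    B = bisection lem {Q} {a} {b} a≤b ¬Qa bound

    least : ∀ c → (∀ y → P y → y ≤ c) → upper B ≤ c
    least c h = ≤ℝ-trans {upper B} {lower B} {c} (upper≤lower B)
      (≥-closed {lower B} {c} λ n → step n (≤ℝ-total lem (fromℚ (seq (lower B) n)) c))
      where
      step : ∀ n → fromℚ (seq (lower B) n) ≤ c ⊎ c ≤ fromℚ (seq (lower B) n) → fromℚ (seq (lower B) n) ≤ c
      step n (inj₁ l≤c) = l≤c
      step n (inj₂ c≤l) = ⊥-elim (below B n λ y Py → ≤ℝ-trans {y} {c} {fromℚ (seq (lower B) n)} (h y Py) c≤l)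

  abstract
    supremum : ∃ λ s → IsSup _≤_ P s
    supremum = upper B , (λ y Py → ≤-closed {y} {upper B} λ n → above B n y Py) , least

module _ (lem : LEM) (k : ℕ) (y : ℝ) (y≥0 : 0ℝ ≤ y) (y≤1 : y ≤ 1ℝ) where
  open Bisection

  private
    Q : ℚ → Set
    Q t = y ≤ fromℚ (t ^ℚ suc k)

    Q1 : Q 1ℚ
    Q1 = ≤ℝ-trans {y} {1ℝ} {fromℚ (1ℚ ^ℚ suc k)} y≤1 (fromℚ-mono (ℚₚ.≤-reflexive (sym (1^ (suc k)))))

    root-zero : Q 0ℚ → ∃ λ z → 0ℝ ≤ z × z ^ suc k ≈ y
    root-zero Q0 = 0ℝ , ≤ℝ-refl {0ℝ} ,
      ≤ℝ-trans {0ℝ ^ suc k} {0ℝ} {y} (≤-pointwise {0ℝ ^ suc k} {0ℝ} 0 λ n _ → ℚₚ.≤-reflexive (ℚₚ.*-zeroˡ (seq (0ℝ ^ k) n))) y≥0 ,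
      ≤ℝ-trans {y} {fromℚ (0ℚ ^ℚ suc k)} {0ℝ ^ suc k} Q0 (fromℚ-^-≥ 0ℚ (suc k))

    root-pos : ¬ Q 0ℚ → ∃ λ z → 0ℝ ≤ z × z ^ suc k ≈ y
    root-pos ¬Q0 = z , L≥0⇒z≥0 , z^≤y , y≤z^
      where
      B = bisection lem {Q} {0ℚ} {1ℚ} 0≤1 ¬Q0 Q1
      L = lower B
      z = upper B
      L≥0 : 0ℝ ≤ L
      L≥0 = ≤-pointwise {0ℝ} {L} 0 λ n _ → a≤lower B n
      L≥0⇒z≥0 : 0ℝ ≤ z
      L≥0⇒z≥0 = ≤ℝ-trans {0ℝ} {L} {z} L≥0 (lower≤upper B)
      L^≤y : L ^ suc k ≤ y
      L^≤y = ≥-closed {L ^ suc k} {y} λ n → subst (λ t → fromℚ t ≤ y) (sym (seq-^ L (suc k) n))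
        (choose n (≤ℝ-total lem (fromℚ (seq L n ^ℚ suc k)) y))
        where
        choose : ∀ n → fromℚ (seq L n ^ℚ suc k) ≤ y ⊎ y ≤ fromℚ (seq L n ^ℚ suc k) → fromℚ (seq L n ^ℚ suc k) ≤ y
        choose n (inj₁ h) = h
        choose n (inj₂ h) = ⊥-elim (below B n h)
      z^≤y : z ^ suc k ≤ y
      z^≤y = ≤ℝ-trans {z ^ suc k} {L ^ suc k} {y} (^ℝ-mono-≤ {z} {L} L≥0⇒z≥0 (upper≤lower B) (suc k)) L^≤y
      y≤z^ : y ≤ z ^ suc k
      y≤z^ = ≤-closed {y} {z ^ suc k} λ n → subst (λ t → y ≤ fromℚ t) (sym (seq-^ z (suc k) n)) (above B n)

  root : ∃ λ z → 0ℝ ≤ z × z ^ suc k ≈ y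
  -- Bisection needs a left end at which Q fails. If Q holds at 0, then y is 0 and so is its root.
  root with lem (Q 0ℚ)
  ... | yes Q0 = root-zero Q0
  ... | no ¬Q0 = root-pos ¬Q0

-- Continued fractions

convergent-suc : ∀ a n → convergent a (suc n) ≡ inv (ι (a 0) ℚ.+ convergent (a ∘ suc) n)
convergent-suc a n = trans (recip-def _) (cong (λ t → inv (t ℚ.+ convergent (a ∘ suc) n)) (ι-def (a 0)))

∣p*q∣≡∣p∣*q : ∀ p {q} → 0ℚ ℚ.≤ q → ℚ.∣ p ℚ.* q ∣ ≡ ℚ.∣ p ∣ ℚ.* q
∣p*q∣≡∣p∣*q p {q} q≥0 = trans (ℚₚ.∣p*q∣≡∣p∣*∣q∣ p q) (cong (ℚ.∣ p ∣ ℚ.*_) (ℚₚ.0≤p⇒∣p∣≡p q≥0))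

0≤inv : ∀ {p} → 0ℚ ℚ.< p → 0ℚ ℚ.≤ inv p
0≤inv p>0 = ℚₚ.<⇒≤ (0<inv p>0)

inv*≤1 : ∀ {p q} → 0ℚ ℚ.< p → q ℚ.≤ p → inv p ℚ.* q ℚ.≤ 1ℚ
inv*≤1 {p} {q} p>0 q≤p = subst (inv p ℚ.* q ℚ.≤_) (trans (ℚₚ.*-comm (inv p) p) (*inv p>0)) (*-monoˡ-≤ (inv p) (0≤inv p>0) q≤p)

inv≤1 : ∀ {p} → 1ℚ ℚ.≤ p → inv p ℚ.≤ 1ℚ
inv≤1 {p} p≥1 = subst (ℚ._≤ 1ℚ) (ℚₚ.*-identityʳ (inv p)) (inv*≤1 (ℚₚ.<-≤-trans 0<1 p≥1) p≥1)

inv-diff : ∀ {p q} → 0ℚ ℚ.< p → 0ℚ ℚ.< q → inv p ℚ.- inv q ≡ (q ℚ.- p) ℚ.* (inv p ℚ.* inv q)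
inv-diff {p} {q} p>0 q>0 = identity p q (inv p) (inv q) (*inv p>0) (*inv q>0)
  where
  identity : ∀ p q x y → p ℚ.* x ≡ 1ℚ → q ℚ.* y ≡ 1ℚ → x ℚ.- y ≡ (q ℚ.- p) ℚ.* (x ℚ.* y)
  identity p q x y px qy = sym (trans (solve 4 (λ p q x y → (q :- p) :* (x :* y) := x :* (q :* y) :- y :* (p :* x)) refl p q x y)
    (cong₂ ℚ._-_ (trans (cong (x ℚ.*_) qy) (ℚₚ.*-identityʳ x)) (trans (cong (y ℚ.*_) px) (ℚₚ.*-identityʳ y))))
    where open +-*-Solver

inv-diff′ : ∀ {p q} → 0ℚ ℚ.< p → 0ℚ ℚ.< q → q ℚ.- p ≡ (inv p ℚ.- inv q) ℚ.* (p ℚ.* q)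
inv-diff′ {p} {q} p>0 q>0 = identity p q (inv p) (inv q) (*inv p>0) (*inv q>0)
  where
  identity : ∀ p q x y → p ℚ.* x ≡ 1ℚ → q ℚ.* y ≡ 1ℚ → q ℚ.- p ≡ (x ℚ.- y) ℚ.* (p ℚ.* q)
  identity p q x y px qy = sym (trans (solve 4 (λ p q x y → (x :- y) :* (p :* q) := q :* (p :* x) :- p :* (q :* y)) refl p q x y)
    (cong₂ ℚ._-_ (trans (cong (q ℚ.*_) px) (ℚₚ.*-identityʳ q)) (trans (cong (p ℚ.*_) qy) (ℚₚ.*-identityʳ p))))
    where open +-*-Solver

-- The map u ↦ 1 / (a + u) divides a distance by the product of the two denominators. Bounding them
-- by H from above here, and by A from below in the next lemma, gives both estimates for one digit.
∣Δ∣≤∣Δinv∣ : ∀ {p q H} → 0ℚ ℚ.< p → 0ℚ ℚ.< q → p ℚ.≤ H → q ℚ.≤ H →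
  ℚ.∣ q ℚ.- p ∣ ℚ.≤ ℚ.∣ inv p ℚ.- inv q ∣ ℚ.* (H ℚ.* H)
∣Δ∣≤∣Δinv∣ {p} {q} {H} p>0 q>0 p≤H q≤H = subst (ℚ._≤ ℚ.∣ inv p ℚ.- inv q ∣ ℚ.* (H ℚ.* H))
  (sym (trans (cong ℚ.∣_∣ (inv-diff′ p>0 q>0)) (∣p*q∣≡∣p∣*q (inv p ℚ.- inv q) (0≤-* p≥0 q≥0))))
  (*-monoˡ-≤ ℚ.∣ inv p ℚ.- inv q ∣ (ℚₚ.0≤∣p∣ (inv p ℚ.- inv q)) (*-mono-≤ p≥0 q≥0 p≤H q≤H))
  where
  p≥0 = ℚₚ.<⇒≤ p>0
  q≥0 = ℚₚ.<⇒≤ q>0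

∣Δinv∣≤∣Δ∣ : ∀ {p q A} → 0ℚ ℚ.< p → 0ℚ ℚ.< q → 0ℚ ℚ.≤ A → A ℚ.≤ p → A ℚ.≤ q →
  ℚ.∣ inv p ℚ.- inv q ∣ ℚ.* (A ℚ.* A) ℚ.≤ ℚ.∣ q ℚ.- p ∣
∣Δinv∣≤∣Δ∣ {p} {q} {A} p>0 q>0 A≥0 A≤p A≤q = subst₂ ℚ._≤_
  (sym (trans (cong (ℚ._* (A ℚ.* A)) (trans (cong ℚ.∣_∣ (inv-diff p>0 q>0)) (∣p*q∣≡∣p∣*q (q ℚ.- p) (0≤-* (0≤inv p>0) (0≤inv q>0)))))
    (regroup ℚ.∣ q ℚ.- p ∣ (inv p) (inv q) A)))
  (ℚₚ.*-identityʳ ℚ.∣ q ℚ.- p ∣)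
  (*-monoˡ-≤ ℚ.∣ q ℚ.- p ∣ (ℚₚ.0≤∣p∣ (q ℚ.- p)) (subst ((inv p ℚ.* A) ℚ.* (inv q ℚ.* A) ℚ.≤_) (ℚₚ.*-identityˡ 1ℚ)
    (*-mono-≤ (0≤-* (0≤inv p>0) A≥0) (0≤-* (0≤inv q>0) A≥0) (inv*≤1 p>0 A≤p) (inv*≤1 q>0 A≤q))))
  where
  open +-*-Solver
  regroup : ∀ d x y A → (d ℚ.* (x ℚ.* y)) ℚ.* (A ℚ.* A) ≡ d ℚ.* ((x ℚ.* A) ℚ.* (y ℚ.* A))
  regroup = solve 4 (λ d x y A → (d :* (x :* y)) :* (A :* A) := d :* ((x :* A) :* (y :* A))) refl

Positive : (ℕ → ℕ) → Set
Positive a = ∀ k → 1 ℕ.≤ a k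

0≤convergent : ∀ {a} → Positive a → ∀ n → 0ℚ ℚ.≤ convergent a n
denominator>0 : ∀ {a} → Positive a → ∀ n → 0ℚ ℚ.< ι (a 0) ℚ.+ convergent (a ∘ suc) n

0≤convergent a≥1 zero = ℚₚ.≤-refl
0≤convergent {a} a≥1 (suc n) = subst (0ℚ ℚ.≤_) (sym (convergent-suc a n)) (0≤inv (denominator>0 a≥1 n))

denominator>0 {a} a≥1 n = 0<-+ {ι (a 0)} {convergent (a ∘ suc) n} (ℚₚ.<-≤-trans 0<1 (1≤ι (a≥1 0))) (0≤convergent (a≥1 ∘ suc) n)

denominator≥ : ∀ {a} → Positive a → ∀ n → ι (a 0) ℚ.≤ ι (a 0) ℚ.+ convergent (a ∘ suc) n
denominator≥ {a} a≥1 n = p≤p+q (ι (a 0)) (0≤convergent (a≥1 ∘ suc) n)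

convergent≤inv : ∀ {a} → Positive a → ∀ n → convergent a n ℚ.≤ inv (ι (a 0))
convergent≤inv {a} a≥1 zero = 0≤inv (ℚₚ.<-≤-trans 0<1 (1≤ι (a≥1 0)))
convergent≤inv {a} a≥1 (suc n) = subst (ℚ._≤ inv (ι (a 0))) (sym (convergent-suc a n))
  (inv-anti-≤ (ℚₚ.<-≤-trans 0<1 (1≤ι (a≥1 0))) (denominator≥ a≥1 n))

convergent≤1 : ∀ {a} → Positive a → ∀ n → convergent a n ℚ.≤ 1ℚ
convergent≤1 a≥1 n = ℚₚ.≤-trans (convergent≤inv a≥1 n) (inv≤1 (1≤ι (a≥1 0)))

denominator≤ : ∀ {a} → Positive a → ∀ n → ι (a 0) ℚ.+ convergent (a ∘ suc) n ℚ.≤ ι (suc (a 0))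
denominator≤ {a} a≥1 n = subst (ι (a 0) ℚ.+ convergent (a ∘ suc) n ℚ.≤_)
  (trans (ℚₚ.+-comm (ι (a 0)) 1ℚ) (sym (ι-suc (a 0)))) (ℚₚ.+-monoʳ-≤ (ι (a 0)) (convergent≤1 (a≥1 ∘ suc) n))

inv≤convergent : ∀ {a} → Positive a → ∀ n → inv (ι (suc (a 0))) ℚ.≤ convergent a (suc n)
inv≤convergent {a} a≥1 n = subst (inv (ι (suc (a 0))) ℚ.≤_) (sym (convergent-suc a n))
  (inv-anti-≤ (denominator>0 a≥1 n) (denominator≤ a≥1 n))

-- The value of the fraction is largest when a 0 = 1; even then the second digit keeps it away from
-- 1 by a fixed margin, which makes limits strictly less than 1.
upper-gap : (ℕ → ℕ) → ℚ
upper-gap a = inv (1ℚ ℚ.+ inv (ι (suc (a 1))))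

convergent≤upper-gap : ∀ {a} → Positive a → ∀ n → convergent a (suc (suc n)) ℚ.≤ upper-gap a
convergent≤upper-gap {a} a≥1 n = subst (ℚ._≤ upper-gap a) (sym (convergent-suc a (suc n)))
  (inv-anti-≤ (0<-+ 0<1 (0≤inv (0<ι (a 1)))) (ℚₚ.+-mono-≤ (1≤ι (a≥1 0)) (inv≤convergent (a≥1 ∘ suc) n)))

upper-gap<1 : ∀ a → upper-gap a ℚ.< 1ℚ
upper-gap<1 a = ℚₚ.≰⇒> λ 1≤g → ℚₚ.<-irrefl refl (ℚₚ.<-≤-trans 1<s
  (ℚₚ.≤-trans (subst (ℚ._≤ inv s ℚ.* s) (ℚₚ.*-identityˡ s) (*-monoʳ-≤ s (ℚₚ.<⇒≤ s>0) 1≤g)) (inv*≤1 s>0 ℚₚ.≤-refl)))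
  where
  e = inv (ι (suc (a 1)))
  e>0 : 0ℚ ℚ.< e
  e>0 = 0<inv (0<ι (a 1))
  s = 1ℚ ℚ.+ e
  s>0 : 0ℚ ℚ.< s
  s>0 = 0<-+ 0<1 (ℚₚ.<⇒≤ e>0)
  1<s : 1ℚ ℚ.< s
  1<s = <-from-gap e>0 (solve 1 (λ e → (con 1ℚ :+ e) :- con 1ℚ := e) refl e) where open +-*-Solver

-- Replaces the squared denominators of the convergents, so that no continuants are required. The
-- recursion starts at the front, like that of `convergent`; `∏²-snoc` opens the other end.
∏² : (ℕ → ℕ) → ℕ → ℕ
∏² a zero = 1
∏² a (suc n) = (a 0 ℕ.* a 0) ℕ.* ∏² (a ∘ suc) n

ι-∏²-suc : ∀ a n → ι (∏² a (suc n)) ≡ (ι (a 0) ℚ.* ι (a 0)) ℚ.* ι (∏² (a ∘ suc) n)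
ι-∏²-suc a n = trans (ι-* (a 0 ℕ.* a 0) (∏² (a ∘ suc) n)) (cong (ℚ._* ι (∏² (a ∘ suc) n)) (ι-* (a 0) (a 0)))

cancel-shift : ∀ A u v → (A ℚ.+ v) ℚ.- (A ℚ.+ u) ≡ v ℚ.- u
cancel-shift = solve 3 (λ A u v → (A :+ v) :- (A :+ u) := v :- u) refl where open +-*-Solver

∣p-q∣≤1 : ∀ p q → 0ℚ ℚ.≤ p → p ℚ.≤ 1ℚ → 0ℚ ℚ.≤ q → q ℚ.≤ 1ℚ → ℚ.∣ p ℚ.- q ∣ ℚ.≤ 1ℚ
∣p-q∣≤1 p q p≥0 p≤1 q≥0 q≤1 = ∣p-q∣≤r p q
  (ℚₚ.≤-trans p≤1 (subst (1ℚ ℚ.≤_) (ℚₚ.+-comm 1ℚ q) (p≤p+q 1ℚ q≥0)))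
  (ℚₚ.≤-trans q≤1 (subst (1ℚ ℚ.≤_) (ℚₚ.+-comm 1ℚ p) (p≤p+q 1ℚ p≥0)))

-- Each shared digit d contracts distances by at least d², and all convergents lie in [0,1].
common-prefix-close : ∀ ℓ {a b} → Positive a → Positive b → (∀ i → i ℕ.< ℓ → a i ≡ b i) →
  ∀ m n → ℓ ℕ.≤ m → ℓ ℕ.≤ n → ℚ.∣ convergent a m ℚ.- convergent b n ∣ ℚ.* ι (∏² a ℓ) ℚ.≤ 1ℚ
common-prefix-close zero {a} {b} a≥1 b≥1 same m n _ _ = subst (ℚ._≤ 1ℚ)
  (sym (trans (cong (ℚ.∣ convergent a m ℚ.- convergent b n ∣ ℚ.*_) ι-1) (ℚₚ.*-identityʳ _)))
  (∣p-q∣≤1 (convergent a m) (convergent b n) (0≤convergent a≥1 m) (convergent≤1 a≥1 m) (0≤convergent b≥1 n) (convergent≤1 b≥1 n))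
common-prefix-close (suc ℓ) {a} {b} a≥1 b≥1 same (suc m) (suc n) (ℕ.s≤s ℓ≤m) (ℕ.s≤s ℓ≤n) =
  subst (ℚ._≤ 1ℚ) (sym lhs) (ℚₚ.≤-trans (*-monoʳ-≤ (ι (∏² (a ∘ suc) ℓ)) (0≤ι _) step)
    (common-prefix-close ℓ (a≥1 ∘ suc) (b≥1 ∘ suc) (λ i i<ℓ → same (suc i) (ℕ.s≤s i<ℓ)) m n ℓ≤m ℓ≤n))
  where
  A = ι (a 0)
  u = convergent (a ∘ suc) m
  v = convergent (b ∘ suc) n
  p = A ℚ.+ u
  q = A ℚ.+ v
  p>0 : 0ℚ ℚ.< p
  p>0 = denominator>0 a≥1 m
  A≡ : ι (b 0) ≡ A
  A≡ = cong ι (sym (same 0 (ℕ.s≤s ℕ.z≤n)))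
  q>0 : 0ℚ ℚ.< q
  q>0 = subst (λ t → 0ℚ ℚ.< t ℚ.+ v) A≡ (denominator>0 b≥1 n)
  step : ℚ.∣ inv p ℚ.- inv q ∣ ℚ.* (A ℚ.* A) ℚ.≤ ℚ.∣ u ℚ.- v ∣
  step = subst (ℚ.∣ inv p ℚ.- inv q ∣ ℚ.* (A ℚ.* A) ℚ.≤_)
    (trans (cong ℚ.∣_∣ (cancel-shift A u v)) (∣p-q∣-comm v u))
    (∣Δinv∣≤∣Δ∣ p>0 q>0 (0≤ι (a 0)) (denominator≥ a≥1 m) (p≤p+q A (0≤convergent (b≥1 ∘ suc) n)))
  lhs : ℚ.∣ convergent a (suc m) ℚ.- convergent b (suc n) ∣ ℚ.* ι (∏² a (suc ℓ)) ≡ (ℚ.∣ inv p ℚ.- inv q ∣ ℚ.* (A ℚ.* A)) ℚ.* ι (∏² (a ∘ suc) ℓ)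
  lhs = trans (cong₂ ℚ._*_
      (cong ℚ.∣_∣ (cong₂ ℚ._-_ (convergent-suc a m) (trans (convergent-suc b n) (cong (λ t → inv (t ℚ.+ v)) A≡))))
      (ι-∏²-suc a ℓ))
    (sym (ℚₚ.*-assoc ℚ.∣ inv p ℚ.- inv q ∣ (A ℚ.* A) (ι (∏² (a ∘ suc) ℓ))))

-- A digit below H contracts distances by at most H². Where the digits differ, the denominators are
-- still at least 1/2 apart, because the next digits are at least 2 and so both tails are at most
-- 1/2; this is the factor 2.
first-difference-far : ∀ n {a b H} → Positive a → Positive b → (∀ k → 2 ℕ.≤ a (suc k)) → (∀ k → 2 ℕ.≤ b (suc k)) →
  (∀ k → a k ℕ.< H k) → (∀ k → b k ℕ.< H k) → (∀ i → i ℕ.< n → a i ≡ b i) → a n ≢ b n →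
  ∀ m → n ℕ.< m → 1ℚ ℚ.≤ ℚ.∣ convergent a m ℚ.- convergent b m ∣ ℚ.* ι (2 ℕ.* ∏² H (suc n))
first-difference-far n {a} {b} {H} a≥1 b≥1 a≥2 b≥2 a<H b<H same a≢b (suc m) (ℕ.s≤s n≤m) =
  subst (1ℚ ℚ.≤_) (sym rhs) (goal n same a≢b n≤m)
  where
  h = ι (H 0)
  u = convergent (a ∘ suc) m
  v = convergent (b ∘ suc) m
  p = ι (a 0) ℚ.+ u
  q = ι (b 0) ℚ.+ v
  d = ℚ.∣ inv p ℚ.- inv q ∣
  rest : ℕ → ℚ
  rest n = ι (∏² (H ∘ suc) n)
  ι2 = ι 2
  step : ℚ.∣ q ℚ.- p ∣ ℚ.≤ d ℚ.* (h ℚ.* h)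
  step = ∣Δ∣≤∣Δinv∣ (denominator>0 a≥1 m) (denominator>0 b≥1 m)
    (ℚₚ.≤-trans (denominator≤ a≥1 m) (ι-mono-≤ (a<H 0))) (ℚₚ.≤-trans (denominator≤ b≥1 m) (ι-mono-≤ (b<H 0)))
  regroup : ∀ d h t r → d ℚ.* (t ℚ.* ((h ℚ.* h) ℚ.* r)) ≡ (d ℚ.* (h ℚ.* h)) ℚ.* (t ℚ.* r)
  regroup = solve 4 (λ d h t r → d :* (t :* ((h :* h) :* r)) := (d :* (h :* h)) :* (t :* r)) refl where open +-*-Solver
  rhs : ℚ.∣ convergent a (suc m) ℚ.- convergent b (suc m) ∣ ℚ.* ι (2 ℕ.* ∏² H (suc n)) ≡ (d ℚ.* (h ℚ.* h)) ℚ.* (ι2 ℚ.* rest n)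
  rhs = trans (cong₂ ℚ._*_ (cong ℚ.∣_∣ (cong₂ ℚ._-_ (convergent-suc a m) (convergent-suc b m)))
      (trans (ι-* 2 (∏² H (suc n))) (cong (ι2 ℚ.*_) (ι-∏²-suc H n))))
    (regroup d h ι2 (rest n))
  inv2≤½ : ∀ {k} → 2 ℕ.≤ k → inv (ι k) ℚ.≤ ½
  inv2≤½ {k} 2≤k = ℚₚ.≤-trans (inv-anti-≤ (0<ι 1) (ι-mono-≤ 2≤k)) (ℚₚ.≤-reflexive (sym (inv-unique (0<ι 1) ι2*½)))
    where
    ι2*½ : ι 2 ℚ.* ½ ≡ 1ℚ
    ι2*½ = trans (cong (ℚ._* ½) (trans (ι-suc 1) (cong (1ℚ ℚ.+_) ι-1))) refl
  ι2≡ : ι2 ≡ 1ℚ ℚ.+ 1ℚ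
  ι2≡ = trans (ι-suc 1) (cong (1ℚ ℚ.+_) ι-1)
  gap : ∀ {i j} → i ℕ.< j → ∀ x y → 0ℚ ℚ.≤ y → x ℚ.≤ ½ → ½ ℚ.≤ (ι j ℚ.+ y) ℚ.- (ι i ℚ.+ x)
  gap {i} {j} i<j x y y≥0 x≤½ = ≤-from-gap
    (0≤-+ (0≤-+ (p≤q⇒0≤q-p (subst (ℚ._≤ ι j) (ι-suc i) (ι-mono-≤ i<j))) y≥0) (p≤q⇒0≤q-p x≤½))
    (solve 4 (λ i j x y → ((j :+ y) :- (i :+ x)) :- con ½ := ((j :- (con 1ℚ :+ i)) :+ y) :+ (con ½ :- x)) refl (ι i) (ι j) x y)
    where open +-*-Solver
  u≤½ : u ℚ.≤ ½
  u≤½ = ℚₚ.≤-trans (convergent≤inv (a≥1 ∘ suc) m) (inv2≤½ (a≥2 0))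
  v≤½ : v ℚ.≤ ½
  v≤½ = ℚₚ.≤-trans (convergent≤inv (b≥1 ∘ suc) m) (inv2≤½ (b≥2 0))
  ½≤∣q-p∣ : a 0 ≢ b 0 → ½ ℚ.≤ ℚ.∣ q ℚ.- p ∣
  ½≤∣q-p∣ a≢b with ℕₚ.<-cmp (a 0) (b 0)
  ... | Rel.tri< a<b _ _ = ℚₚ.≤-trans (gap a<b u v (0≤convergent (b≥1 ∘ suc) m) u≤½) (p≤∣p∣ (q ℚ.- p))
  ... | Rel.tri≈ _ a≡b _ = ⊥-elim (a≢b a≡b)
  ... | Rel.tri> _ _ b<a = ℚₚ.≤-trans (gap b<a v u (0≤convergent (a≥1 ∘ suc) m) v≤½)
      (subst (p ℚ.- q ℚ.≤_) (∣p-q∣-comm p q) (p≤∣p∣ (p ℚ.- q)))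
  goal : ∀ n → (∀ i → i ℕ.< n → a i ≡ b i) → a n ≢ b n → n ℕ.≤ m → 1ℚ ℚ.≤ (d ℚ.* (h ℚ.* h)) ℚ.* (ι2 ℚ.* rest n)
  goal zero same a≢b _ = subst₂ ℚ._≤_ (trans (cong (½ ℚ.*_) (trans (cong₂ ℚ._*_ ι2≡ ι-1) refl)) refl) refl
    (*-monoʳ-≤ (ι2 ℚ.* rest 0) (0≤-* (0≤ι 2) (0≤ι _)) (ℚₚ.≤-trans (½≤∣q-p∣ a≢b) step))
  goal (suc n) same a≢b n<m = ℚₚ.≤-trans
    (subst (λ t → 1ℚ ℚ.≤ ℚ.∣ u ℚ.- v ∣ ℚ.* t) (ι-* 2 (∏² (H ∘ suc) (suc n)))
      (first-difference-far n (a≥1 ∘ suc) (b≥1 ∘ suc) (a≥2 ∘ suc) (b≥2 ∘ suc) (a<H ∘ suc) (b<H ∘ suc)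
        (λ i i<n → same (suc i) (ℕ.s≤s i<n)) a≢b m n<m))
    (*-monoʳ-≤ (ι2 ℚ.* rest (suc n)) (0≤-* (0≤ι 2) (0≤ι _))
      (subst (ℚ._≤ d ℚ.* (h ℚ.* h)) (trans (cong ℚ.∣_∣ (trans (cong (λ t → (ι t ℚ.+ v) ℚ.- p) (sym (same 0 (ℕ.s≤s ℕ.z≤n)))) (cancel-shift (ι (a 0)) u v))) (∣p-q∣-comm v u)) step))

-- Irrationality and uniqueness of expansions

Tends : (ℕ → ℚ) → ℚ → Set
Tends c r = ∀ ε → 0ℚ ℚ.< ε → ∃ λ N → ∀ n → N ℕ.≤ n → ℚ.∣ c n ℚ.- r ∣ ℚ.≤ ε

Tends-≥ : ∀ {c r s} → Tends c r → (∃ λ M → ∀ n → M ℕ.≤ n → s ℚ.≤ c n) → s ℚ.≤ r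
Tends-≥ {c} {r} {s} lim (M , h) = ≤-from-ε λ ε ε>0 →
  let N , hN = lim ε ε>0
      n = M ℕ.⊔ N
  in ℚₚ.≤-trans (h n (ℕₚ.m≤m⊔n M N)) (∣p-q∣≤r⇒p≤q+r (c n) r (hN n (ℕₚ.m≤n⊔m M N)))

Tends-≤ : ∀ {c r s} → Tends c r → (∃ λ M → ∀ n → M ℕ.≤ n → c n ℚ.≤ s) → r ℚ.≤ s
Tends-≤ {c} {r} {s} lim (M , h) = ≤-from-ε λ ε ε>0 →
  let N , hN = lim ε ε>0
      n = M ℕ.⊔ N
  in ℚₚ.≤-trans (∣p-q∣≤r⇒q≤p+r (c n) r (hN n (ℕₚ.m≤n⊔m M N))) (ℚₚ.+-monoˡ-≤ ε (h n (ℕₚ.m≤m⊔n M N)))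

limit>0 : ∀ {a r} → Positive a → Tends (convergent a) r → 0ℚ ℚ.< r
limit>0 {a} a≥1 lim = ℚₚ.<-≤-trans (0<inv (0<ι (a 0))) (Tends-≥ lim (1 , late))
  where
  late : ∀ n → 1 ℕ.≤ n → inv (ι (suc (a 0))) ℚ.≤ convergent a n
  late (suc n) _ = inv≤convergent a≥1 n

limit<1 : ∀ {a r} → Positive a → Tends (convergent a) r → r ℚ.< 1ℚ
limit<1 {a} a≥1 lim = ℚₚ.≤-<-trans (Tends-≤ lim (2 , late)) (upper-gap<1 a)
  where
  late : ∀ n → 2 ℕ.≤ n → convergent a n ℚ.≤ upper-gap a
  late (suc (suc n)) _ = convergent≤upper-gap a≥1 n
  late (suc zero) (ℕ.s≤s ())

*-inv-cancel : ∀ p {q} → 0ℚ ℚ.< q → (p ℚ.* inv q) ℚ.* q ≡ p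
*-inv-cancel p {q} q>0 = trans (ℚₚ.*-assoc p (inv q) q)
  (trans (cong (p ℚ.*_) (trans (ℚₚ.*-comm (inv q) q) (*inv q>0))) (ℚₚ.*-identityʳ p))

limit-tail : ∀ {a r} → Positive a → Tends (convergent a) r → Tends (convergent (a ∘ suc)) (inv r ℚ.- ι (a 0))
limit-tail {a} {r} a≥1 lim ε ε>0 =
  let N , h = lim (ε ℚ.* inv (H ℚ.* H)) (0<-* ε>0 (0<inv H²>0)) in N , λ n N≤n →
    ℚₚ.≤-trans (ℚₚ.≤-reflexive (trans (cong ℚ.∣_∣ (regroup (convergent (a ∘ suc) n) R (ι (a 0)))) (∣p-q∣-comm (P n) R)))
      (ℚₚ.≤-trans (∣Δ∣≤∣Δinv∣ {P n} {R} {H} (P>0 n) R>0 (P≤H n) R≤H)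
        (subst₂ ℚ._≤_ (cong (ℚ._* (H ℚ.* H)) (cong ℚ.∣_∣ (cong₂ ℚ._-_ (convergent-suc a n) (inv-unique R>0 (trans (ℚₚ.*-comm R r) (*inv r>0))))))
          (*-inv-cancel ε H²>0)
          (*-monoʳ-≤ (H ℚ.* H) (ℚₚ.<⇒≤ H²>0) (h (suc n) (ℕₚ.m≤n⇒m≤1+n N≤n)))))
  where
  r>0 = limit>0 a≥1 lim
  R = inv r
  R>0 : 0ℚ ℚ.< R
  R>0 = 0<inv r>0
  H = ι (suc (a 0))
  H²>0 : 0ℚ ℚ.< H ℚ.* H
  H²>0 = 0<-* (0<ι (a 0)) (0<ι (a 0))
  P : ℕ → ℚ
  P n = ι (a 0) ℚ.+ convergent (a ∘ suc) n
  P>0 : ∀ n → 0ℚ ℚ.< P n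
  P>0 = denominator>0 a≥1
  P≤H : ∀ n → P n ℚ.≤ H
  P≤H = denominator≤ a≥1
  late : ∀ n → 1 ℕ.≤ n → inv H ℚ.≤ convergent a n
  late (suc n) _ = inv≤convergent a≥1 n
  R≤H : R ℚ.≤ H
  R≤H = subst (R ℚ.≤_) (sym (inv-unique (0<inv (0<ι (a 0))) (trans (ℚₚ.*-comm (inv H) H) (*inv (0<ι (a 0))))))
    (inv-anti-≤ (0<inv (0<ι (a 0))) (Tends-≥ lim (1 , late)))
  regroup : ∀ u R A → u ℚ.- (R ℚ.- A) ≡ (A ℚ.+ u) ℚ.- R
  regroup = solve 3 (λ u R A → u :- (R :- A) := (A :+ u) :- R) refl where open +-*-Solver

-- Descent on the numerator: for r = m / n the tail 1 / r - a₀ = (n - a₀ m) / m is again in (0,1).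
limit-irrational : ∀ fuel {a r} m n → m ℕ.≤ fuel → 0ℚ ℚ.< ι n → Positive a → Tends (convergent a) r → r ℚ.* ι n ≢ ι m
limit-irrational zero zero n ℕ.z≤n n>0 a≥1 lim eq =
  ℚₚ.<-irrefl (sym (trans eq ι-0)) (0<-* (limit>0 a≥1 lim) n>0)
limit-irrational (suc fuel) {a} {r} m n m≤ n>0 a≥1 lim eq =
  limit-irrational fuel o m (ℕₚ.≤-pred (ℕₚ.≤-trans o<m m≤)) m>0 (a≥1 ∘ suc) tail r′m≡o
  where
  r>0 = limit>0 a≥1 lim
  tail = limit-tail a≥1 lim
  r′ = inv r ℚ.- ι (a 0)
  m>0 : 0ℚ ℚ.< ι m
  m>0 = subst (0ℚ ℚ.<_) eq (0<-* r>0 n>0)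
  r′m≡ : r′ ℚ.* ι m ≡ ι n ℚ.- ι (a 0 ℕ.* m)
  r′m≡ = trans (expand (inv r) (ι (a 0)) (ι m)) (cong₂ ℚ._-_
    (trans (cong (inv r ℚ.*_) (sym eq)) (trans (sym (ℚₚ.*-assoc (inv r) r (ι n)))
      (trans (cong (ℚ._* ι n) (trans (ℚₚ.*-comm (inv r) r) (*inv r>0))) (ℚₚ.*-identityˡ (ι n)))))
    (sym (ι-* (a 0) m)))
    where
    open +-*-Solver
    expand : ∀ x y z → (x ℚ.- y) ℚ.* z ≡ x ℚ.* z ℚ.- y ℚ.* z
    expand = solve 3 (λ x y z → (x :- y) :* z := x :* z :- y :* z) refl
  am<n : a 0 ℕ.* m ℕ.< n
  am<n = ι-cancel-< (<-from-gap (0<-* (limit>0 (a≥1 ∘ suc) tail) m>0) (sym r′m≡))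
  o = n ℕ.∸ a 0 ℕ.* m
  r′m≡o : r′ ℚ.* ι m ≡ ι o
  r′m≡o = trans r′m≡ (trans (cong (λ t → ι t ℚ.- ι (a 0 ℕ.* m)) (sym (ℕₚ.m∸n+n≡m (ℕₚ.<⇒≤ am<n))))
    (trans (cong (ℚ._- ι (a 0 ℕ.* m)) (ι-+ o (a 0 ℕ.* m))) (cancel (ι o) (ι (a 0 ℕ.* m)))))
    where
    open +-*-Solver
    cancel : ∀ x y → (x ℚ.+ y) ℚ.- y ≡ x
    cancel = solve 2 (λ x y → (x :+ y) :- y := x) refl
  o<m : o ℕ.< m
  o<m = ι-cancel-< (subst₂ ℚ._<_ r′m≡o (ℚₚ.*-identityˡ (ι m))
    (ℚₚ.*-monoˡ-<-pos (ι m) {{ℚ.positive m>0}} (limit<1 (a≥1 ∘ suc) tail)))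

¬Tends-rational : ∀ {a} r → Positive a → ¬ Tends (convergent a) r
¬Tends-rational r a≥1 lim =
  let m , k , r≡ = nonNeg-fraction r (ℚₚ.<⇒≤ (limit>0 a≥1 lim))
  in limit-irrational m m (suc k) ℕₚ.≤-refl (0<ι k) a≥1 lim (trans (cong (ℚ._* ι (suc k)) r≡) (frac-*-ι m k))

-- Comparing two expansions directly, without their common limit, gives a relation that passes to
-- the tails by rational arithmetic alone.
Close : (ℕ → ℚ) → (ℕ → ℚ) → Set
Close c c′ = ∀ ε → 0ℚ ℚ.< ε → ∃ λ N → ∀ n → N ℕ.≤ n → ℚ.∣ c n ℚ.- c′ n ∣ ℚ.≤ ε

Close-sym : ∀ c c′ → Close c c′ → Close c′ c
Close-sym c c′ h ε ε>0 = let N , hN = h ε ε>0 in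
  N , λ n n≥ → subst (ℚ._≤ ε) (∣p-q∣-comm (c n) (c′ n)) (hN n n≥)

Close-denominators : ∀ {a b} → Positive a → Positive b → Close (convergent a) (convergent b) →
  Close (λ n → ι (b 0) ℚ.+ convergent (b ∘ suc) n) (λ n → ι (a 0) ℚ.+ convergent (a ∘ suc) n)
Close-denominators {a} {b} a≥1 b≥1 close ε ε>0 =
  let N , h = close (ε ℚ.* inv (H ℚ.* H)) (0<-* ε>0 (0<inv H²>0)) in N , λ n N≤n →
    ℚₚ.≤-trans (∣Δ∣≤∣Δinv∣ (denominator>0 a≥1 n) (denominator>0 b≥1 n)
        (ℚₚ.≤-trans (denominator≤ a≥1 n) (ι-mono-≤ (ℕ.s≤s (ℕₚ.m≤m⊔n (a 0) (b 0)))))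
        (ℚₚ.≤-trans (denominator≤ b≥1 n) (ι-mono-≤ (ℕ.s≤s (ℕₚ.m≤n⊔m (a 0) (b 0))))))
      (subst₂ ℚ._≤_ (cong (ℚ._* (H ℚ.* H)) (cong ℚ.∣_∣ (cong₂ ℚ._-_ (convergent-suc a n) (convergent-suc b n))))
        (*-inv-cancel ε H²>0)
        (*-monoʳ-≤ (H ℚ.* H) (ℚₚ.<⇒≤ H²>0) (h (suc n) (ℕₚ.m≤n⇒m≤1+n N≤n))))
  where
  H = ι (suc (a 0 ℕ.⊔ b 0))
  H²>0 : 0ℚ ℚ.< H ℚ.* H
  H²>0 = 0<-* (0<ι _) (0<ι _)

-- If a 0 < b 0, then a 0 + u ≤ a 0 + 1 ≤ b 0 + v, so the two denominators can approach each other
-- only if u tends to 1. By `limit<1` it does not.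
first-digit-≮ : ∀ {a b} → Positive a → Positive b → Close (convergent a) (convergent b) → ¬ (a 0 ℕ.< b 0)
first-digit-≮ {a} {b} a≥1 b≥1 close a<b = ℚₚ.<-irrefl refl (limit<1 (a≥1 ∘ suc) u→1)
  where
  u v : ℕ → ℚ
  u = convergent (a ∘ suc)
  v = convergent (b ∘ suc)
  squeeze : ∀ A B u v → 1ℚ ℚ.+ A ℚ.≤ B → 0ℚ ℚ.≤ v → ∀ ε → B ℚ.+ v ℚ.≤ (A ℚ.+ u) ℚ.+ ε → 1ℚ ℚ.≤ u ℚ.+ ε
  squeeze A B u v h₁ h₂ ε h₃ = ≤-from-gap (0≤-+ (0≤-+ (p≤q⇒0≤q-p h₁) h₂) (p≤q⇒0≤q-p h₃))
    (solve 5 (λ A B u v ε → (u :+ ε) :- con 1ℚ := ((B :- (con 1ℚ :+ A)) :+ v) :+ (((A :+ u) :+ ε) :- (B :+ v))) refl A B u v ε)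
    where open +-*-Solver
  u→1 : Tends u 1ℚ
  u→1 ε ε>0 = let N , h = Close-denominators a≥1 b≥1 close ε ε>0 in N , λ n N≤n →
    ∣p-q∣≤r (u n) 1ℚ (ℚₚ.≤-trans (convergent≤1 (a≥1 ∘ suc) n) (p≤p+q 1ℚ (ℚₚ.<⇒≤ ε>0)))
      (squeeze (ι (a 0)) (ι (b 0)) (u n) (v n) (subst (ℚ._≤ ι (b 0)) (ι-suc (a 0)) (ι-mono-≤ a<b))
        (0≤convergent (b≥1 ∘ suc) n) ε (∣p-q∣≤r⇒p≤q+r (ι (b 0) ℚ.+ v n) (ι (a 0) ℚ.+ u n) (h n N≤n)))

first-digit-unique : ∀ {a b} → Positive a → Positive b → Close (convergent a) (convergent b) → a 0 ≡ b 0
first-digit-unique {a} {b} a≥1 b≥1 close = ℕₚ.≤-antisym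
  (ℕₚ.≮⇒≥ (first-digit-≮ b≥1 a≥1 (Close-sym (convergent a) (convergent b) close))) (ℕₚ.≮⇒≥ (first-digit-≮ a≥1 b≥1 close))

digits-unique : ∀ {a b} → Positive a → Positive b → Close (convergent a) (convergent b) → ∀ k → a k ≡ b k
digits-unique a≥1 b≥1 close zero = first-digit-unique a≥1 b≥1 close
digits-unique {a} {b} a≥1 b≥1 close (suc k) = digits-unique (a≥1 ∘ suc) (b≥1 ∘ suc) tails k
  where
  tails : Close (convergent (a ∘ suc)) (convergent (b ∘ suc))
  tails ε ε>0 = let N , h = Close-denominators a≥1 b≥1 close ε ε>0 in N , λ n N≤n →
    subst (ℚ._≤ ε) (trans (cong ℚ.∣_∣ (trans (cong (λ t → (ι t ℚ.+ convergent (b ∘ suc) n) ℚ.- (ι (a 0) ℚ.+ convergent (a ∘ suc) n))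
        (sym (first-digit-unique a≥1 b≥1 close))) (cancel-shift (ι (a 0)) (convergent (a ∘ suc) n) (convergent (b ∘ suc) n))))
      (∣p-q∣-comm (convergent (b ∘ suc) n) (convergent (a ∘ suc) n))) (h n N≤n)

quotients-unique : ∀ {x a b} → ArePartialQuotients x a → ArePartialQuotients x b → ∀ k → a k ≡ b k
quotients-unique {x} {a} {b} (a≥1 , a⟶x) (b≥1 , b⟶x) = digits-unique a≥1 b≥1 λ ε ε>0 →
  let M , hM = ⟶⇒close {x} {convergent a} a⟶x (½ ℚ.* ε) (0<½* ε>0)
      N , hN = ⟶⇒close {x} {convergent b} b⟶x (½ ℚ.* ε) (0<½* ε>0)
  in M ℕ.⊔ N , λ n n≥ → ℚₚ.≤-trans (∣p-r∣≤∣p-q∣+∣q-r∣ (convergent a n) (seq x n) (convergent b n))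
    (ℚₚ.≤-trans (ℚₚ.+-mono-≤ (hM n (ℕₚ.m⊔n≤o⇒m≤o M N n≥))
        (subst (ℚ._≤ ½ ℚ.* ε) (∣p-q∣-comm (convergent b n) (seq x n)) (hN n (ℕₚ.m⊔n≤o⇒n≤o M N n≥))))
      (ℚₚ.≤-reflexive (½+½ ε)))

StrictlyIncreasing : (ℕ → ℕ) → Set
StrictlyIncreasing a = ∀ k → a k ℕ.< a (suc k)

index<digit : ∀ {a} → Positive a → StrictlyIncreasing a → ∀ k → k ℕ.< a k
index<digit a≥1 inc zero = a≥1 0
index<digit a≥1 inc (suc k) = ℕₚ.<-≤-trans (ℕ.s≤s (index<digit a≥1 inc k)) (inc k)

1≤∏² : ∀ {a} → Positive a → ∀ n → 1 ℕ.≤ ∏² a n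
1≤∏² a≥1 zero = ℕₚ.≤-refl
1≤∏² a≥1 (suc n) = ℕₚ.*-mono-≤ (ℕₚ.*-mono-≤ (a≥1 0) (a≥1 0)) (1≤∏² (a≥1 ∘ suc) n)

digit≤∏² : ∀ {a} → Positive a → ∀ k → a k ℕ.≤ ∏² a (suc k)
digit≤∏² {a} a≥1 zero = subst (ℕ._≤ ∏² a 1) (trans (ℕₚ.*-identityʳ _) (ℕₚ.*-identityʳ (a 0)))
  (ℕₚ.*-monoˡ-≤ 1 (ℕₚ.*-monoʳ-≤ (a 0) (a≥1 0)))
digit≤∏² {a} a≥1 (suc k) = ℕₚ.≤-trans (ℕₚ.≤-reflexive (sym (ℕₚ.*-identityˡ (a (suc k)))))
  (ℕₚ.*-mono-≤ (ℕₚ.*-mono-≤ (a≥1 0) (a≥1 0)) (digit≤∏² (a≥1 ∘ suc) k))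

module _ {a} (a≥1 : Positive a) (inc : StrictlyIncreasing a) where
  -- Increasing positive digits satisfy a N > N, so the product of the first N + 1 squares exceeds
  -- N. That is the modulus.
  convergent-cauchy : IsCauchy (convergent a)
  convergent-cauchy ε ε>0 =
    let N , h = archimedean-* 1ℚ ε>0 in suc N , λ m n m≥ n≥ →
      *-cancelʳ-≤ (ι (∏² a (suc N))) (ℚₚ.<-≤-trans 0<1 (1≤ι (1≤∏² a≥1 (suc N))))
        (ℚₚ.≤-trans (common-prefix-close (suc N) a≥1 a≥1 (λ _ _ → refl) m n m≥ n≥)
          (ℚₚ.≤-trans h (ℚₚ.≤-trans (ℚₚ.≤-reflexive (ℚₚ.*-comm (ι N) ε))
            (*-monoˡ-≤ ε (ℚₚ.<⇒≤ ε>0) (ι-mono-≤ (ℕₚ.≤-trans (ℕₚ.<⇒≤ (index<digit a≥1 inc N)) (digit≤∏² a≥1 N)))))))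

  cf : ℝ
  cf = mkℝ (convergent a) convergent-cauchy

  cf-quotients : ArePartialQuotients cf a
  cf-quotients = a≥1 , close⇒⟶ {cf} {convergent a} λ ε ε>0 → 0 , λ n _ →
    subst (ℚ._≤ ε) (sym (cong ℚ.∣_∣ (ℚₚ.+-inverseʳ (convergent a n)))) (ℚₚ.<⇒≤ ε>0)

  cf-irrational : Irrational cf
  cf-irrational r (cf≤r , r≤cf) = ¬Tends-rational r a≥1 λ ε ε>0 →
    let M , hM = cf≤r ε ε>0
        N , hN = r≤cf ε ε>0
    in M ℕ.⊔ N , λ n n≥ → ∣p-q∣≤r (convergent a n) r (hM n (ℕₚ.m⊔n≤o⇒m≤o M N n≥)) (hN n (ℕₚ.m⊔n≤o⇒n≤o M N n≥))

  0<cf : 0ℝ < cf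
  0<cf = inv (ι (suc (a 0))) , 0<inv (0<ι (a 0)) , 1 , late
    where
    late : ∀ n → 1 ℕ.≤ n → 0ℚ ℚ.+ inv (ι (suc (a 0))) ℚ.≤ convergent a n
    late (suc n) _ = subst (ℚ._≤ convergent a (suc n)) (sym (ℚₚ.+-identityˡ _)) (inv≤convergent a≥1 n)

  cf<1 : cf < 1ℝ
  cf<1 = 1ℚ ℚ.- upper-gap a , p<q⇒0<q-p (upper-gap<1 a) , 2 , late
    where
    late : ∀ n → 2 ℕ.≤ n → convergent a n ℚ.+ (1ℚ ℚ.- upper-gap a) ℚ.≤ 1ℚ
    late (suc zero) (ℕ.s≤s ())
    late (suc (suc n)) _ = subst (convergent a (suc (suc n)) ℚ.+ (1ℚ ℚ.- upper-gap a) ℚ.≤_) (p+[q-p]≡q (upper-gap a) 1ℚ)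
      (ℚₚ.+-monoˡ-≤ (1ℚ ℚ.- upper-gap a) (convergent≤upper-gap a≥1 n))

  cf∈J : J cf
  cf∈J = 0<cf , cf<1 , cf-irrational , a , cf-quotients , inc

-- Binary logarithms

-- lg k = ⌊log₂ (k + 1)⌋, and rem k is the number of steps until it next increases.
lgStep : ℕ × ℕ → ℕ × ℕ
lgStep (ℓ , zero)  = suc ℓ , ℕ.pred (2 ℕ.^ suc ℓ)
lgStep (ℓ , suc r) = ℓ , r

lgState : ℕ → ℕ × ℕ
lgState zero    = 0 , 0
lgState (suc k) = lgStep (lgState k)

lg rem : ℕ → ℕ
lg k = proj₁ (lgState k)
rem k = proj₂ (lgState k)

suc-pred-2^ : ∀ n → suc (ℕ.pred (2 ℕ.^ n)) ≡ 2 ℕ.^ n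
suc-pred-2^ n = ℕₚ.suc-pred (2 ℕ.^ n) {{ℕₚ.m^n≢0 2 n}}

lg-rem : ∀ k → suc (suc k ℕ.+ rem k) ≡ 2 ℕ.^ suc (lg k)
lg-rem zero = refl
lg-rem (suc k) = step (lgState k) (lg-rem k)
  where
  step : ∀ s → suc (suc k ℕ.+ proj₂ s) ≡ 2 ℕ.^ suc (proj₁ s) →
    suc (suc (suc k) ℕ.+ proj₂ (lgStep s)) ≡ 2 ℕ.^ suc (proj₁ (lgStep s))
  step (ℓ , zero) h = begin
    suc (suc (suc k) ℕ.+ ℕ.pred (2 ℕ.^ suc ℓ))    ≡⟨ ℕₚ.+-suc (suc (suc k)) _ ⟨
    suc (suc k) ℕ.+ suc (ℕ.pred (2 ℕ.^ suc ℓ))    ≡⟨ cong (suc (suc k) ℕ.+_) (suc-pred-2^ (suc ℓ)) ⟩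
    suc (suc k) ℕ.+ 2 ℕ.^ suc ℓ                   ≡⟨ cong (λ t → suc (suc t) ℕ.+ 2 ℕ.^ suc ℓ) (ℕₚ.+-identityʳ k) ⟨
    suc (suc k ℕ.+ 0) ℕ.+ 2 ℕ.^ suc ℓ             ≡⟨ cong (ℕ._+ 2 ℕ.^ suc ℓ) h ⟩
    2 ℕ.^ suc ℓ ℕ.+ 2 ℕ.^ suc ℓ                   ≡⟨ cong (2 ℕ.^ suc ℓ ℕ.+_) (ℕₚ.+-identityʳ (2 ℕ.^ suc ℓ)) ⟨
    2 ℕ.^ suc (suc ℓ)                             ∎
    where open ≡-Reasoning
  step (ℓ , suc r) h = trans (cong (λ t → suc (suc t)) (sym (ℕₚ.+-suc k r))) h

rem<2^lg : ∀ k → rem k ℕ.< 2 ℕ.^ lg k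
rem<2^lg zero = ℕₚ.≤-refl
rem<2^lg (suc k) = step (lgState k) (rem<2^lg k)
  where
  step : ∀ s → proj₂ s ℕ.< 2 ℕ.^ proj₁ s → proj₂ (lgStep s) ℕ.< 2 ℕ.^ proj₁ (lgStep s)
  step (ℓ , zero) h = ℕₚ.≤-reflexive (suc-pred-2^ (suc ℓ))
  step (ℓ , suc r) h = ℕₚ.<-trans (ℕₚ.n<1+n r) h

1+k<2^1+lg : ∀ k → suc k ℕ.< 2 ℕ.^ suc (lg k)
1+k<2^1+lg k = ℕₚ.≤-trans (ℕ.s≤s (ℕₚ.m≤m+n (suc k) (rem k))) (ℕₚ.≤-reflexive (lg-rem k))

2^lg≤1+k : ∀ k → 2 ℕ.^ lg k ℕ.≤ suc k
2^lg≤1+k k = ℕₚ.+-cancelʳ-≤ (2 ℕ.^ lg k) (2 ℕ.^ lg k) (suc k) (begin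
  2 ℕ.^ lg k ℕ.+ 2 ℕ.^ lg k    ≡⟨ cong (2 ℕ.^ lg k ℕ.+_) (ℕₚ.+-identityʳ (2 ℕ.^ lg k)) ⟨
  2 ℕ.^ suc (lg k)             ≡⟨ lg-rem k ⟨
  suc (suc k ℕ.+ rem k)        ≡⟨ ℕₚ.+-suc (suc k) (rem k) ⟨
  suc k ℕ.+ suc (rem k)        ≤⟨ ℕₚ.+-monoʳ-≤ (suc k) (rem<2^lg k) ⟩
  suc k ℕ.+ 2 ℕ.^ lg k         ∎)
  where open ℕₚ.≤-Reasoning

lg-step : ∀ k → lg k ℕ.≤ lg (suc k) × lg (suc k) ℕ.≤ suc (lg k)
lg-step k = step (lgState k)
  where
  step : ∀ s → proj₁ s ℕ.≤ proj₁ (lgStep s) × proj₁ (lgStep s) ℕ.≤ suc (proj₁ s)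
  step (ℓ , zero)  = ℕₚ.n≤1+n ℓ , ℕₚ.≤-refl
  step (ℓ , suc r) = ℕₚ.≤-refl , ℕₚ.n≤1+n ℓ

lg-mono : ∀ {j k} → j ℕ.≤ k → lg j ℕ.≤ lg k
lg-mono {j} j≤k with ℕₚ.m≤n⇒∃[o]m+o≡n j≤k
... | o , refl = go o
  where
  go : ∀ o → lg j ℕ.≤ lg (j ℕ.+ o)
  go zero = ℕₚ.≤-reflexive (cong lg (sym (ℕₚ.+-identityʳ j)))
  go (suc o) = subst (λ t → lg j ℕ.≤ lg t) (sym (ℕₚ.+-suc j o)) (ℕₚ.≤-trans (go o) (proj₁ (lg-step (j ℕ.+ o))))

≤-lg : ∀ {n k} → 2 ℕ.^ n ℕ.≤ suc k → n ℕ.≤ lg k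
≤-lg {n} {k} h = ℕₚ.≤-pred (ℕₚ.≰⇒> λ lg<n → ℕₚ.<-irrefl refl
  (ℕₚ.<-≤-trans (1+k<2^1+lg k) (ℕₚ.≤-trans (ℕₚ.^-monoʳ-≤ 2 lg<n) h)))

∑ℕ : (ℕ → ℕ) → ℕ → ℕ
∑ℕ t zero    = 0
∑ℕ t (suc n) = ∑ℕ t n ℕ.+ t n

-- The closed form of the sum of integer parts of logarithms, with its negative term moved to the
-- left. The induction follows `lgStep`; `rem` = 0 marks the step at which the logarithm grows.
∑lg : ∀ k → ∑ℕ lg (suc k) ℕ.+ 2 ℕ.^ suc (lg k) ≡ suc (suc k) ℕ.* lg k ℕ.+ 2
∑lg zero = refl
∑lg (suc k) = step (lgState k) (lg-rem k) (∑lg k)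
  where
  S = ∑ℕ lg (suc k)
  step : ∀ s → suc (suc k ℕ.+ proj₂ s) ≡ 2 ℕ.^ suc (proj₁ s) → S ℕ.+ 2 ℕ.^ suc (proj₁ s) ≡ suc (suc k) ℕ.* proj₁ s ℕ.+ 2 →
    (S ℕ.+ proj₁ (lgStep s)) ℕ.+ 2 ℕ.^ suc (proj₁ (lgStep s)) ≡ suc (suc (suc k)) ℕ.* proj₁ (lgStep s) ℕ.+ 2
  step (ℓ , suc r) h₁ h₂ = trans (swap S ℓ (2 ℕ.^ suc ℓ)) (trans (cong (ℓ ℕ.+_) h₂) (sym (ℕₚ.+-assoc ℓ (suc (suc k) ℕ.* ℓ) 2)))
    where
    swap : ∀ a b c → (a ℕ.+ b) ℕ.+ c ≡ b ℕ.+ (a ℕ.+ c)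
    swap = solve-∀
  step (ℓ , zero) h₁ h₂ = trans (regroup S ℓ (2 ℕ.^ suc ℓ)) (trans (cong (λ t → t ℕ.+ suc ℓ ℕ.+ 2 ℕ.^ suc ℓ) h₂)
    (trans (cong ((suc (suc k) ℕ.* ℓ ℕ.+ 2) ℕ.+ suc ℓ ℕ.+_) (sym h₁)) (final k ℓ)))
    where
    regroup : ∀ S ℓ x → (S ℕ.+ suc ℓ) ℕ.+ (x ℕ.+ (x ℕ.+ 0)) ≡ ((S ℕ.+ x) ℕ.+ suc ℓ) ℕ.+ x
    regroup = solve-∀
    final : ∀ k ℓ → (suc (suc k) ℕ.* ℓ ℕ.+ 2) ℕ.+ suc ℓ ℕ.+ suc (suc k ℕ.+ 0) ≡ suc (suc (suc k)) ℕ.* suc ℓ ℕ.+ 2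
    final = solve-∀

lg-sum-lower : ∀ k → suc k ℕ.* lg k ℕ.≤ ∑ℕ lg (suc k) ℕ.+ 2 ℕ.* suc k
lg-sum-lower k = begin
  suc k ℕ.* lg k                             ≤⟨ ℕₚ.*-monoˡ-≤ (lg k) (ℕₚ.n≤1+n (suc k)) ⟩
  suc (suc k) ℕ.* lg k                       ≤⟨ ℕₚ.m≤m+n _ 2 ⟩
  suc (suc k) ℕ.* lg k ℕ.+ 2                 ≡⟨ ∑lg k ⟨
  ∑ℕ lg (suc k) ℕ.+ 2 ℕ.* 2 ℕ.^ lg k         ≤⟨ ℕₚ.+-monoʳ-≤ (∑ℕ lg (suc k)) (ℕₚ.*-monoʳ-≤ 2 (2^lg≤1+k k)) ⟩
  ∑ℕ lg (suc k) ℕ.+ 2 ℕ.* suc k              ∎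
  where open ℕₚ.≤-Reasoning

module _ (ρ Y : ℚ) (ρ≥0 : 0ℚ ℚ.≤ ρ) (Y≥0 : 0ℚ ℚ.≤ Y) (fixed : (ρ ℚ.+ ρ) ℚ.* Y ℚ.+ 1ℚ ≡ Y) where
  private
    θ = ρ ℚ.+ ρ

    θ^ : ∀ n → ι (2 ℕ.^ n) ℚ.* ρ ^ℚ n ≡ θ ^ℚ n
    θ^ n = trans (cong (ℚ._* ρ ^ℚ n) (ι-^ 2 n)) (trans (sym (^-distrib-* (ι 2) ρ n)) (cong (_^ℚ n) two*))
      where
      two* : ι 2 ℚ.* ρ ≡ θ
      two* = trans (cong (ℚ._* ρ) (trans (ι-suc 1) (cong (1ℚ ℚ.+_) ι-1)))
        (trans (ℚₚ.*-distribʳ-+ ρ 1ℚ 1ℚ) (cong₂ ℚ._+_ (ℚₚ.*-identityˡ ρ) (ℚₚ.*-identityˡ ρ)))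

    -- The partial sum, plus the terms still missing on the present dyadic level, plus θ^(ℓ+1) Y for
    -- all later levels. Level ℓ has 2^ℓ terms ρ^ℓ with sum θ^ℓ, and `fixed` says Y = 1 / (1 - θ),
    -- so the potential is constantly Y.
    potential : ℚ → ℕ × ℕ → ℚ
    potential S (ℓ , r) = (S ℚ.+ ι r ℚ.* ρ ^ℚ ℓ) ℚ.+ θ ^ℚ suc ℓ ℚ.* Y

    conserved : ∀ S s → potential (S ℚ.+ ρ ^ℚ proj₁ (lgStep s)) (lgStep s) ≡ potential S s
    conserved S (ℓ , suc r) = trans (regroup S (ι r) (ρ ^ℚ ℓ) (θ ^ℚ suc ℓ ℚ.* Y)) (cong (λ t → (S ℚ.+ t ℚ.* ρ ^ℚ ℓ) ℚ.+ θ ^ℚ suc ℓ ℚ.* Y) (sym (ι-suc r)))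
      where
      open +-*-Solver
      regroup : ∀ S r x c → ((S ℚ.+ x) ℚ.+ r ℚ.* x) ℚ.+ c ≡ (S ℚ.+ (1ℚ ℚ.+ r) ℚ.* x) ℚ.+ c
      regroup = solve 4 (λ S r x c → ((S :+ x) :+ r :* x) :+ c := (S :+ (con 1ℚ :+ r) :* x) :+ c) refl
    conserved S (ℓ , zero) = begin
      ((S ℚ.+ x) ℚ.+ ι r ℚ.* x) ℚ.+ (θ ℚ.* T) ℚ.* Y     ≡⟨ regroup S (ι r) x θ T Y ⟩
      (S ℚ.+ (1ℚ ℚ.+ ι r) ℚ.* x) ℚ.+ T ℚ.* (θ ℚ.* Y)    ≡⟨ cong (λ t → (S ℚ.+ t ℚ.* x) ℚ.+ T ℚ.* (θ ℚ.* Y)) (trans (sym (ι-suc r)) (cong ι (suc-pred-2^ (suc ℓ)))) ⟩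
      (S ℚ.+ ι (2 ℕ.^ suc ℓ) ℚ.* x) ℚ.+ T ℚ.* (θ ℚ.* Y) ≡⟨ cong (λ t → (S ℚ.+ t) ℚ.+ T ℚ.* (θ ℚ.* Y)) (θ^ (suc ℓ)) ⟩
      (S ℚ.+ T) ℚ.+ T ℚ.* (θ ℚ.* Y)                     ≡⟨ collect S T (θ ℚ.* Y) (ρ ^ℚ ℓ) ⟩
      (S ℚ.+ 0ℚ ℚ.* ρ ^ℚ ℓ) ℚ.+ T ℚ.* (θ ℚ.* Y ℚ.+ 1ℚ)  ≡⟨ cong₂ (λ z y → (S ℚ.+ z ℚ.* ρ ^ℚ ℓ) ℚ.+ T ℚ.* y) (sym ι-0) fixed ⟩
      (S ℚ.+ ι 0 ℚ.* ρ ^ℚ ℓ) ℚ.+ T ℚ.* Y                ∎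
      where
      open ≡-Reasoning
      r = ℕ.pred (2 ℕ.^ suc ℓ)
      x = ρ ^ℚ suc ℓ
      T = θ ^ℚ suc ℓ
      regroup : ∀ S r x θ T Y → ((S ℚ.+ x) ℚ.+ r ℚ.* x) ℚ.+ (θ ℚ.* T) ℚ.* Y ≡ (S ℚ.+ (1ℚ ℚ.+ r) ℚ.* x) ℚ.+ T ℚ.* (θ ℚ.* Y)
      regroup = solve 6 (λ S r x θ T Y → ((S :+ x) :+ r :* x) :+ (θ :* T) :* Y := (S :+ (con 1ℚ :+ r) :* x) :+ T :* (θ :* Y)) refl
        where open +-*-Solver
      collect : ∀ S T z y → (S ℚ.+ T) ℚ.+ T ℚ.* z ≡ (S ℚ.+ 0ℚ ℚ.* y) ℚ.+ T ℚ.* (z ℚ.+ 1ℚ)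
      collect = solve 4 (λ S T z y → (S :+ T) :+ T :* z := (S :+ con 0ℚ :* y) :+ T :* (z :+ con 1ℚ)) refl
        where open +-*-Solver

    total : ∀ k → potential (∑ℚ (λ i → ρ ^ℚ lg i) (suc k)) (lgState k) ≡ Y
    total zero = trans (cong (λ t → ((0ℚ ℚ.+ 1ℚ) ℚ.+ t ℚ.* 1ℚ) ℚ.+ (θ ℚ.* 1ℚ) ℚ.* Y) ι-0)
      (trans (solve 2 (λ θ Y → ((con 0ℚ :+ con 1ℚ) :+ con 0ℚ :* con 1ℚ) :+ (θ :* con 1ℚ) :* Y := θ :* Y :+ con 1ℚ) refl θ Y) fixed)
      where open +-*-Solver
    total (suc k) = trans (conserved (∑ℚ (λ i → ρ ^ℚ lg i) (suc k)) (lgState k)) (total k)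

  ∑ρ^lg≤ : ∀ n → ∑ℚ (λ i → ρ ^ℚ lg i) n ℚ.≤ Y
  ∑ρ^lg≤ zero = Y≥0
  ∑ρ^lg≤ (suc k) = subst (∑ℚ (λ i → ρ ^ℚ lg i) (suc k) ℚ.≤_) (total k)
    (ℚₚ.≤-trans (p≤p+q _ (0≤-* (0≤ι (rem k)) (0≤^ ρ≥0 (lg k))))
      (p≤p+q _ (0≤-* (0≤^ (0≤-+ ρ≥0 ρ≥0) (suc (lg k))) Y≥0)))

-- ρ = (1 - 1 / 2r) / 2 with r = k + 1; Bernoulli's inequality gives (2ρ)^r ≥ 1/2.
module _ (k : ℕ) where
  private
    r = suc k
    η = inv (ι (2 ℕ.* r))
    M>0 : 0ℚ ℚ.< ι (2 ℕ.* r)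
    M>0 = 0<ι _
    θ = 1ℚ ℚ.+ ℚ.- η

    rη≤½ : ι r ℚ.* η ℚ.≤ ½
    rη≤½ = ℚₚ.≤-reflexive (trans (halves (ι r) η) (trans (cong (½ ℚ.*_) (trans (cong (ℚ._* η) (sym 2r)) (*inv M>0))) refl))
      where
      open +-*-Solver
      halves : ∀ a b → a ℚ.* b ≡ ½ ℚ.* (((1ℚ ℚ.+ 1ℚ) ℚ.* a) ℚ.* b)
      halves = solve 2 (λ a b → a :* b := con ½ :* (((con 1ℚ :+ con 1ℚ) :* a) :* b)) refl
      2r : ι (2 ℕ.* r) ≡ (1ℚ ℚ.+ 1ℚ) ℚ.* ι r
      2r = trans (ι-* 2 r) (cong (ℚ._* ι r) (trans (ι-suc 1) (cong (1ℚ ℚ.+_) ι-1)))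

    θ≥0 : 0ℚ ℚ.≤ θ
    θ≥0 = p≤q⇒0≤q-p (inv≤1 (1≤ι (ℕ.s≤s ℕ.z≤n)))

  ratio ratio-sum : ℚ
  ratio = ½ ℚ.* θ
  -- This is 1 / (1 - θ) = 1 / η.
  ratio-sum = ι (2 ℕ.* r)

  ratio≥0 : 0ℚ ℚ.≤ ratio
  ratio≥0 = 0≤-* 0≤½ θ≥0

  ratio-fixed : (ratio ℚ.+ ratio) ℚ.* ratio-sum ℚ.+ 1ℚ ≡ ratio-sum
  ratio-fixed = trans (cong (λ t → t ℚ.* ratio-sum ℚ.+ 1ℚ) (½+½ θ))
    (trans (expand η ratio-sum) (trans (cong (λ t → (ratio-sum ℚ.- t) ℚ.+ 1ℚ) (*inv M>0)) (cancel ratio-sum)))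
    where
    open +-*-Solver
    expand : ∀ e m → (1ℚ ℚ.+ ℚ.- e) ℚ.* m ℚ.+ 1ℚ ≡ (m ℚ.- m ℚ.* e) ℚ.+ 1ℚ
    expand = solve 2 (λ e m → (con 1ℚ :+ :- e) :* m :+ con 1ℚ := (m :- m :* e) :+ con 1ℚ) refl
    cancel : ∀ m → (m ℚ.- 1ℚ) ℚ.+ 1ℚ ≡ m
    cancel = solve 1 (λ m → (m :- con 1ℚ) :+ con 1ℚ := m) refl

  ½^≤ratio^ : ½ ^ℚ suc r ℚ.≤ ratio ^ℚ r
  ½^≤ratio^ = subst₂ ℚ._≤_ (ℚₚ.*-comm (½ ^ℚ r) ½) (sym (^-distrib-* ½ θ r))
    (*-monoˡ-≤ (½ ^ℚ r) (0≤^ 0≤½ r) (ℚₚ.≤-trans ½≤ (bernoulli θ≥0 r)))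
    where
    ½≤ : ½ ℚ.≤ 1ℚ ℚ.+ ι r ℚ.* ℚ.- η
    ½≤ = ≤-from-gap (p≤q⇒0≤q-p rη≤½) (solve 2 (λ a b → (con 1ℚ :+ a :* (:- b)) :- con ½ := con ½ :- a :* b) refl (ι r) η)
      where open +-*-Solver

-- Sums over finite subsets of ℕ

∑ℚ-+ : ∀ t m n → ∑ℚ t (m ℕ.+ n) ≡ ∑ℚ t m ℚ.+ ∑ℚ (λ i → t (m ℕ.+ i)) n
∑ℚ-+ t m zero = trans (cong (∑ℚ t) (ℕₚ.+-identityʳ m)) (sym (ℚₚ.+-identityʳ (∑ℚ t m)))
∑ℚ-+ t m (suc n) = trans (cong (∑ℚ t) (ℕₚ.+-suc m n)) (trans (cong (ℚ._+ t (m ℕ.+ n)) (∑ℚ-+ t m n))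
  (ℚₚ.+-assoc (∑ℚ t m) (∑ℚ (λ i → t (m ℕ.+ i)) n) (t (m ℕ.+ n))))

∑ℚ-cong : ∀ {s t} n → (∀ i → i ℕ.< n → s i ≡ t i) → ∑ℚ s n ≡ ∑ℚ t n
∑ℚ-cong zero h = refl
∑ℚ-cong (suc n) h = cong₂ ℚ._+_ (∑ℚ-cong n λ i i<n → h i (ℕₚ.m<n⇒m<1+n i<n)) (h n ℕₚ.≤-refl)

∑ℚ-*ˡ : ∀ c t n → ∑ℚ (λ i → c ℚ.* t i) n ≡ c ℚ.* ∑ℚ t n
∑ℚ-*ˡ c t zero = sym (ℚₚ.*-zeroʳ c)
∑ℚ-*ˡ c t (suc n) = trans (cong (ℚ._+ c ℚ.* t n) (∑ℚ-*ˡ c t n)) (sym (ℚₚ.*-distribˡ-+ c (∑ℚ t n) (t n)))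

0≤∑ℚ : ∀ {t} → (∀ i → 0ℚ ℚ.≤ t i) → ∀ n → 0ℚ ℚ.≤ ∑ℚ t n
0≤∑ℚ t≥0 zero = ℚₚ.≤-refl
0≤∑ℚ t≥0 (suc n) = 0≤-+ (0≤∑ℚ t≥0 n) (t≥0 n)

∑ℚ-mono-length : ∀ {t} → (∀ i → 0ℚ ℚ.≤ t i) → ∀ {m n} → m ℕ.≤ n → ∑ℚ t m ℚ.≤ ∑ℚ t n
∑ℚ-mono-length {t} t≥0 {m} m≤n with ℕₚ.m≤n⇒∃[o]m+o≡n m≤n
... | o , refl = subst (∑ℚ t m ℚ.≤_) (sym (∑ℚ-+ t m o)) (p≤p+q (∑ℚ t m) (0≤∑ℚ (λ i → t≥0 (m ℕ.+ i)) o))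

∏1+ : (ℕ → ℚ) → ℕ → ℚ
∏1+ t zero    = 1ℚ
∏1+ t (suc n) = (1ℚ ℚ.+ t n) ℚ.* ∏1+ t n

∏1+-nonNeg : ∀ {t} → (∀ i → 0ℚ ℚ.≤ t i) → ∀ n → 0ℚ ℚ.≤ ∏1+ t n
∏1+-nonNeg t≥0 zero = 0≤1
∏1+-nonNeg t≥0 (suc n) = 0≤-* (0≤-+ 0≤1 (t≥0 n)) (∏1+-nonNeg t≥0 n)

-- For S the sum so far, the induction step has slack t n (1 - 2 S), which is nonnegative exactly as
-- long as S ≤ 1/2 unless t n vanishes.
∏1+≤1+2∑ : ∀ {t} → (∀ i → 0ℚ ℚ.≤ t i) → ∀ n → ∑ℚ t n ℚ.≤ ½ → ∏1+ t n ℚ.≤ 1ℚ ℚ.+ (∑ℚ t n ℚ.+ ∑ℚ t n)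
∏1+≤1+2∑ t≥0 zero _ = ℚₚ.≤-refl
∏1+≤1+2∑ {t} t≥0 (suc n) h = ℚₚ.≤-trans
  (*-monoˡ-≤ (1ℚ ℚ.+ t n) (0≤-+ 0≤1 (t≥0 n)) (∏1+≤1+2∑ t≥0 n S≤½))
  (≤-from-gap (0≤-* (t≥0 n) (p≤q⇒0≤q-p S+S≤1)) (expand (∑ℚ t n) (t n)))
  where
  S≤½ : ∑ℚ t n ℚ.≤ ½
  S≤½ = ℚₚ.≤-trans (p≤p+q (∑ℚ t n) (t≥0 n)) h
  S+S≤1 : ∑ℚ t n ℚ.+ ∑ℚ t n ℚ.≤ 1ℚ
  S+S≤1 = ℚₚ.+-mono-≤ S≤½ S≤½
  expand : ∀ S x → (1ℚ ℚ.+ ((S ℚ.+ x) ℚ.+ (S ℚ.+ x))) ℚ.- (1ℚ ℚ.+ x) ℚ.* (1ℚ ℚ.+ (S ℚ.+ S)) ≡ x ℚ.* (1ℚ ℚ.- (S ℚ.+ S))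
  expand = solve 2 (λ S x → (con 1ℚ :+ ((S :+ x) :+ (S :+ x))) :- (con 1ℚ :+ x) :* (con 1ℚ :+ (S :+ S)) := x :* (con 1ℚ :- (S :+ S))) refl
    where open +-*-Solver

2ℚ : ℚ
2ℚ = 1ℚ ℚ.+ 1ℚ

-- By Bernoulli 1 + t ≤ (1 + t / M)^M, which reduces to sums at most 1/2.
∏1+≤2^M : ∀ {t} M → (∀ i → 0ℚ ℚ.≤ t i) → ∀ n → ∑ℚ t n ℚ.≤ ½ ℚ.* ι (suc M) → ∏1+ t n ℚ.≤ 2ℚ ^ℚ suc M
∏1+≤2^M {t} M t≥0 n h = ℚₚ.≤-trans (split n)
  (^-mono-≤ (∏1+-nonNeg y≥0 n) (ℚₚ.≤-trans (∏1+≤1+2∑ y≥0 n ∑y≤½) (ℚₚ.+-monoʳ-≤ 1ℚ (ℚₚ.+-mono-≤ ∑y≤½ ∑y≤½))) (suc M))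
  where
  m = ι (suc M)
  m>0 = 0<ι M
  y : ℕ → ℚ
  y i = inv m ℚ.* t i
  y≥0 : ∀ i → 0ℚ ℚ.≤ y i
  y≥0 i = 0≤-* (0≤inv m>0) (t≥0 i)
  ∑y≤½ : ∑ℚ y n ℚ.≤ ½
  ∑y≤½ = *-cancelʳ-≤ m m>0 (subst (ℚ._≤ ½ ℚ.* m) (sym (trans (cong (ℚ._* m) (trans (∑ℚ-*ˡ (inv m) t n) (ℚₚ.*-comm (inv m) (∑ℚ t n))))
    (*-inv-cancel (∑ℚ t n) m>0))) h)
  one : ∀ i → 1ℚ ℚ.+ t i ℚ.≤ (1ℚ ℚ.+ y i) ^ℚ suc M
  one i = subst (λ s → 1ℚ ℚ.+ s ℚ.≤ (1ℚ ℚ.+ y i) ^ℚ suc M)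
    (trans (sym (ℚₚ.*-assoc m (inv m) (t i))) (trans (cong (ℚ._* t i) (*inv m>0)) (ℚₚ.*-identityˡ (t i))))
    (bernoulli (0≤-+ 0≤1 (y≥0 i)) (suc M))
  split : ∀ n → ∏1+ t n ℚ.≤ ∏1+ y n ^ℚ suc M
  split zero = ℚₚ.≤-reflexive (sym (1^ (suc M)))
  split (suc n) = subst ((1ℚ ℚ.+ t n) ℚ.* ∏1+ t n ℚ.≤_) (sym (^-distrib-* (1ℚ ℚ.+ y n) (∏1+ y n) (suc M)))
    (*-mono-≤ (0≤-+ 0≤1 (t≥0 n)) (∏1+-nonNeg t≥0 n) (one n) (split n))

-- subset K i is the i-th subset of {1, …, K}, as a decreasing list, with membership read off the binary digits of i.
subset : ℕ → ℕ → List ℕ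
pick : ∀ K i → Dec (i ℕ.< 2 ℕ.^ K) → List ℕ

subset zero    i = []
subset (suc K) i = pick K i (i ℕₚ.<? 2 ℕ.^ K)

pick K i (yes _) = subset K i
pick K i (no _)  = suc K ∷ subset K (i ℕ.∸ 2 ℕ.^ K)

subset-low : ∀ K {i} → i ℕ.< 2 ℕ.^ K → subset (suc K) i ≡ subset K i
subset-low K {i} i< with i ℕₚ.<? 2 ℕ.^ K
... | yes _ = refl
... | no i≮ = ⊥-elim (i≮ i<)

subset-high : ∀ K i → subset (suc K) (2 ℕ.^ K ℕ.+ i) ≡ suc K ∷ subset K i
subset-high K i with (2 ℕ.^ K ℕ.+ i) ℕₚ.<? 2 ℕ.^ K
... | yes h = ⊥-elim (ℕₚ.<⇒≱ h (ℕₚ.m≤m+n (2 ℕ.^ K) i))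
... | no _ = cong (λ j → suc K ∷ subset K j) (ℕₚ.m+n∸m≡n (2 ℕ.^ K) i)

subset-stable : ∀ k K {i} → i ℕ.< 2 ℕ.^ K → subset (k ℕ.+ K) i ≡ subset K i
subset-stable zero K i< = refl
subset-stable (suc k) K i< = trans (subset-low (k ℕ.+ K) (ℕₚ.<-≤-trans i< (ℕₚ.^-monoʳ-≤ 2 (ℕₚ.m≤n+m K k)))) (subset-stable k K i<)

n<2^n : ∀ n → n ℕ.< 2 ℕ.^ n
n<2^n zero = ℕₚ.≤-refl
n<2^n (suc n) = ℕₚ.+-mono-≤ (ℕₚ.m^n>0 2 n) (subst (n ℕ.<_) (sym (ℕₚ.+-identityʳ (2 ℕ.^ n))) (n<2^n n))

-- As i < 2^i, the bound i on the elements is never felt: every larger bound gives the same set.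
-- This enumerates all finite subsets of {1, 2, ...} by binary expansions.
finiteSet : ℕ → List ℕ
finiteSet i = subset i i

subset≡finiteSet : ∀ K {i} → i ℕ.< 2 ℕ.^ K → subset K i ≡ finiteSet i
subset≡finiteSet K {i} i< = trans (sym (subset-stable i K i<))
  (trans (cong (λ n → subset n i) (ℕₚ.+-comm i K)) (subset-stable K i (n<2^n i)))

∏wt : (ℕ → ℚ) → List ℕ → ℚ
∏wt τ []      = 1ℚ
∏wt τ (d ∷ S) = τ d ℚ.* ∏wt τ S

-- Multiplying out the product: the lower half of the indices omits the element K + 1, the upper
-- half contains it.
∑-subset : ∀ τ K → ∑ℚ (λ i → ∏wt τ (subset K i)) (2 ℕ.^ K) ≡ ∏1+ (τ ∘ suc) K
∑-subset τ zero = ℚₚ.+-identityˡ 1ℚ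
∑-subset τ (suc K) = begin
  ∑ℚ f (N ℕ.+ (N ℕ.+ 0))                      ≡⟨ cong (λ n → ∑ℚ f (N ℕ.+ n)) (ℕₚ.+-identityʳ N) ⟩
  ∑ℚ f (N ℕ.+ N)                              ≡⟨ ∑ℚ-+ f N N ⟩
  ∑ℚ f N ℚ.+ ∑ℚ (λ i → f (N ℕ.+ i)) N         ≡⟨ cong₂ ℚ._+_ (∑ℚ-cong N λ i i<N → cong (∏wt τ) (subset-low K i<N)) (∑ℚ-cong N λ i _ → cong (∏wt τ) (subset-high K i)) ⟩
  ∑ℚ g N ℚ.+ ∑ℚ (λ i → τ (suc K) ℚ.* g i) N   ≡⟨ cong (∑ℚ g N ℚ.+_) (∑ℚ-*ˡ (τ (suc K)) g N) ⟩
  ∑ℚ g N ℚ.+ τ (suc K) ℚ.* ∑ℚ g N             ≡⟨ cong₂ (λ a b → a ℚ.+ τ (suc K) ℚ.* b) (∑-subset τ K) (∑-subset τ K) ⟩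
  P ℚ.+ τ (suc K) ℚ.* P                       ≡⟨ cong (ℚ._+ τ (suc K) ℚ.* P) (ℚₚ.*-identityˡ P) ⟨
  1ℚ ℚ.* P ℚ.+ τ (suc K) ℚ.* P                ≡⟨ ℚₚ.*-distribʳ-+ P 1ℚ (τ (suc K)) ⟨
  (1ℚ ℚ.+ τ (suc K)) ℚ.* P                    ∎
  where
  open ≡-Reasoning
  N = 2 ℕ.^ K
  f g : ℕ → ℚ
  f i = ∏wt τ (subset (suc K) i)
  g i = ∏wt τ (subset K i)
  P = ∏1+ (τ ∘ suc) K

∏wt-nonNeg : ∀ {τ} → (∀ d → 0ℚ ℚ.≤ τ d) → ∀ S → 0ℚ ℚ.≤ ∏wt τ S
∏wt-nonNeg τ≥0 [] = 0≤1
∏wt-nonNeg τ≥0 (d ∷ S) = 0≤-* (τ≥0 d) (∏wt-nonNeg τ≥0 S)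

-- The first n finite sets are among the 2^n subsets of {1, ..., n}.
∑-finiteSet≤ : ∀ {τ C} → (∀ d → 0ℚ ℚ.≤ τ d) → (∀ K → ∏1+ (τ ∘ suc) K ℚ.≤ C) → ∀ n → ∑ℚ (λ i → ∏wt τ (finiteSet i)) n ℚ.≤ C
∑-finiteSet≤ {τ} τ≥0 bound n = ℚₚ.≤-trans (∑ℚ-mono-length (λ i → ∏wt-nonNeg τ≥0 (finiteSet i)) (ℕₚ.<⇒≤ (n<2^n n)))
  (ℚₚ.≤-trans (ℚₚ.≤-reflexive (trans (∑ℚ-cong (2 ℕ.^ n) λ i i< → cong (∏wt τ) (sym (subset≡finiteSet n i<))) (∑-subset τ n))) (bound n))

-- The latest digit comes first. For increasing digits the list is then decreasing, as the lists of
-- `subset` are, so the set alone recovers the digits with their positions.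
prefix : (ℕ → ℕ) → ℕ → List ℕ
prefix a zero    = []
prefix a (suc m) = a m ∷ prefix a m

length-prefix : ∀ a m → List.length (prefix a m) ≡ m
length-prefix a zero = refl
length-prefix a (suc m) = cong suc (length-prefix a m)

prefix-injective : ∀ {a b} m → prefix a m ≡ prefix b m → ∀ j → j ℕ.< m → a j ≡ b j
prefix-injective {a} {b} (suc m) eq j j< with ℕₚ.m≤n⇒m<n∨m≡n (ℕₚ.≤-pred j<)
... | inj₁ j<m = prefix-injective m (∷-injectiveʳ eq) j j<m
... | inj₂ refl = ∷-injectiveˡ eq

increasing-mono : ∀ {a} → StrictlyIncreasing a → ∀ j k → j ℕ.≤ k → a j ℕ.≤ a k
increasing-mono inc j zero ℕ.z≤n = ℕₚ.≤-refl
increasing-mono inc j (suc k) j≤ with ℕₚ.m≤n⇒m<n∨m≡n j≤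
... | inj₁ j<1+k = ℕₚ.≤-trans (increasing-mono inc j k (ℕₚ.≤-pred j<1+k)) (ℕₚ.<⇒≤ (inc k))
... | inj₂ refl = ℕₚ.≤-refl

prefix∈subset : ∀ {a} → Positive a → StrictlyIncreasing a → ∀ K m → (∀ j → j ℕ.< m → a j ℕ.≤ K) →
  ∃ λ i → i ℕ.< 2 ℕ.^ K × subset K i ≡ prefix a m
prefix∈subset a≥1 inc zero zero h = 0 , ℕ.s≤s ℕ.z≤n , refl
prefix∈subset a≥1 inc zero (suc m) h = ⊥-elim (ℕₚ.<⇒≱ (a≥1 m) (h m ℕₚ.≤-refl))
prefix∈subset a≥1 inc (suc K) zero h =
  let i , i< , eq = prefix∈subset a≥1 inc K zero (λ j ()) in
  i , ℕₚ.<-≤-trans i< (ℕₚ.^-monoʳ-≤ 2 (ℕₚ.n≤1+n K)) , trans (subset-low K i<) eq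
prefix∈subset {a} a≥1 inc (suc K) (suc m) h with ℕₚ.m≤n⇒m<n∨m≡n (h m ℕₚ.≤-refl)
... | inj₁ am<1+K =
  let i , i< , eq = prefix∈subset a≥1 inc K (suc m) (λ j j≤m → ℕₚ.≤-trans (increasing-mono inc j m (ℕₚ.≤-pred j≤m)) (ℕₚ.≤-pred am<1+K)) in
  i , ℕₚ.<-≤-trans i< (ℕₚ.^-monoʳ-≤ 2 (ℕₚ.n≤1+n K)) , trans (subset-low K i<) eq
... | inj₂ am≡1+K =
  let i , i< , eq = prefix∈subset a≥1 inc K m (below m am≡1+K) in
  2 ℕ.^ K ℕ.+ i , ℕₚ.<-≤-trans (ℕₚ.+-monoʳ-< (2 ℕ.^ K) i<) (ℕₚ.≤-reflexive (cong (2 ℕ.^ K ℕ.+_) (sym (ℕₚ.+-identityʳ (2 ℕ.^ K))))) ,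
  trans (subset-high K i) (cong₂ _∷_ (sym am≡1+K) eq)
  where
  below : ∀ m → a m ≡ suc K → ∀ j → j ℕ.< m → a j ℕ.≤ K
  below (suc m) eq j j≤m = ℕₚ.≤-pred (ℕₚ.<-≤-trans (ℕ.s≤s (increasing-mono inc j m (ℕₚ.≤-pred j≤m))) (subst (suc (a m) ℕ.≤_) eq (inc m)))

-- Digit weights

∏ℕ : (ℕ → ℕ) → ℕ → ℕ
∏ℕ a zero    = 1
∏ℕ a (suc n) = a n ℕ.* ∏ℕ a n

∏²-snoc : ∀ a n → ∏² a (suc n) ≡ ∏² a n ℕ.* (a n ℕ.* a n)
∏²-snoc a zero = trans (ℕₚ.*-identityʳ (a 0 ℕ.* a 0)) (sym (ℕₚ.*-identityˡ (a 0 ℕ.* a 0)))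
∏²-snoc a (suc n) = trans (cong (a 0 ℕ.* a 0 ℕ.*_) (∏²-snoc (a ∘ suc) n))
  (sym (ℕₚ.*-assoc (a 0 ℕ.* a 0) (∏² (a ∘ suc) n) (a (suc n) ℕ.* a (suc n))))

∏²≡ : ∀ a n → ∏² a n ≡ ∏ℕ a n ℕ.* ∏ℕ a n
∏²≡ a zero = refl
∏²≡ a (suc n) = trans (∏²-snoc a n) (trans (cong (ℕ._* (a n ℕ.* a n)) (∏²≡ a n)) (regroup (∏ℕ a n) (a n)))
  where
  regroup : ∀ p x → (p ℕ.* p) ℕ.* (x ℕ.* x) ≡ (x ℕ.* p) ℕ.* (x ℕ.* p)
  regroup = solve-∀

1≤∏ℕ : ∀ {a} → Positive a → ∀ n → 1 ℕ.≤ ∏ℕ a n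
1≤∏ℕ a≥1 zero = ℕₚ.≤-refl
1≤∏ℕ a≥1 (suc n) = ℕₚ.*-mono-≤ (a≥1 n) (1≤∏ℕ a≥1 n)

∏ℕ-upper : ∀ {a A} m → (∀ j → j ℕ.< m → a j ℕ.≤ A) → ∏ℕ a m ℕ.≤ A ℕ.^ m
∏ℕ-upper zero h = ℕₚ.≤-refl
∏ℕ-upper (suc m) h = ℕₚ.*-mono-≤ (h m ℕₚ.≤-refl) (∏ℕ-upper m λ j j<m → h j (ℕₚ.m<n⇒m<1+n j<m))

∏ℕ-extend : ∀ {a A} m l → (∀ j → m ℕ.≤ j → A ℕ.≤ a j) → ∏ℕ a m ℕ.* A ℕ.^ l ℕ.≤ ∏ℕ a (m ℕ.+ l)
∏ℕ-extend {a} m zero h = ℕₚ.≤-reflexive (trans (ℕₚ.*-identityʳ (∏ℕ a m)) (cong (∏ℕ a) (sym (ℕₚ.+-identityʳ m))))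
∏ℕ-extend {a} {A} m (suc l) h = subst (∏ℕ a m ℕ.* (A ℕ.* A ℕ.^ l) ℕ.≤_) (cong (∏ℕ a) (sym (ℕₚ.+-suc m l)))
  (ℕₚ.≤-trans (ℕₚ.≤-reflexive (swap (∏ℕ a m) A (A ℕ.^ l)))
    (ℕₚ.*-mono-≤ (h (m ℕ.+ l) (ℕₚ.m≤m+n m l)) (∏ℕ-extend m l h)))
  where
  swap : ∀ p x y → p ℕ.* (x ℕ.* y) ≡ x ℕ.* (p ℕ.* y)
  swap = solve-∀

^-distribʳ-* : ∀ m n o → (m ℕ.* n) ℕ.^ o ≡ m ℕ.^ o ℕ.* n ℕ.^ o
^-distribʳ-* m n zero = refl
^-distribʳ-* m n (suc o) = trans (cong (m ℕ.* n ℕ.*_) (^-distribʳ-* m n o)) (regroup m n (m ℕ.^ o) (n ℕ.^ o))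
  where
  regroup : ∀ m n x y → (m ℕ.* n) ℕ.* (x ℕ.* y) ≡ (m ℕ.* x) ℕ.* (n ℕ.* y)
  regroup = solve-∀

-- The first m + 1 digits are at most A = a m, so their product P is at most A^(m+1); the next l
-- digits are at least A and contribute A^l ≥ P^(l/(m+1)) ≥ P^(g/e). Everything is raised to the
-- power e.
∏ℕ-gain : ∀ {a} → Positive a → StrictlyIncreasing a → ∀ e g m l → g ℕ.* suc m ℕ.≤ e ℕ.* l →
  ∏ℕ a (suc m) ℕ.^ (e ℕ.+ g) ℕ.≤ ∏ℕ a (suc m ℕ.+ l) ℕ.^ e
∏ℕ-gain {a} a≥1 inc e g m l h = begin
  P ℕ.^ (e ℕ.+ g)              ≡⟨ ℕₚ.^-distribˡ-+-* P e g ⟩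
  P ℕ.^ e ℕ.* P ℕ.^ g          ≤⟨ ℕₚ.*-monoʳ-≤ (P ℕ.^ e) P^g≤ ⟩
  P ℕ.^ e ℕ.* (A ℕ.^ l) ℕ.^ e  ≡⟨ ^-distribʳ-* P (A ℕ.^ l) e ⟨
  (P ℕ.* A ℕ.^ l) ℕ.^ e        ≤⟨ ℕₚ.^-monoˡ-≤ e (∏ℕ-extend (suc m) l λ j m≤j → increasing-mono inc m j (ℕₚ.<⇒≤ m≤j)) ⟩
  ∏ℕ a (suc m ℕ.+ l) ℕ.^ e     ∎
  where
  open ℕₚ.≤-Reasoning
  P = ∏ℕ a (suc m)
  A = a m
  P^g≤ : P ℕ.^ g ℕ.≤ (A ℕ.^ l) ℕ.^ e
  P^g≤ = begin
    P ℕ.^ g                 ≤⟨ ℕₚ.^-monoˡ-≤ g (∏ℕ-upper (suc m) λ j j≤m → increasing-mono inc j m (ℕₚ.≤-pred j≤m)) ⟩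
    (A ℕ.^ suc m) ℕ.^ g     ≡⟨ ℕₚ.^-*-assoc A (suc m) g ⟩
    A ℕ.^ (suc m ℕ.* g)     ≤⟨ ℕₚ.^-monoʳ-≤ A {{ℕ.>-nonZero (a≥1 m)}} (subst₂ ℕ._≤_ (ℕₚ.*-comm g (suc m)) (ℕₚ.*-comm e l) h) ⟩
    A ℕ.^ (l ℕ.* e)         ≡⟨ ℕₚ.^-*-assoc A l e ⟨
    (A ℕ.^ l) ℕ.^ e         ∎

^-swap : ∀ x m n → (x ^ℚ m) ^ℚ n ≡ (x ^ℚ n) ^ℚ m
^-swap x m n = trans (^-assocʳ x m n) (trans (cong (x ^ℚ_) (ℕₚ.*-comm m n)) (sym (^-assocʳ x n m)))

inv-ι-^ : ∀ {m} → 1 ℕ.≤ m → ∀ n → inv (ι (m ℕ.^ n)) ≡ inv (ι m) ^ℚ n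
inv-ι-^ {m} m≥1 n = trans (cong inv (ι-^ m n)) (inv-^ (ℚₚ.<-≤-trans 0<1 (1≤ι m≥1)) n)

inv-ι-anti : ∀ {m n} → 1 ℕ.≤ m → m ℕ.≤ n → inv (ι n) ℚ.≤ inv (ι m)
inv-ι-anti m≥1 m≤n = inv-anti-≤ (ℚₚ.<-≤-trans 0<1 (1≤ι m≥1)) (ι-mono-≤ m≤n)

inv-ι-2^ : ∀ n → inv (ι (2 ℕ.^ n)) ≡ ½ ^ℚ n
inv-ι-2^ n = trans (inv-ι-^ (ℕ.s≤s ℕ.z≤n) n) (cong (_^ℚ n) (sym (inv-unique (0<ι 1) (trans (cong (ℚ._* ½) (trans (ι-suc 1) (cong (1ℚ ℚ.+_) ι-1))) refl))))

-- The weight of a digit d is at least d^{-(r+1)/r} with r = k + 1, and the weights are summable.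
module DigitWeight (k : ℕ) where
  r : ℕ
  r = suc k

  -- The exponent is the integer part of log₂ d, since `lg` is shifted by one. Doubling does not
  -- affect summability and gives a set of n elements an extra factor 2^n, the source of smallness
  -- for large sets.
  wt 2wt : ℕ → ℚ
  wt d = ratio k ^ℚ lg (ℕ.pred d)
  2wt d = 2ℚ ℚ.* wt d

  wt≥0 : ∀ d → 0ℚ ℚ.≤ wt d
  wt≥0 d = 0≤^ (ratio≥0 k) (lg (ℕ.pred d))

  2wt≥0 : ∀ d → 0ℚ ℚ.≤ 2wt d
  2wt≥0 d = 0≤-* (0≤-+ 0≤1 0≤1) (wt≥0 d)

  -- With ℓ the integer part of log₂ d: d ≥ 2^ℓ, and (1/2)^(r+1) ≤ `ratio`^r, raised to the power ℓ.
  wt-lower : ∀ {d} → 1 ℕ.≤ d → inv (ι d) ^ℚ suc r ℚ.≤ wt d ^ℚ r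
  wt-lower {suc d} _ = subst₂ (λ x y → x ℚ.≤ y) refl (^-swap (ratio k) r (lg d)) (ℚₚ.≤-trans
    (^-mono-≤ (0≤inv (0<ι d)) (ℚₚ.≤-trans (inv-ι-anti (ℕₚ.m^n>0 2 (lg d)) (2^lg≤1+k d)) (ℚₚ.≤-reflexive (inv-ι-2^ (lg d)))) (suc r))
    (subst (ℚ._≤ (ratio k ^ℚ r) ^ℚ lg d) (^-swap ½ (suc r) (lg d)) (^-mono-≤ (0≤^ 0≤½ (suc r)) (½^≤ratio^ k) (lg d))))

  ∏wt-lower : ∀ {a} → Positive a → ∀ m → inv (ι (∏ℕ a m)) ^ℚ suc r ℚ.≤ ∏wt wt (prefix a m) ^ℚ r
  ∏wt-lower a≥1 zero = ℚₚ.≤-reflexive (trans (cong (_^ℚ suc r) (trans (cong inv ι-1) (sym (inv-unique 0<1 refl)))) (trans (1^ (suc r)) (sym (1^ r))))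
  ∏wt-lower {a} a≥1 (suc m) = subst₂ ℚ._≤_
    (sym (trans (cong (_^ℚ suc r) (trans (cong inv (ι-* (a m) (∏ℕ a m))) (inv-* {ι (a m)} {ι (∏ℕ a m)} (ℚₚ.<-≤-trans 0<1 (1≤ι (a≥1 m))) (ℚₚ.<-≤-trans 0<1 (1≤ι (1≤∏ℕ a≥1 m))))))
      (^-distrib-* (inv (ι (a m))) (inv (ι (∏ℕ a m))) (suc r))))
    (sym (^-distrib-* (wt (a m)) (∏wt wt (prefix a m)) r))
    (*-mono-≤ (0≤^ (0≤inv (ℚₚ.<-≤-trans 0<1 (1≤ι (a≥1 m)))) (suc r)) (0≤^ (0≤inv (ℚₚ.<-≤-trans 0<1 (1≤ι (1≤∏ℕ a≥1 m)))) (suc r))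
      (wt-lower (a≥1 m)) (∏wt-lower a≥1 m))

  ∏2wt : ∀ S → ∏wt 2wt S ≡ 2ℚ ^ℚ List.length S ℚ.* ∏wt wt S
  ∏2wt [] = refl
  ∏2wt (d ∷ S) = trans (cong (2wt d ℚ.*_) (∏2wt S)) (regroup 2ℚ (wt d) (2ℚ ^ℚ List.length S) (∏wt wt S))
    where
    open +-*-Solver
    regroup : ∀ a b c d → (a ℚ.* b) ℚ.* (c ℚ.* d) ≡ (a ℚ.* c) ℚ.* (b ℚ.* d)
    regroup = solve 4 (λ a b c d → (a :* b) :* (c :* d) := (a :* c) :* (b :* d)) refl

  -- The doubled weights sum to at most 2 · 2r = 4r, which is half of 8r, as `∏1+≤2^M` asks.
  total-bound : ℚ
  total-bound = 2ℚ ^ℚ (8 ℕ.* r)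

  ∑∏2wt≤ : ∀ n → ∑ℚ (λ i → ∏wt 2wt (finiteSet i)) n ℚ.≤ total-bound
  ∑∏2wt≤ = ∑-finiteSet≤ 2wt≥0 λ K → ∏1+≤2^M (ℕ.pred (8 ℕ.* r)) (2wt≥0 ∘ suc) K
    (ℚₚ.≤-trans (ℚₚ.≤-reflexive (∑ℚ-*ˡ 2ℚ (λ i → ratio k ^ℚ lg i) K))
      (ℚₚ.≤-trans (*-monoˡ-≤ 2ℚ (0≤-+ 0≤1 0≤1) (∑ρ^lg≤ (ratio k) (ratio-sum k) (ratio≥0 k) (0≤ι (2 ℕ.* r)) (ratio-fixed k) K))
        (ℚₚ.≤-reflexive halves)))
    where
    halves : 2ℚ ℚ.* ι (2 ℕ.* r) ≡ ½ ℚ.* ι (8 ℕ.* r)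
    halves = trans (double (ι (2 ℕ.* r))) (cong (½ ℚ.*_) (trans (cong₂ ℚ._+_ (sym (ι-+ x x)) (sym (ι-+ x x))) (trans (sym (ι-+ (x ℕ.+ x) (x ℕ.+ x))) (cong ι (eight r)))))
      where
      x = 2 ℕ.* r
      eight : ∀ r → (2 ℕ.* r ℕ.+ 2 ℕ.* r) ℕ.+ (2 ℕ.* r ℕ.+ 2 ℕ.* r) ≡ 8 ℕ.* r
      eight = solve-∀
      open +-*-Solver
      double : ∀ x → (1ℚ ℚ.+ 1ℚ) ℚ.* x ≡ ½ ℚ.* ((x ℚ.+ x) ℚ.+ (x ℚ.+ x))
      double = solve 1 (λ x → (con 1ℚ :+ con 1ℚ) :* x := con ½ :* ((x :+ x) :+ (x :+ x))) refl

  -- With P the product of the first m + 1 digits and E = `suc e`, the diameter is at most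
  -- P^(-2(1+g/E)) and the weight at least P^(-(r+1)/r). Hence the condition 2 (1 + g/E) p ≥ r + 1;
  -- the extra 1 is the price of rational weights.
  diameter-power≤weight : ∀ {a} → Positive a → StrictlyIncreasing a → ∀ e g p m l →
    suc r ℕ.* suc e ℕ.≤ 2 ℕ.* (suc e ℕ.+ g) ℕ.* p → g ℕ.* suc m ℕ.≤ suc e ℕ.* l →
    inv (ι (∏² a (suc m ℕ.+ l))) ^ℚ p ℚ.≤ ∏wt wt (prefix a (suc m)) ^ℚ r
  diameter-power≤weight {a} a≥1 inc e′ g p m l h₁ h₂ = ^-cancel-≤ (0≤^ (∏wt-nonNeg wt≥0 (prefix a (suc m))) r) e′ (begin
    (δ ^ℚ p) ^ℚ e                    ≡⟨ ^-swap δ p e ⟩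
    (δ ^ℚ e) ^ℚ p                    ≤⟨ ^-mono-≤ (0≤^ (0≤inv (ℚₚ.<-≤-trans 0<1 (1≤ι (1≤∏² a≥1 (suc m ℕ.+ l))))) e) δ^e≤ p ⟩
    (X ^ℚ (2 ℕ.* (e ℕ.+ g))) ^ℚ p    ≡⟨ ^-assocʳ X (2 ℕ.* (e ℕ.+ g)) p ⟩
    X ^ℚ (2 ℕ.* (e ℕ.+ g) ℕ.* p)     ≤⟨ ^-anti-≤ X≥0 (inv≤1 (1≤ι (1≤∏ℕ a≥1 (suc m)))) h₁ ⟩
    X ^ℚ (suc r ℕ.* e)               ≡⟨ ^-assocʳ X (suc r) e ⟨
    (X ^ℚ suc r) ^ℚ e                ≤⟨ ^-mono-≤ (0≤^ X≥0 (suc r)) (∏wt-lower a≥1 (suc m)) e ⟩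
    (t ^ℚ r) ^ℚ e                    ∎)
    where
    open ℚₚ.≤-Reasoning
    e = suc e′
    D = ∏² a (suc m ℕ.+ l)
    P = ∏ℕ a (suc m)
    δ = inv (ι D)
    X = inv (ι P)
    t = ∏wt wt (prefix a (suc m))
    X≥0 : 0ℚ ℚ.≤ X
    X≥0 = 0≤inv (ℚₚ.<-≤-trans 0<1 (1≤ι (1≤∏ℕ a≥1 (suc m))))
    P^≤D^ : P ℕ.^ (2 ℕ.* (e ℕ.+ g)) ℕ.≤ D ℕ.^ e
    P^≤D^ = ℕₚ.≤-trans (ℕₚ.≤-reflexive (trans (cong (P ℕ.^_) (cong (e ℕ.+ g ℕ.+_) (ℕₚ.+-identityʳ (e ℕ.+ g)))) (ℕₚ.^-distribˡ-+-* P (e ℕ.+ g) (e ℕ.+ g))))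
      (ℕₚ.≤-trans (ℕₚ.*-mono-≤ gain gain)
        (ℕₚ.≤-reflexive (trans (sym (^-distribʳ-* Q Q e)) (cong (ℕ._^ e) (sym (∏²≡ a (suc m ℕ.+ l)))))))
      where
      Q = ∏ℕ a (suc m ℕ.+ l)
      gain = ∏ℕ-gain a≥1 inc e g m l h₂
    δ^e≤ : δ ^ℚ e ℚ.≤ X ^ℚ (2 ℕ.* (e ℕ.+ g))
    δ^e≤ = subst₂ ℚ._≤_ (inv-ι-^ (1≤∏² a≥1 (suc m ℕ.+ l)) e) (inv-ι-^ (1≤∏ℕ a≥1 (suc m)) (2 ℕ.* (e ℕ.+ g)))
      (inv-ι-anti (ℕₚ.m^n>0 P {{ℕ.>-nonZero (1≤∏ℕ a≥1 (suc m))}} (2 ℕ.* (e ℕ.+ g))) P^≤D^)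

-- The upper bound

frac-cancel-≤ : ∀ p k m j → frac p k ℚ.≤ frac m j → p ℕ.* suc j ℕ.≤ m ℕ.* suc k
frac-cancel-≤ p k m j h = ι-cancel-≤ (subst₂ ℚ._≤_ lhs rhs
  (*-monoʳ-≤ (ι (suc k) ℚ.* ι (suc j)) (0≤-* (0≤ι (suc k)) (0≤ι (suc j))) h))
  where
  open +-*-Solver
  lhs : frac p k ℚ.* (ι (suc k) ℚ.* ι (suc j)) ≡ ι (p ℕ.* suc j)
  lhs = trans (sym (ℚₚ.*-assoc (frac p k) (ι (suc k)) (ι (suc j)))) (trans (cong (ℚ._* ι (suc j)) (frac-*-ι p k)) (sym (ι-* p (suc j))))
  rhs : frac m j ℚ.* (ι (suc k) ℚ.* ι (suc j)) ≡ ι (m ℕ.* suc k)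
  rhs = trans (swap (frac m j) (ι (suc k)) (ι (suc j))) (trans (cong (ℚ._* ι (suc k)) (frac-*-ι m j)) (sym (ι-* m (suc k))))
    where
    swap : ∀ a b c → a ℚ.* (b ℚ.* c) ≡ (a ℚ.* c) ℚ.* b
    swap = solve 3 (λ a b c → a :* (b :* c) := (a :* c) :* b) refl

IsPowerMember : ℝ → ℝ → Pred ℝ 0ℓ
IsPowerMember x s z = ∃ λ m → ∃ λ k → s ≤ fromℚ (+ m ℚ./ suc k) × 0ℝ ≤ z × z ^ suc k ≈ x ^ m

power-member≤ : LEM → ∀ {d δ t} p k → 0ℝ ≤ d → d ≤ fromℚ δ → 0ℚ ℚ.≤ δ → δ ℚ.≤ 1ℚ → 0ℚ ℚ.≤ t → δ ^ℚ p ℚ.≤ t ^ℚ suc k →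
  ∀ z → IsPowerMember d (fromℚ (frac p k)) z → z ≤ fromℚ t
power-member≤ lem {d} {δ} {t} p k d≥0 d≤δ δ≥0 δ≤1 t≥0 δ^p≤t^r z (m , j , s≤m/j , z≥0 , z^≤ , _) =
  ¬¬-elim lem λ z≰t → contra (<ℝ-dense {fromℚ t} {z} (≰⇒> {z} {fromℚ t} lem z≰t))
  where
  contra : ¬ (∃ λ q → ∃ λ ε → 0ℚ ℚ.< ε × fromℚ t ≤ fromℚ q × fromℚ (q ℚ.+ ε) ≤ z)
  contra (q , ε , ε>0 , t≤q , q+ε≤z) = ℚₚ.<-irrefl refl (ℚₚ.≤-<-trans (ℚₚ.≤-trans y≤t (fromℚ-cancel t≤q)) q<y)
    where
    y = q ℚ.+ ε
    q<y : q ℚ.< y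
    q<y = <-from-gap ε>0 (solve 2 (λ q ε → (q :+ ε) :- q := ε) refl q ε) where open +-*-Solver
    y≥0 : 0ℚ ℚ.≤ y
    y≥0 = ℚₚ.≤-trans t≥0 (ℚₚ.≤-trans (fromℚ-cancel t≤q) (ℚₚ.<⇒≤ q<y))
    y^≤δ^ : y ^ℚ suc j ℚ.≤ δ ^ℚ m
    y^≤δ^ = fromℚ-cancel
      (≤ℝ-trans {fromℚ (y ^ℚ suc j)} {fromℚ y ^ suc j} {fromℚ (δ ^ℚ m)} (fromℚ-^-≥ y (suc j))
        (≤ℝ-trans {fromℚ y ^ suc j} {z ^ suc j} {fromℚ (δ ^ℚ m)} (^ℝ-mono-≤ {fromℚ y} {z} (fromℚ-mono y≥0) q+ε≤z (suc j))
          (≤ℝ-trans {z ^ suc j} {d ^ m} {fromℚ (δ ^ℚ m)} z^≤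
            (≤ℝ-trans {d ^ m} {fromℚ δ ^ m} {fromℚ (δ ^ℚ m)} (^ℝ-mono-≤ {d} {fromℚ δ} d≥0 d≤δ m) (fromℚ-^-≤ δ m)))))
    y≤t : y ℚ.≤ t
    y≤t = ^-cancel-≤ t≥0 k (^-cancel-≤ (0≤^ t≥0 (suc k)) j (begin
      (y ^ℚ suc k) ^ℚ suc j    ≡⟨ ^-swap y (suc k) (suc j) ⟩
      (y ^ℚ suc j) ^ℚ suc k    ≤⟨ ^-mono-≤ (0≤^ y≥0 (suc j)) y^≤δ^ (suc k) ⟩
      (δ ^ℚ m) ^ℚ suc k        ≡⟨ ^-assocʳ δ m (suc k) ⟩
      δ ^ℚ (m ℕ.* suc k)       ≤⟨ ^-anti-≤ δ≥0 δ≤1 (frac-cancel-≤ p k m j (subst (frac p k ℚ.≤_) (frac-def m j) (fromℚ-cancel s≤m/j))) ⟩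
      δ ^ℚ (p ℕ.* suc j)       ≡⟨ ^-assocʳ δ p (suc j) ⟨
      (δ ^ℚ p) ^ℚ suc j        ≤⟨ ^-mono-≤ (0≤^ δ≥0 p) δ^p≤t^r (suc j) ⟩
      (t ^ℚ suc k) ^ℚ suc j    ∎))
      where open ℚₚ.≤-Reasoning

⟶-respects-≈ : ∀ {c x y} → x ≈ y → (fromℚ ∘ c) ⟶ x → (fromℚ ∘ c) ⟶ y
⟶-respects-≈ {c} {x} {y} (x≤y , y≤x) c⟶x = close⇒⟶ {y} {c} λ ε ε>0 →
  let N , hN = ⟶⇒close {x} {c} c⟶x (½ ℚ.* ε) (0<½* ε>0)
      M₁ , h₁ = x≤y (½ ℚ.* ε) (0<½* ε>0)
      M₂ , h₂ = y≤x (½ ℚ.* ε) (0<½* ε>0)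
  in N ℕ.⊔ (M₁ ℕ.⊔ M₂) , λ n n≥ →
    ℚₚ.≤-trans (∣p-r∣≤∣p-q∣+∣q-r∣ (c n) (seq x n) (seq y n))
      (ℚₚ.≤-trans (ℚₚ.+-mono-≤ (hN n (ℕₚ.m⊔n≤o⇒m≤o N (M₁ ℕ.⊔ M₂) n≥))
          (∣p-q∣≤r (seq x n) (seq y n) (h₁ n (ℕₚ.m⊔n≤o⇒m≤o M₁ M₂ (ℕₚ.m⊔n≤o⇒n≤o N (M₁ ℕ.⊔ M₂) n≥)))
            (h₂ n (ℕₚ.m⊔n≤o⇒n≤o M₁ M₂ (ℕₚ.m⊔n≤o⇒n≤o N (M₁ ℕ.⊔ M₂) n≥)))))
        (ℚₚ.≤-reflexive (½+½ ε)))

common-prefix-distance : ∀ {x y a b} ℓ → ArePartialQuotients x a → ArePartialQuotients y b → (∀ i → i ℕ.< ℓ → a i ≡ b i) →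
  ∣ x - y ∣ ≤ fromℚ (inv (ι (∏² a ℓ)))
common-prefix-distance {x} {y} {a} {b} ℓ (a≥1 , a⟶x) (b≥1 , b⟶y) same ε ε>0 =
  let M , hM = ⟶⇒close {x} {convergent a} a⟶x (½ ℚ.* ε) (0<½* ε>0)
      N , hN = ⟶⇒close {y} {convergent b} b⟶y (½ ℚ.* ε) (0<½* ε>0)
  in (M ℕ.⊔ N) ℕ.⊔ ℓ , λ n n≥ →
    let n≥MN = ℕₚ.m⊔n≤o⇒m≤o (M ℕ.⊔ N) ℓ n≥
        n≥ℓ = ℕₚ.m⊔n≤o⇒n≤o (M ℕ.⊔ N) ℓ n≥
    in estimate (seq x n) (seq y n) (convergent a n) (convergent b n) {inv D} (hM n (ℕₚ.m⊔n≤o⇒m≤o M N n≥MN)) (hN n (ℕₚ.m⊔n≤o⇒n≤o M N n≥MN))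
         (*-cancelʳ-≤ D D>0 (subst (ℚ.∣ convergent a n ℚ.- convergent b n ∣ ℚ.* D ℚ.≤_) (sym (trans (ℚₚ.*-comm (inv D) D) (*inv D>0)))
           (common-prefix-close ℓ a≥1 b≥1 same n n n≥ℓ n≥ℓ)))
  where
  D = ι (∏² a ℓ)
  D>0 : 0ℚ ℚ.< D
  D>0 = ℚₚ.<-≤-trans 0<1 (1≤ι (1≤∏² a≥1 ℓ))
  estimate : ∀ x y c c′ {r} → ℚ.∣ c ℚ.- x ∣ ℚ.≤ ½ ℚ.* ε → ℚ.∣ c′ ℚ.- y ∣ ℚ.≤ ½ ℚ.* ε → ℚ.∣ c ℚ.- c′ ∣ ℚ.≤ r → ℚ.∣ x ℚ.- y ∣ ℚ.≤ r ℚ.+ ε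
  estimate x y c c′ {r} h₁ h₂ h₃ = begin
    ℚ.∣ x ℚ.- y ∣                                             ≤⟨ ∣p-r∣≤∣p-q∣+∣q-r∣ x c y ⟩
    ℚ.∣ x ℚ.- c ∣ ℚ.+ ℚ.∣ c ℚ.- y ∣                           ≤⟨ ℚₚ.+-monoʳ-≤ ℚ.∣ x ℚ.- c ∣ (∣p-r∣≤∣p-q∣+∣q-r∣ c c′ y) ⟩
    ℚ.∣ x ℚ.- c ∣ ℚ.+ (ℚ.∣ c ℚ.- c′ ∣ ℚ.+ ℚ.∣ c′ ℚ.- y ∣)     ≤⟨ ℚₚ.+-mono-≤ (subst (ℚ._≤ ½ ℚ.* ε) (∣p-q∣-comm c x) h₁) (ℚₚ.+-mono-≤ h₃ h₂) ⟩
    ½ ℚ.* ε ℚ.+ (r ℚ.+ ½ ℚ.* ε)                               ≡⟨ solve 2 (λ r e → con ½ :* e :+ (r :+ con ½ :* e) := r :+ e) refl r ε ⟩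
    r ℚ.+ ε                                                   ∎
    where
    open ℚₚ.≤-Reasoning
    open +-*-Solver

ℤ-cancel-+ : ∀ x {d d′} → x ℤ.+ + 1 ℤ.* d ≡ x ℤ.+ + 1 ℤ.* d′ → d ≡ d′
ℤ-cancel-+ x {d} {d′} h = trans (sym (ℤₚ.*-identityˡ d)) (trans (GroupProperties.∙-cancelˡ (AbelianGroup.group ℤₚ.+-0-abelianGroup) x (+ 1 ℤ.* d) (+ 1 ℤ.* d′) h) (ℤₚ.*-identityˡ d′))

-- The terms 0 and 1 fix the difference. They are among the shared digits, so short progressions,
-- whose difference may be ambiguous, need no further argument.
arith-prog-determined : ∀ {a b} k n → IsArithProg a k n → IsArithProg b k n → (∀ j → j ℕ.< suc (suc k) → a j ≡ b j) →
  ∀ i → i ℕ.< n → a (k ℕ.+ i) ≡ b (k ℕ.+ i)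
arith-prog-determined k n _ _ same zero _ = same (k ℕ.+ 0) (ℕ.s≤s (ℕₚ.≤-trans (ℕₚ.≤-reflexive (ℕₚ.+-identityʳ k)) (ℕₚ.n≤1+n k)))
arith-prog-determined k n _ _ same (suc zero) _ = same (k ℕ.+ 1) (ℕ.s≤s (ℕₚ.≤-reflexive (ℕₚ.+-comm k 1)))
arith-prog-determined {a} {b} k n (d , ha) (d′ , hb) same i@(suc (suc _)) i<n = ℤₚ.+-injective (begin
  + a (k ℕ.+ i)          ≡⟨ ha i i<n ⟩
  + a k ℤ.+ + i ℤ.* d    ≡⟨ cong₂ (λ x y → + x ℤ.+ + i ℤ.* y) ak≡bk d≡d′ ⟩
  + b k ℤ.+ + i ℤ.* d′   ≡⟨ hb i i<n ⟨
  + b (k ℕ.+ i)          ∎)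
  where
  open ≡-Reasoning
  ak≡bk = same k (ℕ.s≤s (ℕₚ.n≤1+n k))
  1<n = ℕₚ.≤-<-trans (ℕ.s≤s ℕ.z≤n) i<n
  d≡d′ : d ≡ d′
  d≡d′ = ℤ-cancel-+ (+ b k) (trans (cong (λ t → + t ℤ.+ + 1 ℤ.* d) (sym ak≡bk)) (trans (sym (ha 1 1<n))
    (trans (cong +_ (same (k ℕ.+ 1) (ℕ.s≤s (ℕₚ.≤-reflexive (ℕₚ.+-comm k 1))))) (hb 1 1<n))))

zero-measure : ∀ {s F} → (∀ δ → 0ℝ < δ → ∀ ε → 0ℚ ℚ.< ε → Σ (Cover δ F) λ C → ∃ λ w → ∃ λ T →
    (∀ i → IsWeight s (piece C i) (w i)) × IsSup _≤_ (λ y → ∃ λ n → y ≡ ∑ w n) T × T ≤ fromℚ ε) →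
  IsHausdorffMeasure s F (fin 0ℝ)
-- The empty partial sum 0 lies below every total, so 0 is a lower bound of the totals.
zero-measure {s} {F} covers = (λ _ → fin 0ℝ) , (λ δ δ>0 → (λ { y (_ , w , _ , ub , _) → ub (fin (∑ w 0)) (0 , refl) }) , greatest δ δ>0) ,
  (λ { y (δ , _ , refl) → ≤ℝ-refl {0ℝ} }) , (λ b h → h (fin 0ℝ) (1ℝ , (1ℚ , 0<1 , 0 , λ _ _ → ℚₚ.≤-refl) , refl))
  where
  total : ∀ {w T} → IsSup _≤_ (λ y → ∃ λ n → y ≡ ∑ w n) T → IsSup _≤∞_ (λ y → ∃ λ n → y ≡ fin (∑ w n)) (fin T)
  total {w} {T} (ub , lub) = (λ { y (n , refl) → ub (∑ w n) (n , refl) }) , λ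
    { ∞ _ → tt
    ; (fin b) h → lub b λ { y (n , refl) → h (fin (∑ w n)) (n , refl) } }
  greatest : ∀ δ → 0ℝ < δ → ∀ b → (∀ y → (Σ (Cover δ F) λ C → ∃ λ w → (∀ i → IsWeight s (piece C i) (w i)) ×
    IsSup _≤∞_ (λ y → ∃ λ n → y ≡ fin (∑ w n)) y) → b ≤∞ y) → b ≤∞ fin 0ℝ
  -- A single cover with finite total excludes ∞ as a lower bound; ε = 1 serves.
  greatest δ δ>0 ∞ h = let C , w , T , ws , sup , _ = covers δ δ>0 1ℚ 0<1 in h (fin T) (C , w , ws , total sup)
  greatest δ δ>0 (fin b) h = ≤0-from-ε {b} λ ε ε>0 → let C , w , T , ws , sup , T≤ε = covers δ δ>0 ε ε>0 in
    ≤ℝ-trans {b} {T} {fromℚ ε} (h (fin T) (C , w , ws , total sup)) T≤ε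

0≤∣∣ : ∀ x → 0ℝ ≤ ∣ x ∣
0≤∣∣ x = ≤-pointwise {0ℝ} {∣ x ∣} 0 λ n _ → ℚₚ.0≤∣p∣ (seq x n)

infinitely-often⇒ : LEM → ∀ {P : Pred ℕ 0ℓ} → InfinitelyOften P → ∀ N → ∃ λ k → N ℕ.≤ k × P k
infinitely-often⇒ lem inf N = ¬¬-elim lem λ ¬∃ → inf (N , λ j N≤j Pj → ¬∃ (j , N≤j , Pj))

-- Here s = p / (k′ + 1) and β = g / (e + 1). `2 ⊔ ν k ∸ 2` is the number of digits that a block at
-- k adds to the first k + 2; it is 0 for blocks of length at most 2, which lie inside those digits.
module UpperBound (lem : LEM) (ν : ℕ → ℕ) (k′ e g p : ℕ) (exponents : suc (suc k′) ℕ.* suc e ℕ.≤ 2 ℕ.* (suc e ℕ.+ g) ℕ.* p)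
  (K₀ : ℕ) (long : ∀ k → K₀ ℕ.≤ k → g ℕ.* suc (suc k) ℕ.≤ suc e ℕ.* (2 ℕ.⊔ ν k ℕ.∸ 2)) where

  open DigitWeight k′

  s : ℝ
  s = fromℚ (frac p k′)

  -- The number of digits fixed by a block at k: at least a k and a (k + 1), and the whole progression.
  fixed-length : ℕ → ℕ
  fixed-length k = suc (suc k) ℕ.+ (2 ℕ.⊔ ν k ℕ.∸ 2)

  -- The list `finiteSet i` fixes k by its length and then the first k + 2 digits, so a piece lies
  -- in one cylinder although k is existential.
  Piece : ℕ → ℕ → Pred ℝ 0ℓ
  Piece N i x = UnitInterval x × ∃ λ a → ArePartialQuotients x a × StrictlyIncreasing a ×
    ∃ λ k → N ℕ.≤ k × prefix a (suc (suc k)) ≡ finiteSet i × IsArithProg a k (ν k)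

  block-determined : ∀ {a b} k → IsArithProg a k (ν k) → IsArithProg b k (ν k) → (∀ j → j ℕ.< suc (suc k) → a j ≡ b j) →
    ∀ j → j ℕ.< fixed-length k → a j ≡ b j
  block-determined {a} {b} k apa apb same j j< with j ℕₚ.<? suc (suc k)
  ... | yes j<2+k = same j j<2+k
  ... | no j≮2+k = subst (λ t → a t ≡ b t) k+i≡j (arith-prog-determined k (ν k) apa apb same i i<ν)
    where
    2+k≤j = ℕₚ.≮⇒≥ j≮2+k
    i = j ℕ.∸ k
    k+i≡j : k ℕ.+ i ≡ j
    k+i≡j = ℕₚ.m+[n∸m]≡n (ℕₚ.≤-trans (ℕₚ.m≤n+m k 2) 2+k≤j)
    2≤i : 2 ℕ.≤ i
    2≤i = ℕₚ.+-cancelˡ-≤ k 2 i (subst₂ ℕ._≤_ (ℕₚ.+-comm 2 k) (sym k+i≡j) 2+k≤j)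
    i<max : i ℕ.< 2 ℕ.⊔ ν k
    i<max = ℕₚ.+-cancelˡ-< k i (2 ℕ.⊔ ν k) (subst₂ ℕ._<_ (sym k+i≡j) (trans (regroup k (2 ℕ.⊔ ν k ℕ.∸ 2))
      (cong (k ℕ.+_) (ℕₚ.m+[n∸m]≡n (ℕₚ.m≤m⊔n 2 (ν k))))) j<)
      where
      regroup : ∀ k x → suc (suc k) ℕ.+ x ≡ k ℕ.+ (2 ℕ.+ x)
      regroup = solve-∀
    i<ν : i ℕ.< ν k
    i<ν with ℕₚ.⊔-sel 2 (ν k)
    ... | inj₁ eq = ⊥-elim (ℕₚ.<⇒≱ (subst (i ℕ.<_) eq i<max) 2≤i)
    ... | inj₂ eq = subst (i ℕ.<_) eq i<max

  piece-digits : ∀ {N i x y} (Px : Piece N i x) (Py : Piece N i y) →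
    ∀ j → j ℕ.< fixed-length (proj₁ (proj₂ (proj₂ (proj₂ (proj₂ Px))))) → proj₁ (proj₂ Px) j ≡ proj₁ (proj₂ Py) j
  piece-digits (_ , a , _ , _ , k , _ , eqa , apa) (_ , b , _ , _ , j , _ , eqb , apb) =
    block-determined k apa (subst (λ n → IsArithProg b n (ν n)) (sym k≡j) apb)
      (prefix-injective (suc (suc k)) (trans eqa (trans (sym eqb) (cong (λ n → prefix b (suc (suc n))) (sym k≡j)))))
    where
    k≡j : k ≡ j
    k≡j = ℕₚ.suc-injective (ℕₚ.suc-injective (trans (sym (length-prefix a (suc (suc k))))
      (trans (cong List.length (trans eqa (sym eqb))) (length-prefix b (suc (suc j))))))

  ∏²-cong : ∀ {a b} n → (∀ j → j ℕ.< n → a j ≡ b j) → ∏² a n ≡ ∏² b n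
  ∏²-cong zero h = refl
  ∏²-cong (suc n) h = cong₂ ℕ._*_ (cong₂ ℕ._*_ (h 0 (ℕ.s≤s ℕ.z≤n)) (h 0 (ℕ.s≤s ℕ.z≤n))) (∏²-cong n λ j j<n → h (suc j) (ℕ.s≤s j<n))

  piece-distance : ∀ {N i x y z} (Px : Piece N i x) → Piece N i y → Piece N i z →
    ∣ y - z ∣ ≤ fromℚ (inv (ι (∏² (proj₁ (proj₂ Px)) (fixed-length (proj₁ (proj₂ (proj₂ (proj₂ (proj₂ Px)))))))))
  piece-distance {N} {i} {x} {y} {z} Px@(_ , a , _ , _ , k , _) Py@(_ , b , pqb , _) Pz@(_ , c , pqc , _) =
    subst (λ r → ∣ y - z ∣ ≤ fromℚ (inv (ι r))) (∏²-cong (fixed-length k) λ j j< → sym (a≡b j j<))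
      (common-prefix-distance {y} {z} {b} {c} (fixed-length k) pqb pqc λ j j< →
        trans (sym (a≡b j j<)) (piece-digits {N} {i} {x} {z} Px Pz j j<))
    where
    a≡b = piece-digits {N} {i} {x} {y} Px Py

  -- A piece with a point has a set of k + 2 > N elements, so the factor 2^(k+2) contained in `2wt`
  -- outweighs (1/2)^N.
  weight-bound : ℕ → ℕ → ℚ
  weight-bound N i = ½ ^ℚ N ℚ.* ∏wt 2wt (finiteSet i)

  piece-weight : ∀ N → K₀ ℕ.≤ N → ∀ i → ∃ λ w → IsWeight s (Piece N i) w × w ≤ fromℚ (weight-bound N i)
  piece-weight N K₀≤N i = weigh (lem (Satisfiable (Piece N i)))
    where
    weigh : Dec (Satisfiable (Piece N i)) → ∃ λ w → IsWeight s (Piece N i) w × w ≤ fromℚ (weight-bound N i)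
    weigh (no unsat) = 0ℝ , empty (λ x Px → unsat (x , Px)) ,
      fromℚ-mono (0≤-* (0≤^ 0≤½ N) (∏wt-nonNeg 2wt≥0 (finiteSet i)))
    weigh (yes sat@(x , Px@(_ , a , (a≥1 , _) , inc , k , N≤k , eq , _))) = proj₁ power , nonempty sat (proj₂ diam) (proj₂ power) ,
        ≤ℝ-trans {proj₁ power} {fromℚ t} {fromℚ (weight-bound N i)} (proj₂ (proj₂ power) (fromℚ t) bound) (fromℚ-mono t≤)
      where
      D = ∏² a (fixed-length k)
      δ = inv (ι D)
      D≥1 : 1ℚ ℚ.≤ ι D
      D≥1 = 1≤ι (1≤∏² a≥1 (fixed-length k))
      t = ∏wt wt (prefix a (suc (suc k)))
      t≥0 : 0ℚ ℚ.≤ t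
      t≥0 = ∏wt-nonNeg wt≥0 (prefix a (suc (suc k)))
      diam : ∃ λ d → IsDiam (Piece N i) d
      diam = supremum lem {λ r → ∃ λ x → ∃ λ y → Piece N i x × Piece N i y × r ≡ ∣ x - y ∣} {δ}
        (λ { r (y , z , Py , Pz , refl) → piece-distance {N} {i} {x} {y} {z} Px Py Pz }) ∣ x - x ∣ (x , x , Px , Px , refl)
      d = proj₁ diam
      d≥0 : 0ℝ ≤ d
      d≥0 = ≤ℝ-trans {0ℝ} {∣ x - x ∣} {d} (0≤∣∣ (x - x)) (proj₁ (proj₂ diam) ∣ x - x ∣ (x , x , Px , Px , refl))
      d≤δ : d ≤ fromℚ δ
      d≤δ = proj₂ (proj₂ diam) (fromℚ δ) λ { r (y , z , Py , Pz , refl) → piece-distance {N} {i} {x} {y} {z} Px Py Pz }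
      bound : ∀ z → IsPowerMember d s z → z ≤ fromℚ t
      bound = power-member≤ lem {d} {δ} {t} p k′ d≥0 d≤δ (0≤inv (ℚₚ.<-≤-trans 0<1 D≥1)) (inv≤1 D≥1) t≥0
        (diameter-power≤weight a≥1 inc e g p (suc k) (2 ℕ.⊔ ν k ℕ.∸ 2) exponents (long k (ℕₚ.≤-trans K₀≤N N≤k)))
      -- A supremum requires some member. The integer p is an exponent at least s, and its power is
      -- available without a root.
      member : IsPowerMember d s (d ^ p)
      member = p , 0 , fromℚ-mono s≤p , 0≤^ℝ {d} d≥0 p ,
        ≤-pointwise {d ^ p * 1ℝ} {d ^ p} 0 (λ n _ → ℚₚ.≤-reflexive (ℚₚ.*-identityʳ (seq (d ^ p) n))) ,
        ≤-pointwise {d ^ p} {d ^ p * 1ℝ} 0 (λ n _ → ℚₚ.≤-reflexive (sym (ℚₚ.*-identityʳ (seq (d ^ p) n))))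
        where
        s≤p : frac p k′ ℚ.≤ + p ℚ./ 1
        s≤p = subst₂ ℚ._≤_ (ℚₚ.*-identityʳ (frac p k′)) (trans (frac-*-ι p k′) (sym (ι-def p)))
          (*-monoˡ-≤ (frac p k′) (0≤frac p k′) (1≤ι (ℕ.s≤s ℕ.z≤n)))
      power : ∃ λ w → IsPower d s w
      power = supremum lem {IsPowerMember d s} {t} bound (d ^ p) member
      t≤ : t ℚ.≤ weight-bound N i
      t≤ = subst₂ ℚ._≤_ (ℚₚ.*-identityˡ t)
        (trans (ℚₚ.*-assoc (½ ^ℚ N) (2ℚ ^ℚ suc (suc k)) t) (cong (½ ^ℚ N ℚ.*_)
          (trans (sym (trans (∏2wt (prefix a (suc (suc k)))) (cong (λ n → 2ℚ ^ℚ n ℚ.* t) (length-prefix a (suc (suc k)))))) (cong (∏wt 2wt) eq))))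
        (*-monoʳ-≤ t t≥0 1≤)
        where
        1≤ : 1ℚ ℚ.≤ ½ ^ℚ N ℚ.* 2ℚ ^ℚ suc (suc k)
        1≤ = subst (ℚ._≤ ½ ^ℚ N ℚ.* 2ℚ ^ℚ suc (suc k)) (trans (sym (^-distrib-* ½ 2ℚ N)) (1^ N))
          (*-monoˡ-≤ (½ ^ℚ N) (0≤^ 0≤½ N) 2^≤)
          where
          1≤2 : 1ℚ ℚ.≤ 2ℚ
          1≤2 = p≤p+q 1ℚ 0≤1
          2^≤ : 2ℚ ^ℚ N ℚ.≤ 2ℚ ^ℚ suc (suc k)
          2^≤ = let o , N+o≡ = ℕₚ.m≤n⇒∃[o]m+o≡n (ℕₚ.≤-trans N≤k (ℕₚ.m≤n+m k 2)) in
            subst₂ ℚ._≤_ (ℚₚ.*-identityʳ (2ℚ ^ℚ N)) (trans (sym (^-homo-* 2ℚ N o)) (cong (2ℚ ^ℚ_) N+o≡))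
              (*-monoˡ-≤ (2ℚ ^ℚ N) (0≤^ (0≤-+ 0≤1 0≤1) N) (1≤^ 1≤2 o))

  piece-covers : ∀ N {x} → F ν x → ∃ λ i → Piece N i x
  piece-covers N {x} ((0<x , x<1 , _ , a , pqa@(a≥1 , _) , inc) , b , pqb , often) =
    let k , N≤k , apb = infinitely-often⇒ lem often N
        i , i< , eq = prefix∈subset a≥1 inc (a (suc k)) (suc (suc k)) λ j j< → increasing-mono inc j (suc k) (ℕₚ.≤-pred j<)
    in i , (<ℝ⇒≤ {0ℝ} {x} 0<x , <ℝ⇒≤ {x} {1ℝ} x<1) , a , pqa , inc , k , N≤k ,
      trans (sym eq) (subset≡finiteSet (a (suc k)) i<) , transport k apb
    where
    same = quotients-unique {x} {a} {b} pqa pqb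
    transport : ∀ k → IsArithProg b k (ν k) → IsArithProg a k (ν k)
    transport k (d , h) = d , λ i i< → trans (cong +_ (same (k ℕ.+ i))) (trans (h i i<) (cong (λ t → + t ℤ.+ + i ℤ.* d) (sym (same k))))

  piece-respects : ∀ N i {x y} → x ≈ y → Piece N i x → Piece N i y
  piece-respects N i {x} {y} x≈y@(x≤y , y≤x) ((0≤x , x≤1) , a , (a≥1 , a⟶x) , rest) =
    (≤ℝ-trans {0ℝ} {x} {y} 0≤x x≤y , ≤ℝ-trans {y} {x} {1ℝ} y≤x x≤1) , a , (a≥1 , ⟶-respects-≈ {convergent a} {x} {y} x≈y a⟶x) , rest

  piece-small : ∀ {N ε} → 1ℚ ℚ.≤ ι N ℚ.* ε → 0ℚ ℚ.< ε → ∀ i {x y} → Piece N i x → Piece N i y → ∣ x - y ∣ ≤ fromℚ ε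
  piece-small {N} {ε} 1≤Nε ε>0 i {x} {y} Px@(_ , a , (a≥1 , _) , inc , k , N≤k , _) Py =
    ≤ℝ-trans {∣ x - y ∣} {fromℚ (inv (ι D))} {fromℚ ε} (piece-distance {N} {i} {x} {x} {y} Px Px Py)
      (fromℚ-mono {inv (ι D)} {ε} (*-cancelʳ-≤ (ι D) D>0 (subst (ℚ._≤ ε ℚ.* ι D) (sym (trans (ℚₚ.*-comm (inv (ι D)) (ι D)) (*inv D>0)))
        (ℚₚ.≤-trans 1≤Nε (ℚₚ.≤-trans (ℚₚ.≤-reflexive (ℚₚ.*-comm (ι N) ε)) (*-monoˡ-≤ ε (ℚₚ.<⇒≤ ε>0) (ι-mono-≤ N≤D)))))))
    where
    l = 2 ℕ.⊔ ν k ℕ.∸ 2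
    D = ∏² a (fixed-length k)
    D>0 : 0ℚ ℚ.< ι D
    D>0 = ℚₚ.<-≤-trans 0<1 (1≤ι (1≤∏² a≥1 (fixed-length k)))
    N≤D : N ℕ.≤ D
    N≤D = ℕₚ.≤-trans N≤k (ℕₚ.≤-trans (ℕₚ.≤-trans (ℕₚ.n≤1+n k) (ℕₚ.m≤m+n (suc k) l))
      (ℕₚ.≤-trans (ℕₚ.<⇒≤ (index<digit a≥1 inc (suc k ℕ.+ l))) (digit≤∏² a≥1 (suc k ℕ.+ l))))

  measure-zero : IsHausdorffMeasure s (F ν) (fin 0ℝ)
  measure-zero = zero-measure {s} {F ν} λ δ δ>0 ε ε>0 →
    let η , η>0 , η≤δ = positive-rational {δ} δ>0
        N₁ , 1≤N₁η = archimedean-* 1ℚ η>0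
        N₂ , ½^N₂≤ = ½^-small {ε ℚ.* inv total-bound} (0<-* ε>0 (0<inv C>0))
        -- K₀ makes the blocks long, N₁ makes the diameters at most η, and N₂ makes the total weight
        -- at most ε.
        N = K₀ ℕ.⊔ (N₁ ℕ.⊔ N₂)
        K₀≤N = ℕₚ.m≤m⊔n K₀ (N₁ ℕ.⊔ N₂)
        N₁≤N = ℕₚ.≤-trans (ℕₚ.m≤m⊔n N₁ N₂) (ℕₚ.m≤n⊔m K₀ (N₁ ℕ.⊔ N₂))
        N₂≤N = ℕₚ.≤-trans (ℕₚ.m≤n⊔m N₁ N₂) (ℕₚ.m≤n⊔m K₀ (N₁ ℕ.⊔ N₂))
        w = λ i → proj₁ (piece-weight N K₀≤N i)
        small = partial-sums N K₀≤N ε (ℚₚ.≤-trans (^-anti-≤ 0≤½ (ℚₚ.<⇒≤ ½<1) N₂≤N) ½^N₂≤)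
        T , sup = supremum lem {λ y → ∃ λ n → y ≡ ∑ w n} {ε} (λ { y (n , refl) → small n }) 0ℝ (0 , refl)
    in record
      { piece = Piece N
      ; respects-≈ = λ i {x} {y} → piece-respects N i {x} {y}
      ; ⊆-unit = λ i Px → proj₁ Px
      ; diam≤δ = λ i {x} {y} Px Py → ≤ℝ-trans {∣ x - y ∣} {fromℚ η} {δ}
          (piece-small {N} {η} (ℚₚ.≤-trans 1≤N₁η (*-monoʳ-≤ η (ℚₚ.<⇒≤ η>0) (ι-mono-≤ N₁≤N))) η>0 i {x} {y} Px Py) η≤δ
      ; covers = λ {x} → piece-covers N {x}
      } , w , T , (λ i → proj₁ (proj₂ (piece-weight N K₀≤N i))) , sup , proj₂ sup (fromℚ ε) λ { y (n , refl) → small n }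
    where
    C>0 : 0ℚ ℚ.< total-bound
    C>0 = 0<^ (0<-+ 0<1 0≤1) (8 ℕ.* r)
    partial-sums : ∀ N (K₀≤N : K₀ ℕ.≤ N) ε → ½ ^ℚ N ℚ.≤ ε ℚ.* inv total-bound → ∀ n →
      ∑ (λ i → proj₁ (piece-weight N K₀≤N i)) n ≤ fromℚ ε
    partial-sums N K₀≤N ε h n = ≤ℝ-trans {∑ w n} {∑ (fromℚ ∘ weight-bound N) n} {fromℚ ε}
      (∑-mono-≤ {w} {fromℚ ∘ weight-bound N} (λ i → proj₂ (proj₂ (piece-weight N K₀≤N i))) n)
      (≤-pointwise {∑ (fromℚ ∘ weight-bound N) n} {fromℚ ε} 0 λ k _ → subst (ℚ._≤ ε) (sym (seq-∑-fromℚ (weight-bound N) n k)) sum≤)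
      where
      w = λ i → proj₁ (piece-weight N K₀≤N i)
      sum≤ : ∑ℚ (weight-bound N) n ℚ.≤ ε
      sum≤ = ℚₚ.≤-trans (ℚₚ.≤-reflexive (∑ℚ-*ˡ (½ ^ℚ N) (λ i → ∏wt 2wt (finiteSet i)) n))
        (ℚₚ.≤-trans (*-mono-≤ (0≤^ 0≤½ N) (0≤∑ℚ (λ i → ∏wt-nonNeg 2wt≥0 (finiteSet i)) n) h (∑∏2wt≤ n))
          (ℚₚ.≤-reflexive (*-inv-cancel ε C>0)))

-- Avoiding small families of nodes of a tree

select : ∀ {A : Set} → Dec A → ℚ → ℚ
select (yes _) q = q
select (no _)  q = 0ℚ

discard : ∀ {A : Set} → Dec A → ℚ → ℚ
discard (yes _) q = 0ℚ
discard (no _)  q = q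

select+discard : ∀ {A : Set} (d : Dec A) q → select d q ℚ.+ discard d q ≡ q
select+discard (yes _) q = ℚₚ.+-identityʳ q
select+discard (no _) q = ℚₚ.+-identityˡ q

0≤select : ∀ {A : Set} (d : Dec A) {q} → 0ℚ ℚ.≤ q → 0ℚ ℚ.≤ select d q
0≤select (yes _) q≥0 = q≥0
0≤select (no _) q≥0 = ℚₚ.≤-refl

0≤discard : ∀ {A : Set} (d : Dec A) {q} → 0ℚ ℚ.≤ q → 0ℚ ℚ.≤ discard d q
0≤discard (yes _) q≥0 = ℚₚ.≤-refl
0≤discard (no _) q≥0 = q≥0

∑ℚ-distrib-+ : ∀ s t n → ∑ℚ (λ i → s i ℚ.+ t i) n ≡ ∑ℚ s n ℚ.+ ∑ℚ t n
∑ℚ-distrib-+ s t zero = refl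
∑ℚ-distrib-+ s t (suc n) = trans (cong (ℚ._+ (s n ℚ.+ t n)) (∑ℚ-distrib-+ s t n)) (regroup (∑ℚ s n) (∑ℚ t n) (s n) (t n))
  where
  open +-*-Solver
  regroup : ∀ a b c d → (a ℚ.+ b) ℚ.+ (c ℚ.+ d) ≡ (a ℚ.+ c) ℚ.+ (b ℚ.+ d)
  regroup = solve 4 (λ a b c d → (a :+ b) :+ (c :+ d) := (a :+ c) :+ (b :+ d)) refl

restrict : (ℕ → ℚ) → (ℕ → ℕ) → ℕ → ℕ → ℚ
restrict W v β i = select (v i ℕₚ.≟ β) (W i)

Bounded : (ℕ → ℚ) → ℚ → Set
Bounded W x = ∀ m → ∑ℚ W m ℚ.≤ x

∑ℚ-mono-≤ : ∀ {s t} → (∀ i → s i ℚ.≤ t i) → ∀ n → ∑ℚ s n ℚ.≤ ∑ℚ t n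
∑ℚ-mono-≤ h zero = ℚₚ.≤-refl
∑ℚ-mono-≤ h (suc n) = ℚₚ.+-mono-≤ (∑ℚ-mono-≤ h n) (h n)

-- If the branch β = b is too heavy, discarding it leaves at most the share of the other branches.
light-branch : LEM → ∀ b W v x → (∀ i → 0ℚ ℚ.≤ W i) → Bounded W (ι (suc b) ℚ.* x) →
  ∃ λ β → β ℕ.< suc b × Bounded (restrict W v β) x
light-branch lem zero W v x W≥0 h = 0 , ℕₚ.≤-refl , λ m → ℚₚ.≤-trans
  (∑ℚ-mono-≤ {restrict W v 0} {W} (λ i → select≤ (v i ℕₚ.≟ 0) (W≥0 i)) m)
  (subst (∑ℚ W m ℚ.≤_) (trans (cong (ℚ._* x) ι-1) (ℚₚ.*-identityˡ x)) (h m))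
  where
  select≤ : ∀ {A : Set} (d : Dec A) {q} → 0ℚ ℚ.≤ q → select d q ℚ.≤ q
  select≤ (yes _) q≥0 = ℚₚ.≤-refl
  select≤ (no _) q≥0 = q≥0
light-branch lem (suc b) W v x W≥0 h = choose (lem (Bounded (restrict W v (suc b)) x))
  where
  W′ : ℕ → ℚ
  W′ i = discard (v i ℕₚ.≟ suc b) (W i)
  W′≥0 : ∀ i → 0ℚ ℚ.≤ W′ i
  W′≥0 i = 0≤discard (v i ℕₚ.≟ suc b) (W≥0 i)
  R = restrict W v (suc b)
  R≥0 : ∀ i → 0ℚ ℚ.≤ R i
  R≥0 i = 0≤select (v i ℕₚ.≟ suc b) (W≥0 i)
  same : ∀ {β} → β ℕ.< suc b → ∀ i → restrict W′ v β i ≡ restrict W v β i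
  same {β} β< i = go (v i ℕₚ.≟ suc b) (v i ℕₚ.≟ β)
    where
    go : (d : Dec (v i ≡ suc b)) (d′ : Dec (v i ≡ β)) → select d′ (discard d (W i)) ≡ select d′ (W i)
    go (yes p) (yes q) = ⊥-elim (ℕₚ.<-irrefl (trans (sym q) p) β<)
    go (yes p) (no _) = refl
    go (no _) (yes _) = refl
    go (no _) (no _) = refl
  choose : Dec (Bounded R x) → ∃ λ β → β ℕ.< suc (suc b) × Bounded (restrict W v β) x
  choose (yes light) = suc b , ℕₚ.≤-refl , light
  choose (no heavy) =
    let m₀ , x≰ = ¬∀⇒∃¬ lem heavy
        β , β< , light = light-branch lem b W′ v x W′≥0 (rest m₀ (ℚₚ.<⇒≤ (ℚₚ.≰⇒> x≰)))
    in β , ℕₚ.m<n⇒m<1+n β< , λ m → subst (ℚ._≤ x) (∑ℚ-cong m λ i _ → same β< i) (light m)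
    where
    rest : ∀ m₀ → x ℚ.≤ ∑ℚ R m₀ → Bounded W′ (ι (suc b) ℚ.* x)
    rest m₀ x≤ m = ℚₚ.≤-trans (∑ℚ-mono-length W′≥0 (ℕₚ.m≤m⊔n m m₀))
      (cancel (ι (suc b)) x (∑ℚ R M) (∑ℚ W′ M) (ℚₚ.≤-trans x≤ (∑ℚ-mono-length R≥0 (ℕₚ.m≤n⊔m m m₀)))
        (subst₂ ℚ._≤_ (trans (∑ℚ-cong M λ i _ → sym (select+discard (v i ℕₚ.≟ suc b) (W i))) (∑ℚ-distrib-+ R W′ M))
          (cong (ℚ._* x) (ι-suc (suc b))) (h M)))
      where
      M = m ℕ.⊔ m₀
      cancel : ∀ k x r w → x ℚ.≤ r → r ℚ.+ w ℚ.≤ (1ℚ ℚ.+ k) ℚ.* x → w ℚ.≤ k ℚ.* x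
      cancel k x r w h₁ h₂ = ≤-from-gap (0≤-+ (p≤q⇒0≤q-p h₁) (p≤q⇒0≤q-p h₂))
        (solve 4 (λ k x r w → k :* x :- w := (r :- x) :+ ((con 1ℚ :+ k) :* x :- (r :+ w))) refl k x r w)
        where open +-*-Solver

module Tree (B : ℕ → ℕ) (B≥1 : ∀ k → 1 ℕ.≤ B k) where
  μ : ℕ → ℚ
  μ zero    = 1ℚ
  μ (suc n) = inv (ι (B n)) ℚ.* μ n

  B>0 : ∀ n → 0ℚ ℚ.< ι (B n)
  B>0 n = ℚₚ.<-≤-trans 0<1 (1≤ι (B≥1 n))

  0<μ : ∀ n → 0ℚ ℚ.< μ n
  0<μ zero = 0<1
  0<μ (suc n) = 0<-* (0<inv (B>0 n)) (0<μ n)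

  Valid : (ℕ → ℕ) → Set
  Valid b = ∀ k → b k ℕ.< B k

  -- The i-th node is the prefix of length L i of v i; the digits chosen along the path keep its relative mass below 1.
  module _ (lem : LEM) (L : ℕ → ℕ) (v : ℕ → ℕ → ℕ) {C : ℚ} (C<1 : C ℚ.< 1ℚ) (total : Bounded (μ ∘ L) C) where
    private
      -- W i is μ (L i) while the path has followed v i on all of its first n digits, and 0 once it
      -- has left v i. The invariant bounds the mass of the forbidden nodes relative to the current
      -- one.
      record Node (n : ℕ) : Set where
        field
          W       : ℕ → ℚ
          W≥0     : ∀ i → 0ℚ ℚ.≤ W i
          mass≤   : Bounded W (C ℚ.* μ n)
      open Node

      root-node : Node 0
      root-node = record { W = μ ∘ L ; W≥0 = λ i → ℚₚ.<⇒≤ (0<μ (L i)) ; mass≤ = λ m → subst (∑ℚ (μ ∘ L) m ℚ.≤_) (sym (ℚₚ.*-identityʳ C)) (total m) }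

      branch : ∀ n (N : Node n) → ∃ λ β → β ℕ.< B n × Bounded (restrict (W N) (λ i → v i n) β) (C ℚ.* μ (suc n))
      branch n N = let β , β< , light = light-branch lem (ℕ.pred (B n)) (W N) (λ i → v i n) (C ℚ.* μ (suc n)) (W≥0 N) bound in
        β , subst (β ℕ.<_) suc-pred-B β< , light
        where
        suc-pred-B : suc (ℕ.pred (B n)) ≡ B n
        suc-pred-B = ℕₚ.suc-pred (B n) {{ℕ.>-nonZero (B≥1 n)}}
        rescale : ∀ k k⁻¹ C μ → k ℚ.* k⁻¹ ≡ 1ℚ → k ℚ.* (C ℚ.* (k⁻¹ ℚ.* μ)) ≡ C ℚ.* μ
        rescale k k⁻¹ C μ eq = trans (solve 4 (λ k j C μ → k :* (C :* (j :* μ)) := (k :* j) :* (C :* μ)) refl k k⁻¹ C μ)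
          (trans (cong (ℚ._* (C ℚ.* μ)) eq) (ℚₚ.*-identityˡ (C ℚ.* μ)))
          where open +-*-Solver
        bound : Bounded (W N) (ι (suc (ℕ.pred (B n))) ℚ.* (C ℚ.* μ (suc n)))
        bound m = subst (∑ℚ (W N) m ℚ.≤_) (sym (trans (cong (λ k → ι k ℚ.* (C ℚ.* μ (suc n))) suc-pred-B)
          (rescale (ι (B n)) (inv (ι (B n))) C (μ n) (*inv (B>0 n))))) (mass≤ N m)

      child : ∀ n → Node n → Node (suc n)
      child n N = record
        { W = restrict (W N) (λ i → v i n) (proj₁ (branch n N))
        ; W≥0 = λ i → 0≤select (v i n ℕₚ.≟ proj₁ (branch n N)) (W≥0 N i)
        ; mass≤ = proj₂ (proj₂ (branch n N)) }

      node : ∀ n → Node n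
      node zero = root-node
      node (suc n) = child n (node n)

      path : ℕ → ℕ
      path n = proj₁ (branch n (node n))

      full-weight : ∀ i n → (∀ k → k ℕ.< n → path k ≡ v i k) → W (node n) i ≡ μ (L i)
      full-weight i zero h = refl
      full-weight i (suc n) h = trans (selected (v i n ℕₚ.≟ path n) (sym (h n ℕₚ.≤-refl))) (full-weight i n λ k k<n → h k (ℕₚ.m<n⇒m<1+n k<n))
        where
        selected : ∀ {A : Set} (d : Dec A) → A → ∀ {q} → select d q ≡ q
        selected (yes _) a = refl
        selected (no ¬a) a = ⊥-elim (¬a a)

    avoiding-path : ∃ λ b → Valid b × (∀ i → ¬ (∀ k → k ℕ.< L i → b k ≡ v i k))
    avoiding-path = path , (λ n → proj₁ (proj₂ (branch n (node n)))) , λ i h →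
      -- A path through the i-th node would at this level still carry its whole mass μ n, more than
      -- the invariant C μ n permits.
      let n = L i in
      ℚₚ.<-irrefl refl (ℚₚ.<-≤-trans
        (subst (C ℚ.* μ n ℚ.<_) (ℚₚ.*-identityˡ (μ n)) (ℚₚ.*-monoˡ-<-pos (μ n) {{ℚ.positive (0<μ n)}} C<1))
        (ℚₚ.≤-trans (ℚₚ.≤-reflexive (sym (full-weight i n h)))
          (ℚₚ.≤-trans (last≤∑ (W≥0 (node n)) i) (mass≤ (node n) (suc i)))))
      where
      last≤∑ : ∀ {t} → (∀ i → 0ℚ ℚ.≤ t i) → ∀ i → t i ℚ.≤ ∑ℚ t (suc i)
      last≤∑ {t} t≥0 i = subst (t i ℚ.≤_) (ℚₚ.+-comm (t i) (∑ℚ t i)) (p≤p+q (t i) (0≤∑ℚ t≥0 i))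

-- The Cantor set of the lower bound

-- Mostly applied to a count of pending forced digits, with 0 for a free position. Being a plain
-- function it allows proofs to generalise over the count.
if0 : ∀ {A : Set} → ℕ → A → A → A
if0 zero    x y = x
if0 (suc _) x y = y

-- The state at position k is the position of the next block together with the number of forced digits still to come.
-- A block at s forces the digits at s + 1, …, s + ν s - 1; the next block starts so late that the forced digits up to
-- its start are negligible.
module Schedule (ν : ℕ → ℕ) (ν≥1 : ∀ k → 1 ℕ.≤ ν k) (Q′ e g : ℕ)
  (often : ∀ M → ∃ λ N → M ℕ.≤ N × suc e ℕ.* ν N ℕ.≤ g ℕ.* suc N) where

  -- Divided by W n, the bound `#forced≤` says that the share of forced digits is at most g / (E +
  -- g) + 1 / W, where E = `suc e`. Q only controls the error 1 / W.
  Q W : ℕ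
  Q = suc Q′
  W = Q ℕ.* (suc e ℕ.+ g)

  next : ℕ → ℕ
  next k = proj₁ (often (W ℕ.* (k ℕ.+ ν k)))

  enter : ∀ k t → Dec (k ≡ t) → ℕ × ℕ
  enter k t (yes _) = next k , ℕ.pred (ν k)
  enter k t (no _)  = t , 0

  step : ℕ → ℕ × ℕ → ℕ × ℕ
  step k (t , suc r) = t , r
  step k (t , zero)  = enter k t (k ℕₚ.≟ t)

  state : ℕ → ℕ × ℕ
  state zero    = proj₁ (often 0) , 0
  state (suc k) = step k (state k)

  pending : ℕ → ℕ
  pending k = proj₂ (state k)

  #forced : ℕ → ℕ
  #forced zero    = 0
  #forced (suc n) = #forced n ℕ.+ if0 (pending n) 0 1

  -- Inside a block at s, j of its forced digits lie before n, `suc r` are still to come, and the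
  -- forced digits of earlier blocks weigh at most s, each counted W times. In a free stretch the
  -- forced digits so far weigh at most t, which takes the role of s when the block at t opens.
  data Phase (n u : ℕ) : ℕ × ℕ → Set where
    free  : ∀ {t} → n ℕ.≤ t → W ℕ.* u ℕ.≤ t → W ℕ.* u ℕ.≤ Q ℕ.* (g ℕ.* n) ℕ.+ n → suc e ℕ.* ν t ℕ.≤ g ℕ.* suc t → Phase n u (t , 0)
    block : ∀ s j {r} → n ≡ suc s ℕ.+ j → suc (j ℕ.+ suc r) ≡ ν s → W ℕ.* u ℕ.≤ s ℕ.+ W ℕ.* j →
      suc e ℕ.* ν s ℕ.≤ g ℕ.* suc s → Phase n u (next s , suc r)

  1≤W : 1 ℕ.≤ W
  1≤W = ℕ.s≤s ℕ.z≤n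

  -- W j = Q (E j + g j) and E j ≤ g (s + 1), so the block itself accounts for Q g (s + 1 + j); the
  -- remaining s is absorbed by the error term.
  forced-in-block : ∀ s j r u → suc (j ℕ.+ r) ≡ ν s → W ℕ.* u ℕ.≤ s ℕ.+ W ℕ.* j → suc e ℕ.* ν s ℕ.≤ g ℕ.* suc s →
    W ℕ.* u ℕ.≤ Q ℕ.* (g ℕ.* (suc s ℕ.+ j)) ℕ.+ (suc s ℕ.+ j)
  forced-in-block s j r u len few short = begin
    W ℕ.* u                                                    ≤⟨ few ⟩
    s ℕ.+ W ℕ.* j                                              ≡⟨ split s Q (suc e) g j ⟩
    Q ℕ.* (suc e ℕ.* j ℕ.+ g ℕ.* j) ℕ.+ s                      ≤⟨ ℕₚ.+-mono-≤ (ℕₚ.*-monoʳ-≤ Q (ℕₚ.+-monoˡ-≤ (g ℕ.* j) ej≤)) (ℕₚ.≤-trans (ℕₚ.n≤1+n s) (ℕₚ.m≤m+n (suc s) j)) ⟩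
    Q ℕ.* (g ℕ.* suc s ℕ.+ g ℕ.* j) ℕ.+ (suc s ℕ.+ j)          ≡⟨ cong (λ x → Q ℕ.* x ℕ.+ (suc s ℕ.+ j)) (ℕₚ.*-distribˡ-+ g (suc s) j) ⟨
    Q ℕ.* (g ℕ.* (suc s ℕ.+ j)) ℕ.+ (suc s ℕ.+ j)              ∎
    where
    open ℕₚ.≤-Reasoning
    split : ∀ s Q E g j → s ℕ.+ Q ℕ.* (E ℕ.+ g) ℕ.* j ≡ Q ℕ.* (E ℕ.* j ℕ.+ g ℕ.* j) ℕ.+ s
    split = solve-∀
    ej≤ : suc e ℕ.* j ℕ.≤ g ℕ.* suc s
    ej≤ = ℕₚ.≤-trans (ℕₚ.*-monoʳ-≤ (suc e) (ℕₚ.≤-trans (ℕₚ.≤-trans (ℕₚ.m≤m+n j r) (ℕₚ.n≤1+n (j ℕ.+ r))) (ℕₚ.≤-reflexive len))) short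

  -- At r = 0 the block is over, at once if ν s = 1. As `next s` is at least W times its end, all
  -- forced digits so far weigh at most the start of the next block.
  settle : ∀ s j r u → suc (j ℕ.+ r) ≡ ν s → W ℕ.* u ℕ.≤ s ℕ.+ W ℕ.* j → suc e ℕ.* ν s ℕ.≤ g ℕ.* suc s →
    Phase (suc s ℕ.+ j) u (next s , r)
  settle s j zero u len few short = free n≤ (ℕₚ.≤-trans few (ℕₚ.≤-trans s+Wj≤ W*≤))
    (forced-in-block s j 0 u len few short) (proj₂ (proj₂ (often (W ℕ.* (s ℕ.+ ν s)))))
    where
    W*≤ : W ℕ.* (s ℕ.+ ν s) ℕ.≤ next s
    W*≤ = proj₁ (proj₂ (often (W ℕ.* (s ℕ.+ ν s))))
    n≡ : suc s ℕ.+ j ≡ s ℕ.+ ν s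
    n≡ = trans (sym (ℕₚ.+-suc s j)) (cong (s ℕ.+_) (trans (cong suc (sym (ℕₚ.+-identityʳ j))) len))
    m≤W*m : ∀ m → m ℕ.≤ W ℕ.* m
    m≤W*m m = ℕₚ.≤-trans (ℕₚ.≤-reflexive (sym (ℕₚ.*-identityˡ m))) (ℕₚ.*-monoˡ-≤ m 1≤W)
    n≤ : suc s ℕ.+ j ℕ.≤ next s
    n≤ = ℕₚ.≤-trans (ℕₚ.≤-reflexive n≡) (ℕₚ.≤-trans (m≤W*m (s ℕ.+ ν s)) W*≤)
    s+Wj≤ : s ℕ.+ W ℕ.* j ℕ.≤ W ℕ.* (s ℕ.+ ν s)
    s+Wj≤ = ℕₚ.≤-trans (ℕₚ.+-mono-≤ (m≤W*m s) (ℕₚ.*-monoʳ-≤ W (ℕₚ.≤-trans (ℕₚ.≤-trans (ℕₚ.m≤m+n j 0) (ℕₚ.n≤1+n (j ℕ.+ 0))) (ℕₚ.≤-reflexive len))))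
      (ℕₚ.≤-reflexive (sym (ℕₚ.*-distribˡ-+ W s (ν s))))
  settle s j (suc r) u len few short = block s j refl len few short

  phase-step : ∀ n u q → Phase n u q → Phase (suc n) (u ℕ.+ if0 (proj₂ q) 0 1) (step n q)
  phase-step n u .(t , 0) (free {t} n≤t few few′ short) = enter-phase (n ℕₚ.≟ t)
    where
    u+0 = sym (ℕₚ.+-identityʳ u)
    enter-phase : (d : Dec (n ≡ t)) → Phase (suc n) (u ℕ.+ 0) (enter n t d)
    enter-phase (yes refl) = subst₂ (λ m v → Phase m v (next n , ℕ.pred (ν n))) (ℕₚ.+-identityʳ (suc n)) u+0
      (settle n 0 (ℕ.pred (ν n)) u (ℕₚ.suc-pred (ν n) {{ℕ.>-nonZero (ν≥1 n)}}) (ℕₚ.≤-trans few (ℕₚ.m≤m+n n (W ℕ.* 0))) short)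
    enter-phase (no n≢t) = subst (λ v → Phase (suc n) v (t , 0)) u+0 (free (ℕₚ.≤∧≢⇒< n≤t n≢t) few
      (ℕₚ.≤-trans few′ (ℕₚ.+-mono-≤ (ℕₚ.*-monoʳ-≤ Q (ℕₚ.*-monoʳ-≤ g (ℕₚ.n≤1+n n))) (ℕₚ.n≤1+n n))) short)
  phase-step .(suc s ℕ.+ j) u .(next s , suc r) (block s j {r} refl len few short) =
    subst₂ (λ m v → Phase m v (next s , r)) (ℕₚ.+-suc (suc s) j) (ℕₚ.+-comm 1 u)
      (settle s (suc j) r (suc u) (trans (cong suc (sym (ℕₚ.+-suc j r))) len) (more W s j u few) short)
    where
    more : ∀ W s j u → W ℕ.* u ℕ.≤ s ℕ.+ W ℕ.* j → W ℕ.* suc u ℕ.≤ s ℕ.+ W ℕ.* suc j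
    more W s j u h = subst₂ ℕ._≤_ (sym (ℕₚ.*-suc W u)) (trans (swap W s (W ℕ.* j)) (cong (s ℕ.+_) (sym (ℕₚ.*-suc W j)))) (ℕₚ.+-monoʳ-≤ W h)
      where
      swap : ∀ a b c → a ℕ.+ (b ℕ.+ c) ≡ b ℕ.+ (a ℕ.+ c)
      swap = solve-∀

  phase : ∀ n → Phase n (#forced n) (state n)
  phase zero = free ℕ.z≤n W0 W0′ (proj₂ (proj₂ (often 0)))
    where
    W0 : W ℕ.* 0 ℕ.≤ proj₁ (often 0)
    W0 = subst (ℕ._≤ proj₁ (often 0)) (sym (ℕₚ.*-zeroʳ W)) ℕ.z≤n
    W0′ : W ℕ.* 0 ℕ.≤ Q ℕ.* (g ℕ.* 0) ℕ.+ 0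
    W0′ = subst (ℕ._≤ Q ℕ.* (g ℕ.* 0) ℕ.+ 0) (sym (ℕₚ.*-zeroʳ W)) ℕ.z≤n
  phase (suc n) = phase-step n (#forced n) (state n) (phase n)

  #forced≤ : ∀ n → W ℕ.* #forced n ℕ.≤ Q ℕ.* (g ℕ.* n) ℕ.+ n
  #forced≤ n = go (phase n)
    where
    go : ∀ {q} → Phase n (#forced n) q → W ℕ.* #forced n ℕ.≤ Q ℕ.* (g ℕ.* n) ℕ.+ n
    go (free _ _ h _) = h
    go (block s j {r} n≡ len few short) = subst (λ m → W ℕ.* #forced n ℕ.≤ Q ℕ.* (g ℕ.* m) ℕ.+ m) (sym n≡)
      (forced-in-block s j (suc r) (#forced n) len few short)

  block-run : ∀ s → state s ≡ (s , 0) → ∀ j → j ℕ.< ν s → state (suc s ℕ.+ j) ≡ (next s , ν s ℕ.∸ suc j)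
  block-run s eq zero _ = trans (cong state (ℕₚ.+-identityʳ (suc s))) (trans (cong (step s) eq) (entered (s ℕₚ.≟ s)))
    where
    entered : (d : Dec (s ≡ s)) → enter s s d ≡ (next s , ν s ℕ.∸ 1)
    entered (yes _) = refl
    entered (no s≢s) = ⊥-elim (s≢s refl)
  block-run s eq (suc j) j< = trans (cong state (ℕₚ.+-suc (suc s) j))
    (trans (cong (step (suc s ℕ.+ j)) (trans (block-run s eq j (ℕₚ.<-trans (ℕₚ.n<1+n j) j<)) (cong (next s ,_) (ℕₚ.+-∸-assoc 1 j<)))) refl)

  block-forced : ∀ s → state s ≡ (s , 0) → ∀ j → suc j ℕ.< ν s → ∃ λ r → pending (suc s ℕ.+ j) ≡ suc r
  block-forced s eq j j< = ν s ℕ.∸ suc (suc j) , trans (cong proj₂ (block-run s eq j (ℕₚ.<-trans (ℕₚ.n<1+n j) j<))) (ℕₚ.+-∸-assoc 1 j<)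

  -- Two countdowns: first the pending digits, then the distance to the next start.
  block-starts : ∀ n → ∃ λ s → n ℕ.≤ s × state s ≡ (s , 0)
  block-starts n = wait (pending n) n refl
    where
    approach : ∀ d n t → state n ≡ (t , 0) → n ℕ.+ d ≡ t → ∃ λ s → n ℕ.≤ s × state s ≡ (s , 0)
    approach zero n t eq n+d≡t = n , ℕₚ.≤-refl , trans eq (cong (_, 0) (trans (sym n+d≡t) (ℕₚ.+-identityʳ n)))
    approach (suc d) n t eq n+d≡t =
      let s , n<s , eq′ = approach d (suc n) t (trans (cong (step n) eq) (passed (n ℕₚ.≟ t))) (trans (sym (ℕₚ.+-suc n d)) n+d≡t)
      in s , ℕₚ.<⇒≤ n<s , eq′
      where
      passed : (d : Dec (n ≡ t)) → enter n t d ≡ (t , 0)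
      passed (yes n≡t) = ⊥-elim (ℕₚ.m≢1+m+n n (trans n≡t (trans (sym n+d≡t) (ℕₚ.+-suc n d))))
      passed (no _) = refl
    wait : ∀ r n → pending n ≡ r → ∃ λ s → n ℕ.≤ s × state s ≡ (s , 0)
    wait zero n eq = go (phase n) refl eq
      where
      go : ∀ {q} → Phase n (#forced n) q → q ≡ state n → proj₂ (state n) ≡ 0 → ∃ λ s → n ℕ.≤ s × state s ≡ (s , 0)
      go (free {t} n≤t _ _ _) q≡ _ = approach (t ℕ.∸ n) n t (sym q≡) (ℕₚ.m+[n∸m]≡n n≤t)
      go (block s j _ _ _ _) q≡ eq with trans (cong proj₂ q≡) eq
      ... | ()
    wait (suc r) n eq = let s , n<s , eq′ = wait r (suc n) (descend (state n) eq) in s , ℕₚ.<⇒≤ n<s , eq′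
      where
      descend : ∀ q → proj₂ q ≡ suc r → proj₂ (step n q) ≡ r
      descend (t , suc r′) refl = refl

  lgFree : ℕ → ℕ
  lgFree zero    = 0
  lgFree (suc n) = lgFree n ℕ.+ if0 (pending n) (lg n) 0

  -- Each forced position drops one logarithm; by monotonicity all earlier losses may be charged at
  -- the present value.
  ∑lg≤ : ∀ n → ∑ℕ lg n ℕ.≤ lgFree n ℕ.+ #forced n ℕ.* lg n
  ∑lg≤ zero = ℕ.z≤n
  ∑lg≤ (suc n) = go (pending n)
    where
    open ℕₚ.≤-Reasoning
    u = #forced n
    lg≤ : lg n ℕ.≤ lg (suc n)
    lg≤ = proj₁ (lg-step n)
    go : ∀ r → ∑ℕ lg n ℕ.+ lg n ℕ.≤ (lgFree n ℕ.+ if0 r (lg n) 0) ℕ.+ (u ℕ.+ if0 r 0 1) ℕ.* lg (suc n)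
    go zero = begin
      ∑ℕ lg n ℕ.+ lg n                                       ≤⟨ ℕₚ.+-monoˡ-≤ (lg n) (∑lg≤ n) ⟩
      (lgFree n ℕ.+ u ℕ.* lg n) ℕ.+ lg n                     ≤⟨ ℕₚ.+-monoˡ-≤ (lg n) (ℕₚ.+-monoʳ-≤ (lgFree n) (ℕₚ.*-monoʳ-≤ u lg≤)) ⟩
      (lgFree n ℕ.+ u ℕ.* lg (suc n)) ℕ.+ lg n               ≡⟨ regroup (lgFree n) u (lg (suc n)) (lg n) ⟩
      (lgFree n ℕ.+ lg n) ℕ.+ (u ℕ.+ 0) ℕ.* lg (suc n)       ∎
      where
      regroup : ∀ a u l m → (a ℕ.+ u ℕ.* l) ℕ.+ m ≡ (a ℕ.+ m) ℕ.+ (u ℕ.+ 0) ℕ.* l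
      regroup = solve-∀
    go (suc r) = begin
      ∑ℕ lg n ℕ.+ lg n                                       ≤⟨ ℕₚ.+-mono-≤ (ℕₚ.≤-trans (∑lg≤ n) (ℕₚ.+-monoʳ-≤ (lgFree n) (ℕₚ.*-monoʳ-≤ u lg≤))) lg≤ ⟩
      (lgFree n ℕ.+ u ℕ.* lg (suc n)) ℕ.+ lg (suc n)         ≡⟨ regroup (lgFree n) u (lg (suc n)) ⟩
      (lgFree n ℕ.+ 0) ℕ.+ (u ℕ.+ 1) ℕ.* lg (suc n)          ∎
      where
      regroup : ∀ a u l → (a ℕ.+ u ℕ.* l) ℕ.+ l ≡ (a ℕ.+ 0) ℕ.+ (u ℕ.+ 1) ℕ.* l
      regroup = solve-∀

∑ℕ-bound : ∀ {t} → (∀ {j k} → j ℕ.≤ k → t j ℕ.≤ t k) → ∀ n → ∑ℕ t (suc n) ℕ.≤ suc n ℕ.* t n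
∑ℕ-bound {t} mono n = go (suc n) λ j j<1+n → mono (ℕₚ.≤-pred j<1+n)
  where
  go : ∀ m → (∀ j → j ℕ.< m → t j ℕ.≤ t n) → ∑ℕ t m ℕ.≤ m ℕ.* t n
  go zero h = ℕ.z≤n
  go (suc m) h = subst (∑ℕ t m ℕ.+ t m ℕ.≤_) (ℕₚ.+-comm (m ℕ.* t n) (t n))
    (ℕₚ.+-mono-≤ (go m λ j j<m → h j (ℕₚ.m<n⇒m<1+n j<m)) (h m ℕₚ.≤-refl))

-- Sequences with a free digit at k in [(k + 1) 2^{K lg k}, (k + 2) 2^{K lg k}), so that a share K / (K + 1) of the
-- size of the digit is choice; forced digits continue an arithmetic progression of difference 1.
module CantorSet (ν : ℕ → ℕ) (ν≥1 : ∀ k → 1 ℕ.≤ ν k) (Q′ e g K : ℕ)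
  (often : ∀ M → ∃ λ N → M ℕ.≤ N × suc e ℕ.* ν N ℕ.≤ g ℕ.* suc N) where

  open Schedule ν ν≥1 Q′ e g often public

  scale : ℕ → ℕ
  scale k = 2 ℕ.^ (K ℕ.* lg k)

  1≤scale : ∀ k → 1 ℕ.≤ scale k
  1≤scale k = ℕₚ.m^n>0 2 (K ℕ.* lg k)

  scale-mono : ∀ k → scale k ℕ.≤ scale (suc k)
  scale-mono k = ℕₚ.^-monoʳ-≤ 2 (ℕₚ.*-monoʳ-≤ K (proj₁ (lg-step k)))

  branches : ℕ → ℕ
  branches k = if0 (pending k) (scale k) 1

  branches≥1 : ∀ k → 1 ℕ.≤ branches k
  branches≥1 k = go (pending k)
    where
    go : ∀ r → 1 ℕ.≤ if0 r (scale k) 1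
    go zero = 1≤scale k
    go (suc _) = ℕₚ.≤-refl

  open Tree branches branches≥1 public

  digit : (ℕ → ℕ) → ℕ → ℕ
  -- Position 0 is free for every schedule, because `state zero` has nothing pending.
  digit b zero    = 1 ℕ.* scale 0 ℕ.+ b 0
  digit b (suc k) = if0 (pending (suc k)) (suc (suc k) ℕ.* scale (suc k) ℕ.+ b (suc k)) (suc (digit b k))

  digit-upper : ∀ {b} → Valid b → ∀ k → digit b k ℕ.< suc (suc k) ℕ.* scale k
  digit-upper {b} valid zero = subst (1 ℕ.* scale 0 ℕ.+ b 0 ℕ.<_) (ℕₚ.+-comm (1 ℕ.* scale 0) (scale 0)) (ℕₚ.+-monoʳ-< (1 ℕ.* scale 0) (valid 0))
  digit-upper {b} valid (suc k) = go (pending (suc k)) (valid (suc k))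
    where
    P = scale (suc k)
    go : ∀ r → b (suc k) ℕ.< if0 r P 1 → if0 r (suc (suc k) ℕ.* P ℕ.+ b (suc k)) (suc (digit b k)) ℕ.< suc (suc (suc k)) ℕ.* P
    go zero b< = subst (suc (suc k) ℕ.* P ℕ.+ b (suc k) ℕ.<_) (ℕₚ.+-comm (suc (suc k) ℕ.* P) P) (ℕₚ.+-monoʳ-< (suc (suc k) ℕ.* P) b<)
    go (suc _) _ = ℕₚ.+-mono-≤ (1≤scale (suc k)) (ℕₚ.≤-trans (digit-upper valid k) (ℕₚ.*-monoʳ-≤ (suc (suc k)) (scale-mono k)))

  digit-increasing : ∀ {b} → Valid b → StrictlyIncreasing (digit b)
  digit-increasing {b} valid k = go (pending (suc k))
    where
    go : ∀ r → digit b k ℕ.< if0 r (suc (suc k) ℕ.* scale (suc k) ℕ.+ b (suc k)) (suc (digit b k))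
    go zero = ℕₚ.<-≤-trans (digit-upper valid k) (ℕₚ.≤-trans (ℕₚ.*-monoʳ-≤ (suc (suc k)) (scale-mono k)) (ℕₚ.m≤m+n _ (b (suc k))))
    go (suc _) = ℕₚ.≤-refl

  digit-positive : ∀ {b} → Valid b → Positive (digit b)
  digit-positive {b} valid zero = ℕₚ.≤-trans (ℕₚ.*-mono-≤ (ℕₚ.≤-refl {1}) (1≤scale 0)) (ℕₚ.m≤m+n (1 ℕ.* scale 0) (b 0))
  digit-positive valid (suc k) = ℕₚ.≤-<-trans ℕ.z≤n (digit-increasing valid k)

  -- The logarithm of a power of two above the digit at k: 1 + lg k for the factor k + 2, and K lg k
  -- for the scale.
  height : ℕ → ℕ
  height k = suc (lg k) ℕ.+ K ℕ.* lg k

  digit<2^height : ∀ {b} → Valid b → ∀ k → digit b k ℕ.< 2 ℕ.^ height k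
  digit<2^height valid k = ℕₚ.<-≤-trans (digit-upper valid k)
    (ℕₚ.≤-trans (ℕₚ.*-monoˡ-≤ (scale k) (1+k<2^1+lg k)) (ℕₚ.≤-reflexive (sym (ℕₚ.^-distribˡ-+-* 2 (suc (lg k)) (K ℕ.* lg k)))))

  height-mono : ∀ {j k} → j ℕ.≤ k → height j ℕ.≤ height k
  height-mono j≤k = ℕₚ.+-mono-≤ (ℕ.s≤s (lg-mono j≤k)) (ℕₚ.*-monoʳ-≤ K (lg-mono j≤k))

  digit-cong : ∀ {b c} k → (∀ j → j ℕ.≤ k → b j ≡ c j) → digit b k ≡ digit c k
  digit-cong zero h = cong (1 ℕ.* scale 0 ℕ.+_) (h 0 ℕₚ.≤-refl)
  digit-cong (suc k) h = cong₂ (if0 (pending (suc k))) (cong (suc (suc k) ℕ.* scale (suc k) ℕ.+_) (h (suc k) ℕₚ.≤-refl))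
    (cong suc (digit-cong k λ j j≤k → h j (ℕₚ.m≤n⇒m≤1+n j≤k)))

  digit-injective : ∀ {b c} → Valid b → Valid c → ∀ k → digit b k ≡ digit c k → b k ≡ c k
  digit-injective {b} {c} _ _ zero eq = ℕₚ.+-cancelˡ-≡ (1 ℕ.* scale 0) (b 0) (c 0) eq
  digit-injective {b} {c} vb vc (suc k) = go (pending (suc k)) (vb (suc k)) (vc (suc k))
    where
    P = suc (suc k) ℕ.* scale (suc k)
    <1 : ∀ {n} → n ℕ.< 1 → n ≡ 0
    <1 (ℕ.s≤s ℕ.z≤n) = refl
    go : ∀ r → b (suc k) ℕ.< if0 r (scale (suc k)) 1 → c (suc k) ℕ.< if0 r (scale (suc k)) 1 →
      if0 r (P ℕ.+ b (suc k)) (suc (digit b k)) ≡ if0 r (P ℕ.+ c (suc k)) (suc (digit c k)) → b (suc k) ≡ c (suc k)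
    go zero _ _ eq = ℕₚ.+-cancelˡ-≡ P (b (suc k)) (c (suc k)) eq
    -- A forced position has a single branch, so both choices are 0 whatever the digits are.
    go (suc _) b< c< _ = trans (<1 b<) (sym (<1 c<))

  μ≡ : ∀ n → μ n ≡ ½ ^ℚ (K ℕ.* lgFree n)
  μ≡ zero = cong (½ ^ℚ_) (sym (ℕₚ.*-zeroʳ K))
  μ≡ (suc n) = trans (cong₂ ℚ._*_ (go (pending n)) (μ≡ n)) (trans (sym (^-homo-* ½ (K ℕ.* if0 (pending n) (lg n) 0) (K ℕ.* lgFree n)))
    (cong (½ ^ℚ_) (trans (sym (ℕₚ.*-distribˡ-+ K (if0 (pending n) (lg n) 0) (lgFree n))) (cong (K ℕ.*_) (ℕₚ.+-comm (if0 (pending n) (lg n) 0) (lgFree n))))))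
    where
    go : ∀ r → inv (ι (if0 r (scale n) 1)) ≡ ½ ^ℚ (K ℕ.* if0 r (lg n) 0)
    go zero = inv-ι-2^ (K ℕ.* lg n)
    go (suc _) = trans (inv-ι-2^ 0) (cong (½ ^ℚ_) (sym (ℕₚ.*-zeroʳ K)))

  point : ∀ b → Valid b → ℝ
  point b valid = cf (digit-positive valid) (digit-increasing valid)

  -- Points that first differ at n are at least 2^(-gap n) apart; the successor is the factor 2 in
  -- `first-difference-far`.
  gap : ℕ → ℕ
  gap n = suc (2 ℕ.* ∑ℕ height (suc n))

  ∏²-2^ : ∀ t n → ∏² (λ k → 2 ℕ.^ t k) n ≡ 2 ℕ.^ (2 ℕ.* ∑ℕ t n)
  ∏²-2^ t zero = refl
  ∏²-2^ t (suc n) = trans (∏²-snoc (λ k → 2 ℕ.^ t k) n) (trans (cong₂ ℕ._*_ (∏²-2^ t n) (sym (ℕₚ.^-distribˡ-+-* 2 (t n) (t n))))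
    (trans (sym (ℕₚ.^-distribˡ-+-* 2 (2 ℕ.* ∑ℕ t n) (t n ℕ.+ t n))) (cong (2 ℕ.^_) (regroup (∑ℕ t n) (t n)))))
    where
    regroup : ∀ a b → 2 ℕ.* a ℕ.+ (b ℕ.+ b) ≡ 2 ℕ.* (a ℕ.+ b)
    regroup = solve-∀

  points-apart : ∀ {b c} (vb : Valid b) (vc : Valid c) n → (∀ j → j ℕ.< n → b j ≡ c j) → b n ≢ c n →
    fromℚ (½ ^ℚ gap n) ≤ ∣ point b vb - point c vc ∣
  points-apart {b} {c} vb vc n same b≢c = ≤-pointwise {fromℚ (½ ^ℚ gap n)} {∣ point b vb - point c vc ∣} (suc n) λ m n<m →
    *-cancelʳ-≤ G G>0 (ℚₚ.≤-trans (ℚₚ.≤-reflexive ½^*G) (subst (λ t → 1ℚ ℚ.≤ ℚ.∣ convergent (digit b) m ℚ.- convergent (digit c) m ∣ ℚ.* ι t) G≡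
      (first-difference-far n {H = λ k → 2 ℕ.^ height k} (digit-positive vb) (digit-positive vc) (2≤ vb) (2≤ vc) (digit<2^height vb) (digit<2^height vc)
        (λ j j<n → digit-cong j λ i i≤j → same i (ℕₚ.≤-<-trans i≤j j<n)) (λ eq → b≢c (digit-injective vb vc n eq)) m n<m)))
    where
    G = ι (2 ℕ.^ gap n)
    G>0 : 0ℚ ℚ.< G
    G>0 = ℚₚ.<-≤-trans 0<1 (1≤ι (ℕₚ.m^n>0 2 (gap n)))
    ½^*G : ½ ^ℚ gap n ℚ.* G ≡ 1ℚ
    ½^*G = trans (cong (ℚ._* G) (sym (inv-ι-2^ (gap n)))) (trans (ℚₚ.*-comm (inv G) G) (*inv G>0))
    G≡ : 2 ℕ.* ∏² (λ k → 2 ℕ.^ height k) (suc n) ≡ 2 ℕ.^ gap n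
    G≡ = cong (2 ℕ.*_) (∏²-2^ height (suc n))
    2≤ : ∀ {b} → Valid b → ∀ k → 2 ℕ.≤ digit b (suc k)
    2≤ vb k = ℕₚ.<-≤-trans (ℕ.s≤s (digit-positive vb k)) (digit-increasing vb k)

  point∈F : ∀ {b} (valid : Valid b) → F ν (point b valid)
  point∈F {b} valid = cf∈J (digit-positive valid) (digit-increasing valid) , digit b ,
    cf-quotients (digit-positive valid) (digit-increasing valid) , λ { (i , never) →
      let s , i≤s , start = block-starts i in never s i≤s (+ 1 , λ j j<ν → trans (cong +_ (progression s start j j<ν))
        (cong (λ x → + digit b s ℤ.+ x) (sym (ℤₚ.*-identityʳ (+ j))))) }
    where
    progression : ∀ s → state s ≡ (s , 0) → ∀ j → j ℕ.< ν s → digit b (s ℕ.+ j) ≡ digit b s ℕ.+ j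
    progression s start zero _ = trans (cong (digit b) (ℕₚ.+-identityʳ s)) (sym (ℕₚ.+-identityʳ (digit b s)))
    progression s start (suc j) j<ν = let r , eq = block-forced s start j j<ν in
      trans (cong (digit b) (ℕₚ.+-suc s j)) (trans (cong (λ r → if0 r (suc (suc (s ℕ.+ j)) ℕ.* scale (suc (s ℕ.+ j)) ℕ.+ b (suc (s ℕ.+ j))) (suc (digit b (s ℕ.+ j)))) eq)
        (trans (cong suc (progression s start j (ℕₚ.<-trans (ℕₚ.n<1+n j) j<ν))) (sym (ℕₚ.+-suc (digit b s) j))))

abstract
  -- All terms on the left are at most C n with n = m + 1. If lg m ≥ C, then n lg m suffices;
  -- otherwise n is at most 2^C, up to the boundary case lg m = C, and the constant X suffices.
  linear≤n*lg : ∀ C₁ C₂ C₃ → ∃ λ X → ∀ m → C₁ ℕ.* suc m ℕ.+ C₂ ℕ.* lg m ℕ.+ C₃ ℕ.≤ suc m ℕ.* lg m ℕ.+ X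
  linear≤n*lg C₁ C₂ C₃ = C ℕ.* 2 ℕ.^ C , λ m → ℕₚ.≤-trans (crude m) (split m (ℕₚ.≤-total C (lg m)))
    where
    C : ℕ
    C = C₁ ℕ.+ C₂ ℕ.+ C₃
    crude : ∀ m → C₁ ℕ.* suc m ℕ.+ C₂ ℕ.* lg m ℕ.+ C₃ ℕ.≤ C ℕ.* suc m
    crude m = ℕₚ.≤-trans (ℕₚ.+-mono-≤ (ℕₚ.+-monoʳ-≤ (C₁ ℕ.* suc m) (ℕₚ.*-monoʳ-≤ C₂ (ℕₚ.≤-trans (ℕₚ.<⇒≤ (n<2^n (lg m))) (2^lg≤1+k m)))) (ℕₚ.m≤m*n C₃ (suc m)))
      (ℕₚ.≤-reflexive (regroup C₁ C₂ C₃ (suc m)))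
      where
      regroup : ∀ a b c n → a ℕ.* n ℕ.+ b ℕ.* n ℕ.+ c ℕ.* n ≡ (a ℕ.+ b ℕ.+ c) ℕ.* n
      regroup = solve-∀
    split : ∀ m → C ℕ.≤ lg m ⊎ lg m ℕ.≤ C → C ℕ.* suc m ℕ.≤ suc m ℕ.* lg m ℕ.+ C ℕ.* 2 ℕ.^ C
    split m (inj₁ C≤) = ℕₚ.≤-trans (ℕₚ.*-monoˡ-≤ (suc m) C≤) (ℕₚ.≤-trans (ℕₚ.≤-reflexive (ℕₚ.*-comm (lg m) (suc m))) (ℕₚ.m≤m+n _ _))
    split m (inj₂ lg≤) with suc m ℕₚ.≤? 2 ℕ.^ C
    ... | yes n≤ = ℕₚ.≤-trans (ℕₚ.*-monoʳ-≤ C n≤) (ℕₚ.m≤n+m (C ℕ.* 2 ℕ.^ C) (suc m ℕ.* lg m))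
    ... | no n≰ = ℕₚ.≤-trans (ℕₚ.≤-reflexive (trans (ℕₚ.*-comm C (suc m)) (cong (suc m ℕ.*_) (ℕₚ.≤-antisym (≤-lg {C} {m} (ℕₚ.<⇒≤ (ℕₚ.≰⇒> n≰))) lg≤)))) (ℕₚ.m≤m+n _ _)

module Criterion (ν : ℕ → ℕ) (ν≥1 : ∀ k → 1 ℕ.≤ ν k) (q′ p e g : ℕ) (exponents : 2 ℕ.* (suc e ℕ.+ g) ℕ.* p ℕ.< suc e ℕ.* suc q′)
  (often : ∀ M → ∃ λ N → M ℕ.≤ N × suc e ℕ.* ν N ℕ.≤ g ℕ.* suc N) where

  -- Put y = 2 (E + g) p, so that `exponents` reads y + 1 ≤ E q. The choice K = y + 1 makes y (K +
  -- 1) + 1 the square K², whence (E + g) `cost` = y (K + 1) < E q K = E A. This is where a large K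
  -- outweighs the factor n in the size of a digit, which carries no choice.
  q E K A : ℕ
  q = suc q′
  E = suc e
  K = suc (2 ℕ.* (E ℕ.+ g) ℕ.* p)
  A = q ℕ.* K

  open CantorSet ν ν≥1 A e g K often public

  private
    cost : ℕ
    cost = 2 ℕ.* p ℕ.* suc K

    E*A : suc ((E ℕ.+ g) ℕ.* cost) ℕ.≤ E ℕ.* A
    E*A = ℕₚ.≤-trans (ℕₚ.≤-reflexive (regroup (E ℕ.+ g) p))
      (ℕₚ.≤-trans (ℕₚ.*-monoˡ-≤ K exponents) (ℕₚ.≤-reflexive (ℕₚ.*-assoc E q K)))
      where
      regroup : ∀ x p → suc (x ℕ.* (2 ℕ.* p ℕ.* suc (suc (2 ℕ.* x ℕ.* p)))) ≡ suc (2 ℕ.* x ℕ.* p) ℕ.* suc (2 ℕ.* x ℕ.* p)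
      regroup = solve-∀

    C₁ C₂ C₃ : ℕ
    C₁ = A ℕ.* (Q ℕ.* g ℕ.+ 1 ℕ.+ 2 ℕ.* W) ℕ.+ W ℕ.* (2 ℕ.* p ℕ.* suc (suc K))
    C₂ = W ℕ.* cost
    C₃ = W ℕ.* (2 ℕ.* p ℕ.* suc (suc K) ℕ.+ p)

    -- Multiply the first hypothesis by A W and insert the second. As W - Q g = Q E, the forced
    -- digits leave Q E A n L on the left, at least (W `cost` + Q) n L by `E*A`. Their error 1 / W
    -- costs A n L, and Q = A + 1 keeps one n L to absorb every linear term. Subtractions are
    -- avoided by adding the same terms to both sides.
    combine : ∀ n L u S → n ℕ.* L ℕ.≤ S ℕ.+ u ℕ.* suc L ℕ.+ 2 ℕ.* n → W ℕ.* u ℕ.≤ Q ℕ.* (g ℕ.* n) ℕ.+ n →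
      W ℕ.* (cost ℕ.* (n ℕ.* L)) ℕ.+ n ℕ.* L ℕ.≤ W ℕ.* (A ℕ.* S) ℕ.+ A ℕ.* (Q ℕ.* g ℕ.+ 1 ℕ.+ 2 ℕ.* W) ℕ.* n
    combine n L u S h₁ h₂ = ℕₚ.+-cancelʳ-≤ (A ℕ.* (n ℕ.* L) ℕ.+ A ℕ.* (Q ℕ.* g) ℕ.* (n ℕ.* L)) _ _ (begin
      (W ℕ.* (cost ℕ.* (n ℕ.* L)) ℕ.+ n ℕ.* L) ℕ.+ (A ℕ.* (n ℕ.* L) ℕ.+ A ℕ.* (Q ℕ.* g) ℕ.* (n ℕ.* L))
        ≡⟨ lhs A E g cost (n ℕ.* L) ⟩
      Q ℕ.* suc ((E ℕ.+ g) ℕ.* cost) ℕ.* (n ℕ.* L) ℕ.+ A ℕ.* (Q ℕ.* g) ℕ.* (n ℕ.* L)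
        ≤⟨ ℕₚ.+-monoˡ-≤ _ (ℕₚ.*-monoˡ-≤ (n ℕ.* L) (ℕₚ.*-monoʳ-≤ Q E*A)) ⟩
      Q ℕ.* (E ℕ.* A) ℕ.* (n ℕ.* L) ℕ.+ A ℕ.* (Q ℕ.* g) ℕ.* (n ℕ.* L)
        ≡⟨ mid A Q E g (n ℕ.* L) ⟩
      A ℕ.* W ℕ.* (n ℕ.* L)
        ≤⟨ ℕₚ.*-monoʳ-≤ (A ℕ.* W) h₁ ⟩
      A ℕ.* W ℕ.* (S ℕ.+ u ℕ.* suc L ℕ.+ 2 ℕ.* n)
        ≡⟨ expand A W S u L n ⟩
      W ℕ.* (A ℕ.* S) ℕ.+ A ℕ.* (W ℕ.* u ℕ.* suc L) ℕ.+ A ℕ.* (2 ℕ.* W) ℕ.* n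
        ≤⟨ ℕₚ.+-monoˡ-≤ _ (ℕₚ.+-monoʳ-≤ (W ℕ.* (A ℕ.* S)) (ℕₚ.*-monoʳ-≤ A (ℕₚ.*-monoˡ-≤ (suc L) h₂))) ⟩
      W ℕ.* (A ℕ.* S) ℕ.+ A ℕ.* ((Q ℕ.* (g ℕ.* n) ℕ.+ n) ℕ.* suc L) ℕ.+ A ℕ.* (2 ℕ.* W) ℕ.* n
        ≡⟨ rhs A Q g W S L n ⟩
      (W ℕ.* (A ℕ.* S) ℕ.+ A ℕ.* (Q ℕ.* g ℕ.+ 1 ℕ.+ 2 ℕ.* W) ℕ.* n) ℕ.+ (A ℕ.* (n ℕ.* L) ℕ.+ A ℕ.* (Q ℕ.* g) ℕ.* (n ℕ.* L)) ∎)
      where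
      open ℕₚ.≤-Reasoning
      lhs : ∀ A E g c x → (suc A ℕ.* (E ℕ.+ g) ℕ.* (c ℕ.* x) ℕ.+ x) ℕ.+ (A ℕ.* x ℕ.+ A ℕ.* (suc A ℕ.* g) ℕ.* x) ≡
        suc A ℕ.* suc ((E ℕ.+ g) ℕ.* c) ℕ.* x ℕ.+ A ℕ.* (suc A ℕ.* g) ℕ.* x
      lhs = solve-∀
      mid : ∀ A Q E g x → Q ℕ.* (E ℕ.* A) ℕ.* x ℕ.+ A ℕ.* (Q ℕ.* g) ℕ.* x ≡ A ℕ.* (Q ℕ.* (E ℕ.+ g)) ℕ.* x
      mid = solve-∀
      expand : ∀ A W S u L n → A ℕ.* W ℕ.* (S ℕ.+ u ℕ.* suc L ℕ.+ 2 ℕ.* n) ≡ W ℕ.* (A ℕ.* S) ℕ.+ A ℕ.* (W ℕ.* u ℕ.* suc L) ℕ.+ A ℕ.* (2 ℕ.* W) ℕ.* n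
      expand = solve-∀
      rhs : ∀ A Q g W S L n → W ℕ.* (A ℕ.* S) ℕ.+ A ℕ.* ((Q ℕ.* (g ℕ.* n) ℕ.+ n) ℕ.* suc L) ℕ.+ A ℕ.* (2 ℕ.* W) ℕ.* n ≡
        (W ℕ.* (A ℕ.* S) ℕ.+ A ℕ.* (Q ℕ.* g ℕ.+ 1 ℕ.+ 2 ℕ.* W) ℕ.* n) ℕ.+ (A ℕ.* (n ℕ.* L) ℕ.+ A ℕ.* (Q ℕ.* g) ℕ.* (n ℕ.* L))
      rhs = solve-∀

    X : ℕ
    X = proj₁ (linear≤n*lg C₁ C₂ C₃)

    gap-bound : ∀ m → p ℕ.* gap (suc m) ℕ.≤ cost ℕ.* (suc m ℕ.* lg m) ℕ.+ (2 ℕ.* p ℕ.* suc (suc K) ℕ.* suc m ℕ.+ cost ℕ.* lg m ℕ.+ (2 ℕ.* p ℕ.* suc (suc K) ℕ.+ p))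
    gap-bound m = ℕₚ.≤-trans (ℕₚ.*-monoʳ-≤ p (ℕ.s≤s (ℕₚ.*-monoʳ-≤ 2 (ℕₚ.≤-trans (∑ℕ-bound height-mono (suc m)) (ℕₚ.*-monoʳ-≤ (suc (suc m)) height≤)))))
      (ℕₚ.≤-reflexive (regroup p K m (lg m)))
      where
      height≤ : height (suc m) ℕ.≤ suc (suc (lg m)) ℕ.+ K ℕ.* suc (lg m)
      height≤ = ℕₚ.+-mono-≤ (ℕ.s≤s (proj₂ (lg-step m))) (ℕₚ.*-monoʳ-≤ K (proj₂ (lg-step m)))
      regroup : ∀ p K m L → p ℕ.* suc (2 ℕ.* (suc (suc m) ℕ.* (suc (suc L) ℕ.+ K ℕ.* suc L))) ≡
        2 ℕ.* p ℕ.* suc K ℕ.* (suc m ℕ.* L) ℕ.+ (2 ℕ.* p ℕ.* suc (suc K) ℕ.* suc m ℕ.+ 2 ℕ.* p ℕ.* suc K ℕ.* L ℕ.+ (2 ℕ.* p ℕ.* suc (suc K) ℕ.+ p))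
      regroup = solve-∀

  offset : ℕ
  -- X takes up the linear terms for n ≥ 1; the second summand settles n = 0, where `lgFree`
  -- vanishes.
  offset = X ℕ.+ p ℕ.* gap 0

  -- μ n is at most 2^offset times the (p / q)-th power of the least distance 2^{-gap n}.
  criterion : ∀ n → p ℕ.* gap n ℕ.≤ q ℕ.* (offset ℕ.+ K ℕ.* lgFree n)
  criterion zero = ℕₚ.≤-trans (ℕₚ.m≤n+m (p ℕ.* gap 0) X) (ℕₚ.≤-trans (ℕₚ.m≤m+n offset (K ℕ.* 0)) (ℕₚ.m≤n*m (offset ℕ.+ K ℕ.* 0) q))
  criterion (suc m) = ℕₚ.*-cancelˡ-≤ W (ℕₚ.+-cancelʳ-≤ (n ℕ.* L) _ _ (begin
    W ℕ.* (p ℕ.* gap n) ℕ.+ n ℕ.* L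
      ≤⟨ ℕₚ.+-monoˡ-≤ (n ℕ.* L) (ℕₚ.*-monoʳ-≤ W (gap-bound m)) ⟩
    W ℕ.* (cost ℕ.* (n ℕ.* L) ℕ.+ (c ℕ.* n ℕ.+ cost ℕ.* L ℕ.+ (c ℕ.+ p))) ℕ.+ n ℕ.* L
      ≡⟨ regroup₁ W cost (n ℕ.* L) c n L p ⟩
    (W ℕ.* (cost ℕ.* (n ℕ.* L)) ℕ.+ n ℕ.* L) ℕ.+ (W ℕ.* c ℕ.* n ℕ.+ C₂ ℕ.* L ℕ.+ C₃)
      ≤⟨ ℕₚ.+-monoˡ-≤ _ (combine n L (#forced n) (lgFree n) nL≤ (#forced≤ n)) ⟩
    (W ℕ.* (A ℕ.* lgFree n) ℕ.+ A ℕ.* (Q ℕ.* g ℕ.+ 1 ℕ.+ 2 ℕ.* W) ℕ.* n) ℕ.+ (W ℕ.* c ℕ.* n ℕ.+ C₂ ℕ.* L ℕ.+ C₃)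
      ≡⟨ regroup₂ (W ℕ.* (A ℕ.* lgFree n)) (A ℕ.* (Q ℕ.* g ℕ.+ 1 ℕ.+ 2 ℕ.* W)) n (W ℕ.* c) (C₂ ℕ.* L) C₃ ⟩
    W ℕ.* (A ℕ.* lgFree n) ℕ.+ (C₁ ℕ.* n ℕ.+ C₂ ℕ.* L ℕ.+ C₃)
      ≤⟨ ℕₚ.+-monoʳ-≤ (W ℕ.* (A ℕ.* lgFree n)) (proj₂ (linear≤n*lg C₁ C₂ C₃) m) ⟩
    W ℕ.* (A ℕ.* lgFree n) ℕ.+ (n ℕ.* L ℕ.+ X)
      ≤⟨ ℕₚ.+-monoʳ-≤ (W ℕ.* (A ℕ.* lgFree n)) (ℕₚ.+-monoʳ-≤ (n ℕ.* L) X≤) ⟩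
    W ℕ.* (A ℕ.* lgFree n) ℕ.+ (n ℕ.* L ℕ.+ W ℕ.* (q ℕ.* offset))
      ≡⟨ regroup₃ W q K (lgFree n) (n ℕ.* L) offset ⟩
    W ℕ.* (q ℕ.* (offset ℕ.+ K ℕ.* lgFree n)) ℕ.+ n ℕ.* L ∎))
    where
    open ℕₚ.≤-Reasoning
    n = suc m
    L = lg m
    c = 2 ℕ.* p ℕ.* suc (suc K)
    nL≤ : n ℕ.* L ℕ.≤ lgFree n ℕ.+ #forced n ℕ.* suc L ℕ.+ 2 ℕ.* n
    nL≤ = ℕₚ.≤-trans (lg-sum-lower m) (ℕₚ.+-monoˡ-≤ (2 ℕ.* n)
      (ℕₚ.≤-trans (∑lg≤ n) (ℕₚ.+-monoʳ-≤ (lgFree n) (ℕₚ.*-monoʳ-≤ (#forced n) (proj₂ (lg-step m))))))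
    X≤ : X ℕ.≤ W ℕ.* (q ℕ.* offset)
    X≤ = ℕₚ.≤-trans (ℕₚ.m≤m+n X (p ℕ.* gap 0)) (ℕₚ.≤-trans (ℕₚ.m≤n*m offset q) (ℕₚ.m≤n*m (q ℕ.* offset) W))
    regroup₁ : ∀ W k x c n L p → W ℕ.* (k ℕ.* x ℕ.+ (c ℕ.* n ℕ.+ k ℕ.* L ℕ.+ (c ℕ.+ p))) ℕ.+ x ≡
      (W ℕ.* (k ℕ.* x) ℕ.+ x) ℕ.+ (W ℕ.* c ℕ.* n ℕ.+ W ℕ.* k ℕ.* L ℕ.+ W ℕ.* (c ℕ.+ p))
    regroup₁ = solve-∀
    regroup₂ : ∀ a b n c d e → (a ℕ.+ b ℕ.* n) ℕ.+ (c ℕ.* n ℕ.+ d ℕ.+ e) ≡ a ℕ.+ ((b ℕ.+ c) ℕ.* n ℕ.+ d ℕ.+ e)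
    regroup₂ = solve-∀
    regroup₃ : ∀ W q K S x o → W ℕ.* (q ℕ.* K ℕ.* S) ℕ.+ (x ℕ.+ W ℕ.* (q ℕ.* o)) ≡ W ℕ.* (q ℕ.* (o ℕ.+ K ℕ.* S)) ℕ.+ x
    regroup₃ = solve-∀

-- The lower bound

½^*2^ : ∀ n → 2ℚ ^ℚ n ℚ.* ½ ^ℚ n ≡ 1ℚ
½^*2^ n = trans (sym (^-distrib-* 2ℚ ½ n)) (1^ n)

∑½^≤½ : ∀ n → ∑ℚ (λ i → ½ ^ℚ suc (suc i)) n ℚ.≤ ½
∑½^≤½ n = subst (∑ℚ (λ i → ½ ^ℚ suc (suc i)) n ℚ.≤_) (sum n) (p≤p+q _ (0≤^ 0≤½ (suc n)))
  where
  sum : ∀ n → ∑ℚ (λ i → ½ ^ℚ suc (suc i)) n ℚ.+ ½ ^ℚ suc n ≡ ½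
  sum zero = refl
  sum (suc n) = trans (regroup (∑ℚ (λ i → ½ ^ℚ suc (suc i)) n) (½ ^ℚ suc n)) (sum n)
    where
    open +-*-Solver
    regroup : ∀ S x → (S ℚ.+ ½ ℚ.* x) ℚ.+ ½ ℚ.* x ≡ S ℚ.+ x
    regroup = solve 2 (λ S x → (S :+ con ½ :* x) :+ con ½ :* x := S :+ x) refl

module LowerBound (lem : LEM) (ν : ℕ → ℕ) (ν≥1 : ∀ k → 1 ℕ.≤ ν k) (q′ p e g : ℕ) (p≥1 : 1 ℕ.≤ p)
  (exponents : 2 ℕ.* (suc e ℕ.+ g) ℕ.* p ℕ.< suc e ℕ.* suc q′)
  (often : ∀ M → ∃ λ N → M ℕ.≤ N × suc e ℕ.* ν N ℕ.≤ g ℕ.* suc N)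
  (s : ℝ) (s≤p/q : s ≤ fromℚ (frac p q′)) where

  open Criterion ν ν≥1 q′ p e g exponents often

  -- `IsPower` is a supremum, so any one member bounds it from below. The exponent p / q is
  -- admissible, and its member is the q-th root of d^p.
  root-member : ∀ d → 0ℝ ≤ d → d ≤ 1ℝ → ∃ λ z → IsPowerMember d s z × 0ℝ ≤ z × d ^ p ≤ z ^ q
  root-member d d≥0 d≤1 =
    let d^p≤1 = ≤ℝ-trans {d ^ p} {1ℝ ^ p} {1ℝ} (^ℝ-mono-≤ {d} {1ℝ} d≥0 d≤1 p)
          (≤ℝ-trans {1ℝ ^ p} {fromℚ (1ℚ ^ℚ p)} {1ℝ} (fromℚ-^-≤ 1ℚ p) (fromℚ-mono (ℚₚ.≤-reflexive (1^ p))))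
        z , z≥0 , z^≈ = root lem q′ (d ^ p) (0≤^ℝ {d} d≥0 p) d^p≤1
    in z , (p , q′ , subst (λ t → s ≤ fromℚ t) (sym (frac-def p q′)) s≤p/q , z≥0 , z^≈) , z≥0 , proj₂ z^≈

  module _ {U : Pred ℝ 0ℓ} {w : ℝ} (weight : IsWeight s U w) (U≤1 : ∀ x y → U x → U y → ∣ x - y ∣ ≤ 1ℝ) where

    diameter-bounds : ∀ {d} → IsDiam U d → ∀ {x y} → U x → U y → 0ℝ ≤ d × d ≤ 1ℝ × ∣ x - y ∣ ≤ d
    diameter-bounds {d} (ub , lub) {x} {y} Ux Uy =
      ≤ℝ-trans {0ℝ} {∣ x - y ∣} {d} (0≤∣∣ (x - y)) below , lub 1ℝ (λ { r (x , y , Ux , Uy , refl) → U≤1 x y Ux Uy }) , below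
      where below = ub ∣ x - y ∣ (x , y , Ux , Uy , refl)

    0≤weight : 0ℝ ≤ w
    0≤weight = go weight
      where
      go : ∀ {w} → IsWeight s U w → 0ℝ ≤ w
      go (empty _) = ≤ℝ-refl {0ℝ}
      go (nonempty {d} {w} (x , Ux) isDiam (ub , _)) =
        let d≥0 , d≤1 , _ = diameter-bounds {d} isDiam {x} {x} Ux Ux
            z , member , z≥0 , _ = root-member d d≥0 d≤1
        in ≤ℝ-trans {0ℝ} {z} {w} z≥0 (ub z member)

    -- For t = 2^(-offset) μ n, `criterion` gives t^q ≤ 2^(-p gap n) ≤ d^p ≤ z^q. Cancelling the
    -- power q goes through a rational v with z ≤ v < t.
    weight-lower : ∀ n {x y} → U x → U y → fromℚ (½ ^ℚ gap n) ≤ ∣ x - y ∣ → fromℚ (½ ^ℚ offset ℚ.* μ n) ≤ w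
    weight-lower n {x} {y} Ux Uy far = go weight
      where
      t = ½ ^ℚ offset ℚ.* μ n
      t≡ : t ≡ ½ ^ℚ (offset ℕ.+ K ℕ.* lgFree n)
      t≡ = trans (cong (½ ^ℚ offset ℚ.*_) (μ≡ n)) (sym (^-homo-* ½ offset (K ℕ.* lgFree n)))
      t^q≤ : t ^ℚ q ℚ.≤ (½ ^ℚ gap n) ^ℚ p
      t^q≤ = subst₂ ℚ._≤_ (trans (sym (^-assocʳ ½ (offset ℕ.+ K ℕ.* lgFree n) q)) (cong (_^ℚ q) (sym t≡))) (sym (^-assocʳ ½ (gap n) p))
        (^-anti-≤ 0≤½ (ℚₚ.<⇒≤ ½<1) (subst₂ ℕ._≤_ (ℕₚ.*-comm p (gap n)) (ℕₚ.*-comm q (offset ℕ.+ K ℕ.* lgFree n)) (criterion n)))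
      go : ∀ {w} → IsWeight s U w → fromℚ t ≤ w
      go (empty none) = ⊥-elim (none x Ux)
      go (nonempty {d} {w} _ isDiam (ub , _)) =
        let d≥0 , d≤1 , x-y≤d = diameter-bounds {d} isDiam {x} {y} Ux Uy
            z , member , z≥0 , d^≤ = root-member d d≥0 d≤1
        in ≤ℝ-trans {fromℚ t} {z} {w} (¬¬-elim lem λ t≰z → contra d z d≥0 x-y≤d z≥0 d^≤ (<ℝ-dense {z} {fromℚ t} (≰⇒> {fromℚ t} {z} lem t≰z))) (ub z member)
        where
        contra : ∀ d z → 0ℝ ≤ d → ∣ x - y ∣ ≤ d → 0ℝ ≤ z → d ^ p ≤ z ^ q → ¬ (∃ λ y → ∃ λ ε → 0ℚ ℚ.< ε × z ≤ fromℚ y × fromℚ (y ℚ.+ ε) ≤ fromℚ t)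
        contra d z d≥0 x-y≤d z≥0 d^≤ (v , ε , ε>0 , z≤v , v+ε≤t) = ℚₚ.<-irrefl refl (ℚₚ.<-≤-trans (^-mono-< v≥0 v<t q′) (ℚₚ.≤-trans t^q≤ far^≤))
          where
          v≥0 : 0ℚ ℚ.≤ v
          v≥0 = fromℚ-cancel (≤ℝ-trans {0ℝ} {z} {fromℚ v} z≥0 z≤v)
          v<t : v ℚ.< t
          v<t = ℚₚ.<-≤-trans (<-from-gap ε>0 (solve 2 (λ q ε → (q :+ ε) :- q := ε) refl v ε)) (fromℚ-cancel v+ε≤t)
            where open +-*-Solver
          D = ½ ^ℚ gap n
          far^≤ : D ^ℚ p ℚ.≤ v ^ℚ q
          far^≤ = fromℚ-cancel (≤ℝ-trans {fromℚ (D ^ℚ p)} {fromℚ D ^ p} {fromℚ (v ^ℚ q)} (fromℚ-^-≥ D p)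
            (≤ℝ-trans {fromℚ D ^ p} {d ^ p} {fromℚ (v ^ℚ q)} (^ℝ-mono-≤ {fromℚ D} {d} (fromℚ-mono (0≤^ 0≤½ (gap n))) (≤ℝ-trans {fromℚ D} {∣ x - y ∣} {d} far x-y≤d) p)
              (≤ℝ-trans {d ^ p} {z ^ q} {fromℚ (v ^ℚ q)} d^≤
                (≤ℝ-trans {z ^ q} {fromℚ v ^ q} {fromℚ (v ^ℚ q)} (^ℝ-mono-≤ {z} {fromℚ v} z≥0 z≤v q) (fromℚ-^-≤ v q)))))

    Agree : ℕ → Set
    Agree n = ∀ b c (vb : Valid b) (vc : Valid c) → U (point b vb) → U (point c vc) → ∀ k → k ℕ.< n → b k ≡ c k

    last-agreement : ∀ m → ¬ Agree m → ∃ λ n → Agree n × ¬ Agree (suc n)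
    last-agreement zero ¬agree = ⊥-elim (¬agree λ _ _ _ _ _ _ _ ())
    last-agreement (suc m) ¬agree = choose (lem (Agree m))
      where
      choose : Dec (Agree m) → ∃ λ n → Agree n × ¬ Agree (suc n)
      choose (yes agree) = m , agree , ¬agree
      choose (no ¬agree′) = last-agreement m ¬agree′

    -- The negation of `Agree (suc n)` names no pair of points. Instead, if w were smaller,
    -- `weight-lower` would rule out every difference at n.
    heavy-split : ∀ n → Agree n → ¬ Agree (suc n) → fromℚ (½ ^ℚ offset ℚ.* μ n) ≤ w
    heavy-split n agree ¬agree = ¬¬-elim lem λ t≰w → ¬agree λ b c vb vc Ub Uc k k≤n → decide t≰w b c vb vc Ub Uc k (ℕₚ.m≤n⇒m<n∨m≡n (ℕₚ.≤-pred k≤n))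
      where
      decide : ¬ (fromℚ (½ ^ℚ offset ℚ.* μ n) ≤ w) → ∀ b c (vb : Valid b) (vc : Valid c) → U (point b vb) → U (point c vc) → ∀ k → k ℕ.< n ⊎ k ≡ n → b k ≡ c k
      decide t≰w b c vb vc Ub Uc k (inj₁ k<n) = agree b c vb vc Ub Uc k k<n
      decide t≰w b c vb vc Ub Uc .n (inj₂ refl) = decidable-stable (b n ℕₚ.≟ c n) λ b≢c →
        t≰w (weight-lower n Ub Uc (points-apart vb vc n (agree b c vb vc Ub Uc) b≢c))

    -- As n ≤ gap n ≤ p gap n, `criterion` at n = q (offset + N) forces K lgFree n ≥ N.
    μ-small : ∀ N → ∃ λ n → μ n ℚ.≤ ½ ^ℚ N
    μ-small N = n , subst (ℚ._≤ ½ ^ℚ N) (sym (μ≡ n)) (^-anti-≤ 0≤½ (ℚₚ.<⇒≤ ½<1) (ℕₚ.+-cancelˡ-≤ offset N (K ℕ.* lgFree n)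
      (ℕₚ.*-cancelˡ-≤ q (ℕₚ.≤-trans (n≤gap n) (ℕₚ.≤-trans (ℕₚ.m≤n*m (gap n) p {{ℕ.>-nonZero p≥1}}) (criterion n))))))
      where
      n = q ℕ.* (offset ℕ.+ N)
      n≤∑ : ∀ n → n ℕ.≤ ∑ℕ height n
      n≤∑ zero = ℕ.z≤n
      n≤∑ (suc n) = subst (ℕ._≤ ∑ℕ height (suc n)) (ℕₚ.+-comm n 1) (ℕₚ.+-mono-≤ (n≤∑ n) (ℕ.s≤s ℕ.z≤n))
      n≤gap : ∀ n → n ℕ.≤ gap n
      n≤gap n = ℕₚ.≤-trans (n≤∑ n) (ℕₚ.≤-trans (ℕₚ.m≤m+n (∑ℕ height n) (height n)) (ℕₚ.≤-trans (ℕₚ.m≤n*m (∑ℕ height (suc n)) 2) (ℕₚ.n≤1+n _)))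

    -- If the points of the construction in U never split, w may be 0 and pays for nothing. Then a
    -- node so deep that its mass is at most (1/2)^N is taken, and the summable error term pays for
    -- it.
    covering-node : ∀ N → ∃ λ L → Agree L × fromℚ (μ L) ≤ fromℚ (2ℚ ^ℚ offset) * w + fromℚ (½ ^ℚ N)
    covering-node N = choose (lem (∀ n → Agree n))
      where
      P = 2ℚ ^ℚ offset
      P≥0 : 0ℝ ≤ fromℚ P
      P≥0 = fromℚ-mono (0≤^ (0≤-+ 0≤1 0≤1) offset)
      choose : Dec (∀ n → Agree n) → ∃ λ L → Agree L × fromℚ (μ L) ≤ fromℚ P * w + fromℚ (½ ^ℚ N)
      choose (yes always) = let n , μ≤ = μ-small N in n , always n ,
        ≤ℝ-trans {fromℚ (μ n)} {fromℚ P * 0ℝ + fromℚ (½ ^ℚ N)} {fromℚ P * w + fromℚ (½ ^ℚ N)}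
          (≤-pointwise {fromℚ (μ n)} {fromℚ P * 0ℝ + fromℚ (½ ^ℚ N)} 0 λ _ _ → ℚₚ.≤-trans μ≤
            (ℚₚ.≤-reflexive (sym (trans (cong (ℚ._+ ½ ^ℚ N) (ℚₚ.*-zeroʳ P)) (ℚₚ.+-identityˡ (½ ^ℚ N))))))
          (+ℝ-mono-≤ {fromℚ P * 0ℝ} {fromℚ P * w} {fromℚ (½ ^ℚ N)} {fromℚ (½ ^ℚ N)} (*ℝ-monoˡ-≤ {fromℚ P} {0ℝ} {w} P≥0 0≤weight) (≤ℝ-refl {fromℚ (½ ^ℚ N)}))
      choose (no ¬always) =
        let m , ¬agree = ¬∀⇒∃¬ lem ¬always
            n , agree , ¬agree′ = last-agreement m ¬agree
            t = ½ ^ℚ offset ℚ.* μ n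
        in n , agree ,
          ≤ℝ-trans {fromℚ (μ n)} {fromℚ P * fromℚ t + fromℚ (½ ^ℚ N)} {fromℚ P * w + fromℚ (½ ^ℚ N)}
            (≤-pointwise {fromℚ (μ n)} {fromℚ P * fromℚ t + fromℚ (½ ^ℚ N)} 0 λ _ _ →
              subst (λ v → μ n ℚ.≤ v ℚ.+ ½ ^ℚ N) (sym (trans (sym (ℚₚ.*-assoc P (½ ^ℚ offset) (μ n))) (trans (cong (ℚ._* μ n) (½^*2^ offset)) (ℚₚ.*-identityˡ (μ n)))))
                (p≤p+q (μ n) (0≤^ 0≤½ N)))
            (+ℝ-mono-≤ {fromℚ P * fromℚ t} {fromℚ P * w} {fromℚ (½ ^ℚ N)} {fromℚ (½ ^ℚ N)}
              (*ℝ-monoˡ-≤ {fromℚ P} {fromℚ t} {w} P≥0 (heavy-split n agree ¬agree′)) (≤ℝ-refl {fromℚ (½ ^ℚ N)}))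

    covering-digits : ∀ {L} → Agree L → ∃ λ v → ∀ b (vb : Valid b) → U (point b vb) → ∀ k → k ℕ.< L → b k ≡ v k
    covering-digits {L} agree = choose (lem (∃ λ c → ∃ λ vc → U (point c vc)))
      where
      choose : Dec (∃ λ c → ∃ λ vc → U (point c vc)) → ∃ λ v → ∀ b (vb : Valid b) → U (point b vb) → ∀ k → k ℕ.< L → b k ≡ v k
      choose (yes (c , vc , Uc)) = c , λ b vb Ub → agree b c vb vc Ub Uc
      choose (no none) = (λ _ → 0) , λ b vb Ub → ⊥-elim (none (b , vb , Ub))

  -- 2^offset η = 1/4, and the error terms (1/2)^(i+2) sum to at most 1/2, so the forbidden nodes
  -- have total mass at most 3/4 < 1.
  η : ℚ
  η = ½ ^ℚ offset ℚ.* (½ ℚ.* ½)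

  no-light-cover : (C : Cover 1ℝ (F ν)) (w : ℕ → ℝ) → (∀ i → IsWeight s (piece C i) (w i)) → ¬ (∀ n → ∑ w n ≤ fromℚ η)
  no-light-cover C w weights light =
    let b , vb , avoids = avoiding-path lem L v {½ ℚ.* ½ ℚ.+ ½} ¾<1 total
        i , inside = covers C (point∈F vb)
    in avoids i (proj₂ (digits i) b vb inside)
    where
    small : ∀ i x y → piece C i x → piece C i y → ∣ x - y ∣ ≤ 1ℝ
    small i x y = diam≤δ C i {x} {y}
    node : ∀ i → ∃ λ L → Agree (weights i) (small i) L × fromℚ (μ L) ≤ fromℚ (2ℚ ^ℚ offset) * w i + fromℚ (½ ^ℚ suc (suc i))
    node i = covering-node (weights i) (small i) (suc (suc i))
    L : ℕ → ℕ
    L i = proj₁ (node i)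
    digits : ∀ i → ∃ λ v → ∀ b (vb : Valid b) → piece C i (point b vb) → ∀ k → k ℕ.< L i → b k ≡ v k
    digits i = covering-digits (weights i) (small i) {L i} (proj₁ (proj₂ (node i)))
    v : ℕ → ℕ → ℕ
    v i = proj₁ (digits i)
    P = 2ℚ ^ℚ offset
    ε : ℕ → ℚ
    ε i = ½ ^ℚ suc (suc i)
    sums : ∀ n → fromℚ (∑ℚ (μ ∘ L) n) ≤ fromℚ P * ∑ w n + fromℚ (∑ℚ ε n)
    sums zero = ≤-pointwise {0ℝ} {fromℚ P * 0ℝ + 0ℝ} 0 λ _ _ → ℚₚ.≤-reflexive (sym (trans (ℚₚ.+-identityʳ (P ℚ.* 0ℚ)) (ℚₚ.*-zeroʳ P)))
    sums (suc n) = ≤ℝ-trans {fromℚ (∑ℚ (μ ∘ L) (suc n))} {(fromℚ P * ∑ w n + fromℚ (∑ℚ ε n)) + (fromℚ P * w n + fromℚ (ε n))} {fromℚ P * ∑ w (suc n) + fromℚ (∑ℚ ε (suc n))}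
      (≤ℝ-trans {fromℚ (∑ℚ (μ ∘ L) (suc n))} {fromℚ (∑ℚ (μ ∘ L) n) + fromℚ (μ (L n))} {(fromℚ P * ∑ w n + fromℚ (∑ℚ ε n)) + (fromℚ P * w n + fromℚ (ε n))}
        (≤-pointwise {fromℚ (∑ℚ (μ ∘ L) (suc n))} {fromℚ (∑ℚ (μ ∘ L) n) + fromℚ (μ (L n))} 0 λ _ _ → ℚₚ.≤-refl)
        (+ℝ-mono-≤ {fromℚ (∑ℚ (μ ∘ L) n)} {fromℚ P * ∑ w n + fromℚ (∑ℚ ε n)} {fromℚ (μ (L n))} {fromℚ P * w n + fromℚ (ε n)} (sums n) (proj₂ (proj₂ (node n)))))
      (≤-pointwise {(fromℚ P * ∑ w n + fromℚ (∑ℚ ε n)) + (fromℚ P * w n + fromℚ (ε n))} {fromℚ P * ∑ w (suc n) + fromℚ (∑ℚ ε (suc n))} 0 λ k _ →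
        ℚₚ.≤-reflexive (regroup P (seq (∑ w n) k) (∑ℚ ε n) (seq (w n) k) (ε n)))
      where
      open +-*-Solver
      regroup : ∀ P S e x y → (P ℚ.* S ℚ.+ e) ℚ.+ (P ℚ.* x ℚ.+ y) ≡ P ℚ.* (S ℚ.+ x) ℚ.+ (e ℚ.+ y)
      regroup = solve 5 (λ P S e x y → (P :* S :+ e) :+ (P :* x :+ y) := P :* (S :+ x) :+ (e :+ y)) refl
    ¾<1 : ½ ℚ.* ½ ℚ.+ ½ ℚ.< 1ℚ
    ¾<1 = <-from-gap (0<-* 0<½ 0<½) refl
    Pη : P ℚ.* η ≡ ½ ℚ.* ½
    Pη = trans (sym (ℚₚ.*-assoc P (½ ^ℚ offset) (½ ℚ.* ½))) (trans (cong (ℚ._* (½ ℚ.* ½)) (½^*2^ offset)) (ℚₚ.*-identityˡ (½ ℚ.* ½)))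
    total : Bounded (μ ∘ L) (½ ℚ.* ½ ℚ.+ ½)
    total n = fromℚ-cancel (≤ℝ-trans {fromℚ (∑ℚ (μ ∘ L) n)} {fromℚ P * ∑ w n + fromℚ (∑ℚ ε n)} {fromℚ (½ ℚ.* ½ ℚ.+ ½)} (sums n)
      (≤ℝ-trans {fromℚ P * ∑ w n + fromℚ (∑ℚ ε n)} {fromℚ P * fromℚ η + fromℚ ½} {fromℚ (½ ℚ.* ½ ℚ.+ ½)}
        (+ℝ-mono-≤ {fromℚ P * ∑ w n} {fromℚ P * fromℚ η} {fromℚ (∑ℚ ε n)} {fromℚ ½}
          (*ℝ-monoˡ-≤ {fromℚ P} {∑ w n} {fromℚ η} (fromℚ-mono (0≤^ (0≤-+ 0≤1 0≤1) offset)) (light n)) (fromℚ-mono (∑½^≤½ n)))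
        (≤-pointwise {fromℚ P * fromℚ η + fromℚ ½} {fromℚ (½ ℚ.* ½ ℚ.+ ½)} 0 λ _ _ → ℚₚ.≤-reflexive (cong (ℚ._+ ½) Pη))))

  measure-positive : ¬ IsHausdorffMeasure s (F ν) (fin 0ℝ)
  measure-positive (h , contents , sup , _) = contra (h 1ℝ) (proj₂ (contents 1ℝ 0<1ℝ) (fin (fromℚ η)) heavy) (sup (h 1ℝ) (1ℝ , 0<1ℝ , refl))
    where
    0<1ℝ : 0ℝ < 1ℝ
    0<1ℝ = 1ℚ , 0<1 , 0 , λ _ _ → ℚₚ.≤-refl
    η>0 : 0ℚ ℚ.< η
    η>0 = 0<-* (0<^ 0<½ offset) (0<-* 0<½ 0<½)
    contra : ∀ x → fin (fromℚ η) ≤∞ x → x ≤∞ fin 0ℝ → ⊥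
    contra (fin x) η≤x x≤0 = ℚₚ.<-irrefl refl (ℚₚ.<-≤-trans η>0 (fromℚ-cancel (≤ℝ-trans {fromℚ η} {x} {0ℝ} η≤x x≤0)))
    heavy : ∀ y → (Σ (Cover 1ℝ (F ν)) λ C → ∃ λ w → (∀ i → IsWeight s (piece C i) (w i)) × IsSup _≤∞_ (λ y → ∃ λ n → y ≡ fin (∑ w n)) y) → fin (fromℚ η) ≤∞ y
    heavy ∞ _ = tt
    heavy (fin T) (C , w , weights , ub , _) = ¬¬-elim lem λ η≰T → no-light-cover C w weights λ n →
      ≤ℝ-trans {∑ w n} {T} {fromℚ η} (ub (fin (∑ w n)) (n , refl)) (<ℝ⇒≤ {T} {fromℚ η} (≰⇒> {fromℚ η} {T} lem η≰T))

-- The dimension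

≤∞-trans : ∀ x y z → x ≤∞ y → y ≤∞ z → x ≤∞ z
≤∞-trans (fin x) (fin y) (fin z) x≤y y≤z = ≤ℝ-trans {x} {y} {z} x≤y y≤z
≤∞-trans (fin _) _ ∞ _ _ = tt
≤∞-trans ∞ _ ∞ _ _ = tt
≤∞-trans (fin _) ∞ (fin _) _ ()
≤∞-trans ∞ (fin _) (fin _) () _

frac-unique : ∀ {x} m k → x ℚ.* ι (suc k) ≡ ι m → x ≡ frac m k
frac-unique {x} m k eq = ℚₚ.≤-antisym
  (*-cancelʳ-≤ (ι (suc k)) (0<ι k) (ℚₚ.≤-reflexive same)) (*-cancelʳ-≤ (ι (suc k)) (0<ι k) (ℚₚ.≤-reflexive (sym same)))
  where same = trans eq (sym (frac-*-ι m k))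

2s[1+β]-clear : ∀ p k g e → ((2ℚ ℚ.* frac p k) ℚ.* (1ℚ ℚ.+ frac g e)) ℚ.* (ι (suc k) ℚ.* ι (suc e)) ≡ ι (2 ℕ.* (suc e ℕ.+ g) ℕ.* p)
2s[1+β]-clear p k g e = trans (regroup (frac p k) (frac g e) (ι (suc k)) (ι (suc e)))
  (trans (cong₂ (λ x y → (2ℚ ℚ.* (ι (suc e) ℚ.+ y)) ℚ.* x) (frac-*-ι p k) (frac-*-ι g e))
    (sym (trans (ι-* (2 ℕ.* (suc e ℕ.+ g)) p) (cong (ℚ._* ι p) (trans (ι-* 2 (suc e ℕ.+ g)) (cong₂ ℚ._*_ (trans (ι-suc 1) (cong (1ℚ ℚ.+_) ι-1)) (ι-+ (suc e) g)))))))
  where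
  open +-*-Solver
  regroup : ∀ s β k e → (((1ℚ ℚ.+ 1ℚ) ℚ.* s) ℚ.* (1ℚ ℚ.+ β)) ℚ.* (k ℚ.* e) ≡ ((1ℚ ℚ.+ 1ℚ) ℚ.* (e ℚ.+ β ℚ.* e)) ℚ.* (s ℚ.* k)
  regroup = solve 4 (λ s β k e → (((con 1ℚ :+ con 1ℚ) :* s) :* (con 1ℚ :+ β)) :* (k :* e) := ((con 1ℚ :+ con 1ℚ) :* (e :+ β :* e)) :* (s :* k)) refl

1-clear : ∀ k e → 1ℚ ℚ.* (ι (suc k) ℚ.* ι (suc e)) ≡ ι (suc k ℕ.* suc e)
1-clear k e = trans (ℚₚ.*-identityˡ _) (sym (ι-* (suc k) (suc e)))

2s[1+β]>1⇒ : ∀ p k g e → 1ℚ ℚ.< (2ℚ ℚ.* frac p k) ℚ.* (1ℚ ℚ.+ frac g e) → suc k ℕ.* suc e ℕ.< 2 ℕ.* (suc e ℕ.+ g) ℕ.* p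
2s[1+β]>1⇒ p k g e h = ι-cancel-< (subst₂ ℚ._<_ (1-clear k e) (2s[1+β]-clear p k g e)
  (ℚₚ.*-monoˡ-<-pos (ι (suc k) ℚ.* ι (suc e)) {{ℚ.positive (0<-* (0<ι k) (0<ι e))}} h))

2s[1+β]<1⇒ : ∀ p k g e → (2ℚ ℚ.* frac p k) ℚ.* (1ℚ ℚ.+ frac g e) ℚ.< 1ℚ → 2 ℕ.* (suc e ℕ.+ g) ℕ.* p ℕ.< suc k ℕ.* suc e
2s[1+β]<1⇒ p k g e h = ι-cancel-< (subst₂ ℚ._<_ (2s[1+β]-clear p k g e) (1-clear k e)
  (ℚₚ.*-monoˡ-<-pos (ι (suc k) ℚ.* ι (suc e)) {{ℚ.positive (0<-* (0<ι k) (0<ι e))}} h))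

module Dimension (lem : LEM) (ν : ℕ → ℕ) (ν≥1 : ∀ k → 1 ℕ.≤ ν k)
  (α : ℝ∞) (liminf : IsLiminf (λ k → fin (fromℚ (+ ν k ℚ./ suc k))) α) where

  private
    u : ℕ → ℝ∞
    u k = fin (fromℚ (+ ν k ℚ./ suc k))

    i : ℕ → ℝ∞
    i = proj₁ liminf

    i≤u : ∀ {n k} → n ℕ.≤ k → i n ≤∞ u k
    i≤u {n} {k} n≤k = proj₁ (proj₁ (proj₂ liminf) n) (u k) (k , n≤k , refl)

  eventually≥ : ∀ β → ¬ (α ≤∞ fin (fromℚ β)) → ∃ λ n → ∀ k → n ℕ.≤ k → β ℚ.≤ frac (ν k) k
  eventually≥ β α≰β =
    let n , i≰β = ¬∀⇒∃¬ lem λ all → α≰β (proj₂ (proj₂ (proj₂ liminf)) (fin (fromℚ β)) λ { y (n , refl) → all n })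
    in n , λ k n≤k → ℚₚ.<⇒≤ (ℚₚ.≰⇒> λ u≤β → i≰β (≤∞-trans (i n) (u k) (fin (fromℚ β)) (i≤u n≤k)
         (fromℚ-mono (subst (ℚ._≤ β) (sym (frac-def (ν k) k)) u≤β))))

  infinitely-often≤ : ∀ γ → ¬ (fin (fromℚ γ) ≤∞ α) → ∀ M → ∃ λ N → M ℕ.≤ N × frac (ν N) N ℚ.≤ γ
  infinitely-often≤ γ γ≰α M = ¬¬-elim lem λ ¬∃ → γ≰α (≤∞-trans (fin (fromℚ γ)) (i M) α
    (proj₂ (proj₁ (proj₂ liminf) M) (fin (fromℚ γ)) λ { y (k , M≤k , refl) → fromℚ-mono
      (subst (γ ℚ.≤_) (sym (frac-def (ν k) k)) (ℚₚ.<⇒≤ (ℚₚ.≰⇒> λ u≤γ → ¬∃ (k , M≤k , u≤γ)))) })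
    (proj₁ (proj₂ (proj₂ liminf)) (i M) (M , refl)))

  0≤liminf : fin 0ℝ ≤∞ α
  0≤liminf = ≤∞-trans (fin 0ℝ) (i 0) α
    (proj₂ (proj₁ (proj₂ liminf) 0) (fin 0ℝ) λ { y (k , _ , refl) → fromℚ-mono (subst (0ℚ ℚ.≤_) (sym (frac-def (ν k) k)) (0≤frac (ν k) k)) })
    (proj₁ (proj₂ (proj₂ liminf)) (i 0) (0 , refl))

  -- `UpperBound` asks for (r + 1) E where the hypothesis has only (k + 1) E with strict inequality.
  -- Extending the fraction p / (k + 1) by E makes r = (k + 1) E, and the strictness becomes exactly
  -- the missing E.
  measure-zero-at : ∀ p k e g → suc k ℕ.* suc e ℕ.< 2 ℕ.* (suc e ℕ.+ g) ℕ.* p → (K₀ : ℕ) →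
    (∀ k → K₀ ℕ.≤ k → g ℕ.* suc (suc k) ℕ.≤ suc e ℕ.* (2 ℕ.⊔ ν k ℕ.∸ 2)) → IsHausdorffMeasure (fromℚ (frac p k)) (F ν) (fin 0ℝ)
  measure-zero-at p k e g h K₀ long = subst (λ s → IsHausdorffMeasure (fromℚ s) (F ν) (fin 0ℝ)) (sym same)
    (UpperBound.measure-zero lem ν k′ e g (p ℕ.* E) exponents K₀ long)
    where
    E = suc e
    k′ = e ℕ.+ k ℕ.* E
    exponents : suc (suc k ℕ.* E) ℕ.* E ℕ.≤ 2 ℕ.* (E ℕ.+ g) ℕ.* (p ℕ.* E)
    exponents = ℕₚ.≤-trans (ℕₚ.*-monoˡ-≤ E h) (ℕₚ.≤-reflexive (ℕₚ.*-assoc (2 ℕ.* (E ℕ.+ g)) p E))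
    same : frac p k ≡ frac (p ℕ.* E) k′
    same = frac-unique (p ℕ.* E) k′ (trans (cong (frac p k ℚ.*_) (ι-* (suc k) E)) (trans (sym (ℚₚ.*-assoc (frac p k) (ι (suc k)) (ι E)))
      (trans (cong (ℚ._* ι E) (frac-*-ι p k)) (sym (ι-* p E)))))

  -- Replacing g / (e + 1) by (t g - 1) / (t (e + 1)) leaves room for the two digits a block does not gain.
  measure-zero-above : ∀ p k e g → suc k ℕ.* suc e ℕ.< 2 ℕ.* (suc e ℕ.+ g) ℕ.* p → (g ≡ 0 ⊎ ¬ (α ≤∞ fin (fromℚ (frac g e)))) →
    IsHausdorffMeasure (fromℚ (frac p k)) (F ν) (fin 0ℝ)
  measure-zero-above p k e zero h _ = measure-zero-at p k e 0 h 0 λ _ _ → ℕ.z≤n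
  measure-zero-above p k e (suc g) h (inj₂ α≰) =
    let n , below = eventually≥ (frac (suc g) e) α≰
    -- From j = g′ + 2 E′ on, the term j + 1 freed by the smaller numerator covers the two digits
    -- lost and the shift from j + 1 to j + 2.
    in measure-zero-at p k e′ g′ h′ (n ℕ.⊔ (g′ ℕ.+ 2 ℕ.* E′)) λ j j≥ →
         long j (ℕₚ.m⊔n≤o⇒n≤o n (g′ ℕ.+ 2 ℕ.* E′) j≥) (frac-cancel-≤ (suc g) e (ν j) j (below j (ℕₚ.m⊔n≤o⇒m≤o n (g′ ℕ.+ 2 ℕ.* E′) j≥)))
    where
    open ℕₚ.≤-Reasoning
    -- Lowering the numerator by 1 costs 2 p on the right, while t copies of the strict inequality
    -- gain t; one unit must remain.
    t = suc (2 ℕ.* p)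
    e′ = e ℕ.+ 2 ℕ.* p ℕ.* suc e
    E′ = suc e′
    g′ = g ℕ.+ 2 ℕ.* p ℕ.* suc g
    h′ : suc k ℕ.* E′ ℕ.< 2 ℕ.* (E′ ℕ.+ g′) ℕ.* p
    h′ = ℕₚ.+-cancelʳ-≤ (2 ℕ.* p) _ _ (begin
      suc (suc k ℕ.* E′) ℕ.+ 2 ℕ.* p                       ≡⟨ lhs (suc k) e p ⟩
      t ℕ.* suc (suc k ℕ.* suc e)                          ≤⟨ ℕₚ.*-monoʳ-≤ t h ⟩
      t ℕ.* (2 ℕ.* (suc e ℕ.+ suc g) ℕ.* p)                ≡⟨ rhs e g p ⟩
      2 ℕ.* (E′ ℕ.+ g′) ℕ.* p ℕ.+ 2 ℕ.* p                  ∎)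
      where
      lhs : ∀ q e p → suc (q ℕ.* suc (e ℕ.+ 2 ℕ.* p ℕ.* suc e)) ℕ.+ 2 ℕ.* p ≡ suc (2 ℕ.* p) ℕ.* suc (q ℕ.* suc e)
      lhs = solve-∀
      rhs : ∀ e g p → suc (2 ℕ.* p) ℕ.* (2 ℕ.* (suc e ℕ.+ suc g) ℕ.* p) ≡ 2 ℕ.* (suc (e ℕ.+ 2 ℕ.* p ℕ.* suc e) ℕ.+ (g ℕ.+ 2 ℕ.* p ℕ.* suc g)) ℕ.* p ℕ.+ 2 ℕ.* p
      rhs = solve-∀
    long : ∀ j → g′ ℕ.+ 2 ℕ.* E′ ℕ.≤ j → suc g ℕ.* suc j ℕ.≤ ν j ℕ.* suc e → g′ ℕ.* suc (suc j) ℕ.≤ E′ ℕ.* (2 ℕ.⊔ ν j ℕ.∸ 2)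
    long j j≥ h = ℕₚ.+-cancelʳ-≤ (2 ℕ.* E′) _ _ (begin
      g′ ℕ.* suc (suc j) ℕ.+ 2 ℕ.* E′                  ≡⟨ lhs g′ j (2 ℕ.* E′) ⟩
      g′ ℕ.* suc j ℕ.+ (g′ ℕ.+ 2 ℕ.* E′)               ≤⟨ ℕₚ.+-monoʳ-≤ (g′ ℕ.* suc j) (ℕₚ.≤-trans j≥ (ℕₚ.n≤1+n j)) ⟩
      g′ ℕ.* suc j ℕ.+ suc j                           ≡⟨ mid g p j ⟩
      t ℕ.* (suc g ℕ.* suc j)                          ≤⟨ ℕₚ.*-monoʳ-≤ t h ⟩
      t ℕ.* (ν j ℕ.* suc e)                            ≡⟨ rhs p (ν j) e ⟩
      E′ ℕ.* ν j                                       ≤⟨ ℕₚ.*-monoʳ-≤ E′ (ℕₚ.m≤n⊔m 2 (ν j)) ⟩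
      E′ ℕ.* (2 ℕ.⊔ ν j)                               ≡⟨ cong (E′ ℕ.*_) (ℕₚ.m∸n+n≡m (ℕₚ.m≤m⊔n 2 (ν j))) ⟨
      E′ ℕ.* ((2 ℕ.⊔ ν j ℕ.∸ 2) ℕ.+ 2)                 ≡⟨ final E′ (2 ℕ.⊔ ν j ℕ.∸ 2) ⟩
      E′ ℕ.* (2 ℕ.⊔ ν j ℕ.∸ 2) ℕ.+ 2 ℕ.* E′            ∎)
      where
      lhs : ∀ g j x → g ℕ.* suc (suc j) ℕ.+ x ≡ g ℕ.* suc j ℕ.+ (g ℕ.+ x)
      lhs = solve-∀
      mid : ∀ g p j → (g ℕ.+ 2 ℕ.* p ℕ.* suc g) ℕ.* suc j ℕ.+ suc j ≡ suc (2 ℕ.* p) ℕ.* (suc g ℕ.* suc j)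
      mid = solve-∀
      rhs : ∀ p n e → suc (2 ℕ.* p) ℕ.* (n ℕ.* suc e) ≡ suc (e ℕ.+ 2 ℕ.* p ℕ.* suc e) ℕ.* n
      rhs = solve-∀
      final : ∀ E x → E ℕ.* (x ℕ.+ 2) ≡ E ℕ.* x ℕ.+ 2 ℕ.* E
      final = solve-∀

  -- β = 0 is a separate case because for α = 0 no rational β satisfies 0 ≤ β < α.
  zero-measure-at : ∀ {s β} → 0ℚ ℚ.≤ s → 0ℚ ℚ.≤ β → 1ℚ ℚ.< (2ℚ ℚ.* s) ℚ.* (1ℚ ℚ.+ β) → (β ≡ 0ℚ ⊎ ¬ (α ≤∞ fin (fromℚ β))) →
    IsHausdorffMeasure (fromℚ s) (F ν) (fin 0ℝ)
  zero-measure-at {s} {β} s≥0 β≥0 h cases =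
    let p , k , s≡ = nonNeg-fraction s s≥0
    in subst (λ s → IsHausdorffMeasure (fromℚ s) (F ν) (fin 0ℝ)) (sym s≡) (split p k (subst (λ s → 1ℚ ℚ.< (2ℚ ℚ.* s) ℚ.* (1ℚ ℚ.+ β)) s≡ h) cases)
    where
    split : ∀ p k → 1ℚ ℚ.< (2ℚ ℚ.* frac p k) ℚ.* (1ℚ ℚ.+ β) → (β ≡ 0ℚ ⊎ ¬ (α ≤∞ fin (fromℚ β))) → IsHausdorffMeasure (fromℚ (frac p k)) (F ν) (fin 0ℝ)
    split p k h (inj₁ β≡0) = measure-zero-above p k 0 0 (2s[1+β]>1⇒ p k 0 0 (subst (λ β → 1ℚ ℚ.< (2ℚ ℚ.* frac p k) ℚ.* (1ℚ ℚ.+ β))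
      (trans β≡0 (frac-unique 0 0 (trans (ℚₚ.*-zeroˡ (ι 1)) (sym ι-0)))) h)) (inj₁ refl)
    split p k h (inj₂ α≰β) = let g , e , β≡ = nonNeg-fraction β β≥0 in
      measure-zero-above p k e g (2s[1+β]>1⇒ p k g e (subst (λ β → 1ℚ ℚ.< (2ℚ ℚ.* frac p k) ℚ.* (1ℚ ℚ.+ β)) β≡ h))
        (inj₂ (subst (λ β → ¬ (α ≤∞ fin (fromℚ β))) β≡ α≰β))

  positive-measure-at : ∀ {s t γ} → s ≤ fromℚ t → 0ℚ ℚ.< t → 0ℚ ℚ.≤ γ → (2ℚ ℚ.* t) ℚ.* (1ℚ ℚ.+ γ) ℚ.< 1ℚ → ¬ (fin (fromℚ γ) ≤∞ α) →
    ¬ IsHausdorffMeasure s (F ν) (fin 0ℝ)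
  positive-measure-at {s} {t} {γ} s≤t t>0 γ≥0 h γ≰α =
    let p , k , t≡ = nonNeg-fraction t (ℚₚ.<⇒≤ t>0)
        g , e , γ≡ = nonNeg-fraction γ γ≥0
    in LowerBound.measure-positive lem ν ν≥1 k p e g (ι-cancel-< (subst₂ ℚ._<_ (sym ι-0) (trans (cong (ℚ._* ι (suc k)) t≡) (frac-*-ι p k)) (0<-* t>0 (0<ι k))))
      (subst (2 ℕ.* (suc e ℕ.+ g) ℕ.* p ℕ.<_) (ℕₚ.*-comm (suc k) (suc e))
        (2s[1+β]<1⇒ p k g e (subst₂ (λ t γ → (2ℚ ℚ.* t) ℚ.* (1ℚ ℚ.+ γ) ℚ.< 1ℚ) t≡ γ≡ h)))
      (λ M → let N , M≤N , u≤γ = infinitely-often≤ γ γ≰α M in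
        N , M≤N , subst (ℕ._≤ g ℕ.* suc N) (ℕₚ.*-comm (ν N) (suc e)) (frac-cancel-≤ (ν N) N g e (subst (frac (ν N) N ℚ.≤_) γ≡ u≤γ)))
      s (subst (λ t → s ≤ fromℚ t) t≡ s≤t)

-- The value 1 / (2 (1 + α)) and rational slopes near α

0⊔-nonexpansive : ∀ p q → ℚ.∣ (0ℚ ℚ.⊔ p) ℚ.- (0ℚ ℚ.⊔ q) ∣ ℚ.≤ ℚ.∣ p ℚ.- q ∣
0⊔-nonexpansive p q = ∣p-q∣≤r (0ℚ ℚ.⊔ p) (0ℚ ℚ.⊔ q) (half p q ℚ.∣ p ℚ.- q ∣ (ℚₚ.0≤∣p∣ (p ℚ.- q)) (∣p-q∣≤r⇒p≤q+r p q ℚₚ.≤-refl))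
  (half q p ℚ.∣ p ℚ.- q ∣ (ℚₚ.0≤∣p∣ (p ℚ.- q)) (∣p-q∣≤r⇒q≤p+r p q ℚₚ.≤-refl))
  where
  half : ∀ p q r → 0ℚ ℚ.≤ r → p ℚ.≤ q ℚ.+ r → 0ℚ ℚ.⊔ p ℚ.≤ (0ℚ ℚ.⊔ q) ℚ.+ r
  half p q r r≥0 h = ℚₚ.⊔-lub (0≤-+ {0ℚ ℚ.⊔ q} {r} (ℚₚ.p≤p⊔q 0ℚ q) r≥0) (ℚₚ.≤-trans h (ℚₚ.+-monoˡ-≤ r (ℚₚ.p≤q⊔p 0ℚ q)))

module Reciprocal (α : ℝ) (α≥0 : 0ℝ ≤ α) where
  -- Approximants of a nonnegative real may be negative. Clipping them at 0 keeps every A n at least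
  -- 1, so that inversion is defined and does not increase distances.
  a A : ℕ → ℚ
  a n = 0ℚ ℚ.⊔ seq α n
  A n = 2ℚ ℚ.* (1ℚ ℚ.+ a n)

  a≥0 : ∀ n → 0ℚ ℚ.≤ a n
  a≥0 n = ℚₚ.p≤p⊔q 0ℚ (seq α n)

  1≤A : ∀ n → 1ℚ ℚ.≤ A n
  1≤A n = ≤-from-gap (0≤-+ 0≤1 (0≤-* (0≤-+ 0≤1 0≤1) (a≥0 n)))
    (solve 1 (λ a → (con 1ℚ :+ con 1ℚ) :* (con 1ℚ :+ a) :- con 1ℚ := con 1ℚ :+ (con 1ℚ :+ con 1ℚ) :* a) refl (a n))
    where open +-*-Solver

  A>0 : ∀ n → 0ℚ ℚ.< A n
  A>0 n = ℚₚ.<-≤-trans 0<1 (1≤A n)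

  reciprocal : ℝ
  reciprocal = mkℝ (λ n → inv (A n)) λ ε ε>0 →
    let N , h = cauchy α (½ ℚ.* ε) (0<½* ε>0) in N , λ m n m≥ n≥ → ℚₚ.≤-trans
      (subst (ℚ._≤ ℚ.∣ A n ℚ.- A m ∣) (ℚₚ.*-identityʳ ℚ.∣ inv (A m) ℚ.- inv (A n) ∣)
        (∣Δinv∣≤∣Δ∣ {A m} {A n} {1ℚ} (A>0 m) (A>0 n) 0≤1 (1≤A m) (1≤A n)))
      (subst₂ ℚ._≤_ (sym (difference (a n) (a m))) (½+½ ε) (double≤ (ℚₚ.≤-trans (0⊔-nonexpansive (seq α n) (seq α m)) (h n m n≥ m≥))))
    where
    factor : ∀ x y → 2ℚ ℚ.* (1ℚ ℚ.+ x) ℚ.- 2ℚ ℚ.* (1ℚ ℚ.+ y) ≡ (x ℚ.- y) ℚ.* 2ℚ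
    factor = solve 2 (λ x y → con 2ℚ :* (con 1ℚ :+ x) :- con 2ℚ :* (con 1ℚ :+ y) := (x :- y) :* con 2ℚ) refl where open +-*-Solver
    twice : ∀ x → x ℚ.* 2ℚ ≡ x ℚ.+ x
    twice = solve 1 (λ x → x :* con 2ℚ := x :+ x) refl where open +-*-Solver
    difference : ∀ x y → ℚ.∣ 2ℚ ℚ.* (1ℚ ℚ.+ x) ℚ.- 2ℚ ℚ.* (1ℚ ℚ.+ y) ∣ ≡ ℚ.∣ x ℚ.- y ∣ ℚ.+ ℚ.∣ x ℚ.- y ∣
    difference x y = trans (cong ℚ.∣_∣ (factor x y)) (trans (∣p*q∣≡∣p∣*q (x ℚ.- y) (0≤-+ 0≤1 0≤1)) (twice ℚ.∣ x ℚ.- y ∣))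
    double≤ : ∀ {x y} → x ℚ.≤ y → x ℚ.+ x ℚ.≤ y ℚ.+ y
    double≤ h = ℚₚ.+-mono-≤ h h

  reciprocal≥0 : 0ℝ ≤ reciprocal
  reciprocal≥0 = ≤-pointwise {0ℝ} {reciprocal} 0 λ n _ → 0≤inv (A>0 n)

  α⁺ : ℝ
  α⁺ = mkℝ a λ ε ε>0 → let N , h = cauchy α ε ε>0 in N , λ m n m≥ n≥ → ℚₚ.≤-trans (0⊔-nonexpansive (seq α m) (seq α n)) (h m n m≥ n≥)

  α⁺≤α : α⁺ ≤ α
  α⁺≤α ε ε>0 = let N , h = α≥0 ε ε>0 in N , λ n n≥ → ℚₚ.⊔-lub (h n n≥) (p≤p+q (seq α n) (ℚₚ.<⇒≤ ε>0))

  reciprocal-inverse : reciprocal * (2ℝ * (1ℝ + α)) ≈ 1ℝ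
  reciprocal-inverse =
    ≤ℝ-trans {reciprocal * (2ℝ * (1ℝ + α))} {reciprocal * (2ℝ * (1ℝ + α⁺))} {1ℝ}
      (scaled {α} {α⁺} (≤-pointwise {α} {α⁺} 0 λ n _ → ℚₚ.p≤q⊔p 0ℚ (seq α n)))
      (≤-pointwise {reciprocal * (2ℝ * (1ℝ + α⁺))} {1ℝ} 0 λ n _ → ℚₚ.≤-reflexive (unit n)) ,
    ≤ℝ-trans {1ℝ} {reciprocal * (2ℝ * (1ℝ + α⁺))} {reciprocal * (2ℝ * (1ℝ + α))}
      (≤-pointwise {1ℝ} {reciprocal * (2ℝ * (1ℝ + α⁺))} 0 λ n _ → ℚₚ.≤-reflexive (sym (unit n)))
      (scaled {α⁺} {α} α⁺≤α)
    where
    scaled : ∀ {x y} → x ≤ y → reciprocal * (2ℝ * (1ℝ + x)) ≤ reciprocal * (2ℝ * (1ℝ + y))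
    scaled {x} {y} h = *ℝ-monoˡ-≤ {reciprocal} {2ℝ * (1ℝ + x)} {2ℝ * (1ℝ + y)} reciprocal≥0
      (*ℝ-monoˡ-≤ {2ℝ} {1ℝ + x} {1ℝ + y} (fromℚ-mono (0≤-+ 0≤1 0≤1)) (+ℝ-mono-≤ {1ℝ} {1ℝ} {x} {y} (≤ℝ-refl {1ℝ}) h))
    unit : ∀ n → inv (A n) ℚ.* A n ≡ 1ℚ
    unit n = trans (ℚₚ.*-comm (inv (A n)) (A n)) (*inv (A>0 n))

  -- Moving a slope x by θ changes 2 s (1 + x) by η / 2, half of the room provided by `product`.
  margin : ∀ s → 0ℚ ℚ.< s → ∀ η → 0ℚ ℚ.< η → ∃ λ θ → 0ℚ ℚ.< θ × (2ℚ ℚ.* s) ℚ.* θ ≡ ½ ℚ.* η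
  margin s s>0 η η>0 = (½ ℚ.* η) ℚ.* inv (2ℚ ℚ.* s) , 0<-* (0<½* η>0) (0<inv 2s>0) ,
    trans (ℚₚ.*-comm (2ℚ ℚ.* s) ((½ ℚ.* η) ℚ.* inv (2ℚ ℚ.* s))) (*-inv-cancel (½ ℚ.* η) 2s>0)
    where
    2s>0 : 0ℚ ℚ.< 2ℚ ℚ.* s
    2s>0 = 0<-* (0<-+ 0<1 0≤1) s>0

  near : ∀ θ → 0ℚ ℚ.< θ → ∀ M → ∃ λ n → M ℕ.≤ n × ∀ m → n ℕ.≤ m → ℚ.∣ seq α n ℚ.- seq α m ∣ ℚ.≤ ½ ℚ.* θ
  near θ θ>0 M = let N , h = cauchy α (½ ℚ.* θ) (0<½* θ>0) in
    M ℕ.⊔ N , ℕₚ.m≤m⊔n M N , λ m m≥ → h (M ℕ.⊔ N) m (ℕₚ.m≤n⊔m M N) (ℕₚ.≤-trans (ℕₚ.m≤n⊔m M N) m≥)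

  -- At a late index n the hypothesis gives 2 s (1 + a n) ≥ 1 + η. If a n ≤ θ, then β = 0 is close
  -- enough; otherwise β = a n - θ, which stays θ/2 below α because later approximants move by at
  -- most θ/2.
  choose-above : ∀ s η → 0ℚ ℚ.< s → 0ℚ ℚ.< η → reciprocal ≤ fromℚ (s ℚ.- (η ℚ.+ η)) →
    ∃ λ β → 0ℚ ℚ.≤ β × 1ℚ ℚ.< (2ℚ ℚ.* s) ℚ.* (1ℚ ℚ.+ β) × (β ≡ 0ℚ ⊎ ¬ (α ≤ fromℚ β))
  choose-above s η s>0 η>0 d≤ =
    let M , hM = d≤ η η>0
        θ , θ>0 , 2sθ≡ = margin s s>0 η η>0
        n , M≤n , close = near θ θ>0 M
    in decide n θ θ>0 2sθ≡ (product n (hM n M≤n)) close (ℚₚ.≤-total (a n) θ)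
    where
    open +-*-Solver
    product : ∀ n → inv (A n) ℚ.≤ (s ℚ.- (η ℚ.+ η)) ℚ.+ η → 1ℚ ℚ.+ η ℚ.≤ (2ℚ ℚ.* s) ℚ.* (1ℚ ℚ.+ a n)
    product n h = ℚₚ.≤-trans (ℚₚ.+-monoʳ-≤ 1ℚ (subst (ℚ._≤ η ℚ.* A n) (ℚₚ.*-identityʳ η) (*-monoˡ-≤ η (ℚₚ.<⇒≤ η>0) (1≤A n))))
      (subst₂ ℚ._≤_ (trans (ℚₚ.*-distribʳ-+ (A n) (inv (A n)) η) (cong (ℚ._+ η ℚ.* A n) (trans (ℚₚ.*-comm (inv (A n)) (A n)) (*inv (A>0 n)))))
        (solve 2 (λ s a → s :* (con 2ℚ :* (con 1ℚ :+ a)) := (con 2ℚ :* s) :* (con 1ℚ :+ a)) refl s (a n))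
        (*-monoʳ-≤ {inv (A n) ℚ.+ η} {s} (A n) (ℚₚ.<⇒≤ (A>0 n)) (≤-from-gap (p≤q⇒0≤q-p h)
          (solve 3 (λ s η i → s :- (i :+ η) := ((s :- (η :+ η)) :+ η) :- i) refl s η (inv (A n))))))
    bound : ∀ a β θ → (2ℚ ℚ.* s) ℚ.* θ ≡ ½ ℚ.* η → 1ℚ ℚ.+ η ℚ.≤ (2ℚ ℚ.* s) ℚ.* (1ℚ ℚ.+ a) → a ℚ.≤ β ℚ.+ θ → 1ℚ ℚ.< (2ℚ ℚ.* s) ℚ.* (1ℚ ℚ.+ β)
    bound a β θ 2sθ≡ h a≤ = ℚₚ.<-≤-trans (<-from-gap (0<½* η>0) (solve 1 (λ e → (con 1ℚ :+ e) :- con 1ℚ := e) refl (½ ℚ.* η)))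
      (≤-from-gap (0≤-+ (p≤q⇒0≤q-p h) (0≤-* (0≤-* (0≤-+ 0≤1 0≤1) (ℚₚ.<⇒≤ s>0)) (p≤q⇒0≤q-p a≤)))
        (trans (cong (λ e → x ℚ.* (1ℚ ℚ.+ β) ℚ.- (1ℚ ℚ.+ e)) (sym 2sθ≡)) (trans (expand x a β θ)
          (cong (λ e → (x ℚ.* (1ℚ ℚ.+ a) ℚ.- (1ℚ ℚ.+ e)) ℚ.+ x ℚ.* ((β ℚ.+ θ) ℚ.- a)) (trans (cong₂ ℚ._+_ 2sθ≡ 2sθ≡) (½+½ η))))))
      where
      x = 2ℚ ℚ.* s
      expand : ∀ x a β θ → x ℚ.* (1ℚ ℚ.+ β) ℚ.- (1ℚ ℚ.+ x ℚ.* θ) ≡ (x ℚ.* (1ℚ ℚ.+ a) ℚ.- (1ℚ ℚ.+ (x ℚ.* θ ℚ.+ x ℚ.* θ))) ℚ.+ x ℚ.* ((β ℚ.+ θ) ℚ.- a)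
      expand = solve 4 (λ x a β θ → x :* (con 1ℚ :+ β) :- (con 1ℚ :+ x :* θ) := (x :* (con 1ℚ :+ a) :- (con 1ℚ :+ (x :* θ :+ x :* θ))) :+ x :* ((β :+ θ) :- a)) refl
    decide : ∀ n θ → 0ℚ ℚ.< θ → (2ℚ ℚ.* s) ℚ.* θ ≡ ½ ℚ.* η → 1ℚ ℚ.+ η ℚ.≤ (2ℚ ℚ.* s) ℚ.* (1ℚ ℚ.+ a n) →
      (∀ m → n ℕ.≤ m → ℚ.∣ seq α n ℚ.- seq α m ∣ ℚ.≤ ½ ℚ.* θ) → a n ℚ.≤ θ ⊎ θ ℚ.≤ a n →
      ∃ λ β → 0ℚ ℚ.≤ β × 1ℚ ℚ.< (2ℚ ℚ.* s) ℚ.* (1ℚ ℚ.+ β) × (β ≡ 0ℚ ⊎ ¬ (α ≤ fromℚ β))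
    decide n θ θ>0 2sθ≡ h close (inj₁ a≤θ) = 0ℚ , ℚₚ.≤-refl , bound (a n) 0ℚ θ 2sθ≡ h (subst (a n ℚ.≤_) (sym (ℚₚ.+-identityˡ θ)) a≤θ) , inj₁ refl
    decide n θ θ>0 2sθ≡ h close (inj₂ θ≤a) = β , p≤q⇒0≤q-p θ≤a , bound (a n) β θ 2sθ≡ h (ℚₚ.≤-reflexive (sym a≡β+θ)) ,
      inj₂ (<ℝ⇒≱ {fromℚ β} {α} (½ ℚ.* θ , 0<½* θ>0 , n , λ m n≤m → step (seq α n) (seq α m) θ β a≡β+θ (∣p-q∣≤r⇒p≤q+r (seq α n) (seq α m) (close m n≤m)) α≡a))
      where
      β = a n ℚ.- θ
      a≡β+θ : β ℚ.+ θ ≡ a n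
      a≡β+θ = solve 2 (λ a θ → (a :- θ) :+ θ := a) refl (a n) θ
      α≡a : a n ≡ seq α n
      α≡a = positive-part (ℚₚ.⊔-sel 0ℚ (seq α n))
        where
        positive-part : a n ≡ 0ℚ ⊎ a n ≡ seq α n → a n ≡ seq α n
        positive-part (inj₁ a≡0) = ⊥-elim (ℚₚ.<-irrefl refl (ℚₚ.<-≤-trans θ>0 (subst (θ ℚ.≤_) a≡0 θ≤a)))
        positive-part (inj₂ eq) = eq
      step : ∀ x y θ β {z} → β ℚ.+ θ ≡ z → x ℚ.≤ y ℚ.+ ½ ℚ.* θ → z ≡ x → β ℚ.+ ½ ℚ.* θ ℚ.≤ y
      step x y θ β refl h refl = ≤-from-gap (p≤q⇒0≤q-p h)
        (solve 3 (λ y θ β → y :- (β :+ con ½ :* θ) := (y :+ con ½ :* θ) :- (β :+ θ)) refl y θ β)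

  -- The mirror image with γ = a n + θ; it is nonnegative and lies above α, so no case distinction
  -- arises.
  choose-below : ∀ t η → 0ℚ ℚ.< t → 0ℚ ℚ.< η → fromℚ (t ℚ.+ (η ℚ.+ η)) ≤ reciprocal →
    ∃ λ γ → 0ℚ ℚ.≤ γ × (2ℚ ℚ.* t) ℚ.* (1ℚ ℚ.+ γ) ℚ.< 1ℚ × ¬ (fromℚ γ ≤ α)
  choose-below t η t>0 η>0 ≤d =
    let M , hM = ≤d η η>0
        θ , θ>0 , 2tθ≡ = margin t t>0 η η>0
        n , M≤n , close = near θ θ>0 M
    in a n ℚ.+ θ , 0≤-+ {a n} {θ} (a≥0 n) (ℚₚ.<⇒≤ θ>0) , bound (a n) θ 2tθ≡ (product n (hM n M≤n)) ,
       <ℝ⇒≱ {α} {fromℚ (a n ℚ.+ θ)} (½ ℚ.* θ , 0<½* θ>0 , n , λ m n≤m →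
         step (seq α n) (seq α m) (a n) θ (∣p-q∣≤r⇒q≤p+r (seq α n) (seq α m) (close m n≤m)) (ℚₚ.p≤q⊔p 0ℚ (seq α n)))
    where
    open +-*-Solver
    product : ∀ n → t ℚ.+ (η ℚ.+ η) ℚ.≤ inv (A n) ℚ.+ η → (2ℚ ℚ.* t) ℚ.* (1ℚ ℚ.+ a n) ℚ.+ η ℚ.≤ 1ℚ
    product n h = ℚₚ.≤-trans (ℚₚ.+-monoʳ-≤ ((2ℚ ℚ.* t) ℚ.* (1ℚ ℚ.+ a n)) (subst (ℚ._≤ η ℚ.* A n) (ℚₚ.*-identityʳ η) (*-monoˡ-≤ η (ℚₚ.<⇒≤ η>0) (1≤A n))))
      (subst₂ ℚ._≤_ (solve 3 (λ t η a → (t :+ η) :* (con 2ℚ :* (con 1ℚ :+ a)) := (con 2ℚ :* t) :* (con 1ℚ :+ a) :+ η :* (con 2ℚ :* (con 1ℚ :+ a))) refl t η (a n))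
        (trans (ℚₚ.*-comm (inv (A n)) (A n)) (*inv (A>0 n)))
        (*-monoʳ-≤ {t ℚ.+ η} {inv (A n)} (A n) (ℚₚ.<⇒≤ (A>0 n)) (≤-from-gap (p≤q⇒0≤q-p h)
          (solve 3 (λ t η i → i :- (t :+ η) := (i :+ η) :- (t :+ (η :+ η))) refl t η (inv (A n))))))
    bound : ∀ a θ → (2ℚ ℚ.* t) ℚ.* θ ≡ ½ ℚ.* η → (2ℚ ℚ.* t) ℚ.* (1ℚ ℚ.+ a) ℚ.+ η ℚ.≤ 1ℚ → (2ℚ ℚ.* t) ℚ.* (1ℚ ℚ.+ (a ℚ.+ θ)) ℚ.< 1ℚ
    bound a θ 2tθ≡ h = ℚₚ.<-≤-trans (<-from-gap (0<½* η>0) (trans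
      (cong₂ (λ e f → (x ℚ.* (1ℚ ℚ.+ a) ℚ.+ e) ℚ.- f) (sym (½+½ η)) (trans (expand x a θ) (cong (x ℚ.* (1ℚ ℚ.+ a) ℚ.+_) 2tθ≡)))
      (cancel (x ℚ.* (1ℚ ℚ.+ a)) (½ ℚ.* η)))) h
      where
      x = 2ℚ ℚ.* t
      expand : ∀ x a θ → x ℚ.* (1ℚ ℚ.+ (a ℚ.+ θ)) ≡ x ℚ.* (1ℚ ℚ.+ a) ℚ.+ x ℚ.* θ
      expand = solve 3 (λ x a θ → x :* (con 1ℚ :+ (a :+ θ)) := x :* (con 1ℚ :+ a) :+ x :* θ) refl
      cancel : ∀ y e → (y ℚ.+ (e ℚ.+ e)) ℚ.- (y ℚ.+ e) ≡ e
      cancel = solve 2 (λ y e → (y :+ (e :+ e)) :- (y :+ e) := e) refl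
    step : ∀ x y a θ → y ℚ.≤ x ℚ.+ ½ ℚ.* θ → x ℚ.≤ a → y ℚ.+ ½ ℚ.* θ ℚ.≤ a ℚ.+ θ
    step x y a θ h x≤a = ≤-from-gap (0≤-+ (p≤q⇒0≤q-p h) (p≤q⇒0≤q-p x≤a))
      (solve 4 (λ x y a θ → (a :+ θ) :- (y :+ con ½ :* θ) := ((x :+ con ½ :* θ) :- y) :+ (a :- x)) refl x y a θ)

module Theorem (lem : LEM) (ν : ℕ → ℕ) (ν≥1 : ∀ k → 1 ℕ.≤ ν k)
  (α : ℝ∞) (liminf : IsLiminf (λ k → fin (fromℚ (+ ν k ℚ./ suc k))) α) where

  open Dimension lem ν ν≥1 α liminf

  module _ (α′ : ℝ) (α≡ : α ≡ fin α′) where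
    open Reciprocal α′ (subst (fin 0ℝ ≤∞_) α≡ 0≤liminf)

    finite-dimension : IsHausdorffDim (F ν) reciprocal
    finite-dimension =
      (λ s (s≥0 , null) → ¬¬-elim lem λ d≰s → below s s≥0 null (<ℝ-dense {s} {reciprocal} (≰⇒> {reciprocal} {s} lem d≰s))) ,
      (λ b lower → ¬¬-elim lem λ b≰d → above b lower (<ℝ-dense {reciprocal} {b} (≰⇒> {b} {reciprocal} lem b≰d)))
      where
      open +-*-Solver
      below : ∀ s → 0ℝ ≤ s → IsHausdorffMeasure s (F ν) (fin 0ℝ) → ¬ (∃ λ q → ∃ λ ε → 0ℚ ℚ.< ε × s ≤ fromℚ q × fromℚ (q ℚ.+ ε) ≤ reciprocal)
      below s s≥0 null (q , ε , ε>0 , s≤q , q+ε≤d) =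
        let q≥0 = fromℚ-cancel (≤ℝ-trans {0ℝ} {s} {fromℚ q} s≥0 s≤q)
            -- One half of ε makes t positive even when q = 0; the other half is the 2 η that
            -- `choose-below` consumes.
            t = ½ ℚ.* ε ℚ.+ q
            t>0 = 0<-+ {½ ℚ.* ε} {q} (0<½* ε>0) q≥0
            η = ½ ℚ.* (½ ℚ.* ε)
            t+2η≡ = solve 2 (λ q ε → (con ½ :* ε :+ q) :+ (con ½ :* (con ½ :* ε) :+ con ½ :* (con ½ :* ε)) := q :+ ε) refl q ε
            γ , γ≥0 , h , γ≰α = choose-below t η t>0 (0<½* (0<½* ε>0)) (subst (λ x → fromℚ x ≤ reciprocal) (sym t+2η≡) q+ε≤d)
        in positive-measure-at {s} {t} {γ} (≤ℝ-trans {s} {fromℚ q} {fromℚ t} s≤q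
             (fromℚ-mono (subst (q ℚ.≤_) (ℚₚ.+-comm q (½ ℚ.* ε)) (p≤p+q q (ℚₚ.<⇒≤ (0<½* ε>0)))))) t>0 γ≥0 h
             (subst (λ α → ¬ (fin (fromℚ γ) ≤∞ α)) (sym α≡) γ≰α) null
      above : ∀ b → (∀ s → 0ℝ ≤ s × IsHausdorffMeasure s (F ν) (fin 0ℝ) → b ≤ s) →
        ¬ (∃ λ q → ∃ λ ε → 0ℚ ℚ.< ε × reciprocal ≤ fromℚ q × fromℚ (q ℚ.+ ε) ≤ b)
      above b lower (q , ε , ε>0 , d≤q , q+ε≤b) =
        let q≥0 = fromℚ-cancel (≤ℝ-trans {0ℝ} {reciprocal} {fromℚ q} reciprocal≥0 d≤q)
            -- The middle of [q, q + ε]: the lower half is the 2 η for `choose-above`, the upper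
            -- half contradicts q + ε ≤ b ≤ s.
            s = ½ ℚ.* ε ℚ.+ q
            s>0 = 0<-+ {½ ℚ.* ε} {q} (0<½* ε>0) q≥0
            η = ½ ℚ.* (½ ℚ.* ε)
            s-2η≡ = solve 2 (λ q ε → (con ½ :* ε :+ q) :- (con ½ :* (con ½ :* ε) :+ con ½ :* (con ½ :* ε)) := q) refl q ε
            β , β≥0 , h , cases = choose-above s η s>0 (0<½* (0<½* ε>0)) (subst (λ x → reciprocal ≤ fromℚ x) (sym s-2η≡) d≤q)
            null = zero-measure-at {s} {β} (ℚₚ.<⇒≤ s>0) β≥0 h (subst (λ α → β ≡ 0ℚ ⊎ ¬ (α ≤∞ fin (fromℚ β))) (sym α≡) cases)
            q+ε≤s = fromℚ-cancel (≤ℝ-trans {fromℚ (q ℚ.+ ε)} {b} {fromℚ s} q+ε≤b (lower (fromℚ s) (fromℚ-mono (ℚₚ.<⇒≤ s>0) , null)))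
        in ℚₚ.<-irrefl refl (ℚₚ.<-≤-trans (<-from-gap (0<½* ε>0)
             (solve 2 (λ q ε → (q :+ ε) :- (con ½ :* ε :+ q) := con ½ :* ε) refl q ε)) q+ε≤s)

    finite-case : ∃ λ d → d * (2ℝ * (1ℝ + α′)) ≈ 1ℝ × IsHausdorffDim (F ν) d
    finite-case = reciprocal , reciprocal-inverse , finite-dimension

  infinite-dimension : α ≡ ∞ → IsHausdorffDim (F ν) 0ℝ
  infinite-dimension α≡∞ = (λ s → proj₁) , λ b lower → ≤0-from-ε {b} λ s s>0 → lower (fromℚ s) (fromℚ-mono (ℚₚ.<⇒≤ s>0) ,
    -- Every rational slope is below ∞, and β = 1 / s gives 2 s (1 + β) = 2 s + 2 > 1.
    zero-measure-at {s} {inv s} (ℚₚ.<⇒≤ s>0) (0≤inv s>0) (large s s>0) (inj₂ (subst (λ α → ¬ (α ≤∞ fin (fromℚ (inv s)))) (sym α≡∞) λ ())))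
    where
    large : ∀ s → 0ℚ ℚ.< s → 1ℚ ℚ.< (2ℚ ℚ.* s) ℚ.* (1ℚ ℚ.+ inv s)
    large s s>0 = <-from-gap (0<-+ 0<1 (0≤-* (0≤-+ 0≤1 0≤1) (ℚₚ.<⇒≤ s>0)))
      (trans (expand s (inv s)) (trans (cong (λ t → (2ℚ ℚ.* s ℚ.+ 2ℚ ℚ.* t) ℚ.- 1ℚ) (*inv s>0)) (final s)))
      where
      open +-*-Solver
      expand : ∀ s i → (2ℚ ℚ.* s) ℚ.* (1ℚ ℚ.+ i) ℚ.- 1ℚ ≡ (2ℚ ℚ.* s ℚ.+ 2ℚ ℚ.* (s ℚ.* i)) ℚ.- 1ℚ
      expand = solve 2 (λ s i → (con 2ℚ :* s) :* (con 1ℚ :+ i) :- con 1ℚ := (con 2ℚ :* s :+ con 2ℚ :* (s :* i)) :- con 1ℚ) refl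
      final : ∀ s → (2ℚ ℚ.* s ℚ.+ 2ℚ ℚ.* 1ℚ) ℚ.- 1ℚ ≡ 1ℚ ℚ.+ 2ℚ ℚ.* s
      final = solve 1 (λ s → (con 2ℚ :* s :+ con 2ℚ :* con 1ℚ) :- con 1ℚ := con 1ℚ :+ con 2ℚ :* s) refl

lem-from : ExcludedMiddle (lsuc 0ℓ) → LEM
lem-from em P with em {Lift (lsuc 0ℓ) P}
... | yes (lift p) = yes p
... | no ¬p = no (¬p ∘ lift)

theorem1p1 : ExcludedMiddle (lsuc 0ℓ) →
    (ν : ℕ → ℕ) → (∀ k → 1 ℕ.≤ ν k) → (∀ k → ν k ℕ.≤ ν (suc k)) →
    (α : ℝ∞) → IsLiminf (λ k → fin (fromℚ (+ ν k ℚ./ suc k))) α →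
    ((α′ : ℝ) → α ≡ fin α′ →
    ∃ λ d → d * (2ℝ * (1ℝ + α′)) ≈ 1ℝ × IsHausdorffDim (F ν) d) ×
    (α ≡ ∞ → IsHausdorffDim (F ν) 0ℝ)
theorem1p1 em ν ν≥1 _ α liminf = finite-case , infinite-dimension
  where open Theorem (lem-from em) ν ν≥1 α liminf
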